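{- We have \[ \sum_{n=0}^{\infty}b_9(4n+3)q^{n}=3\,\frac{f_2^{2}f_6^{2}f_9}{f_1^{5}} . \] In particular $b_9(4n+3)\equiv 0\pmod 3$ for all $n\ge0$.
   Context: $b_9(n)$ is the number of partitions of $n$ none of whose parts is divisible by $9$; equivalently $\sum_{n\ge0}b_9(n)q^n=f_9/f_1$, where $f_k=\prod_{j\ge1}(1-q^{jk})$. -}

module Defs where

open import Data.Nat as ℕ using (ℕ; zero; suc; _∸_; _/_)
open import Data.Nat.Divisibility using (_∣?_)
open import Data.Integer as ℤ using (ℤ; +_; -_)
open import Data.List using (List; []; _∷_)
open import Relation.Nullary using (yes; no)

sumℕ : ℕ → (ℕ → ℕ) → ℕ
sumℕ zero    g = g 0
sumℕ (suc n) g = sumℕ n g ℕ.+ g (suc n)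

-- count n m = number of partitions of n into parts ≤ m, none divisible by 9
-- (choose the multiplicity t of the largest allowed part m).
count : ℕ → ℕ → ℕ
count zero    zero    = 1
count (suc _) zero    = 0
count n       (suc m) with 9 ∣? suc m
... | yes _ = count n m
... | no  _ = sumℕ (n / suc m) (λ t → count (n ∸ t ℕ.* suc m) m)

b₉ : ℕ → ℕ
b₉ n = count n n

Series : Set
Series = ℕ → ℤ

sumℤ : ℕ → (ℕ → ℤ) → ℤ
sumℤ zero    g = g 0
sumℤ (suc n) g = sumℤ n g ℤ.+ g (suc n)

_⊛_ : Series → Series → Series
(a ⊛ b) n = sumℤ n (λ i → a i ℤ.* b (n ∸ i))
infixl 7 _⊛_

one : Series
one zero    = + 1
one (suc _) = + 0

_^ˢ_ : Series → ℕ → Series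
a ^ˢ zero  = one
a ^ˢ suc k = a ⊛ (a ^ˢ k)
infixr 8 _^ˢ_

_·ˢ_ : ℤ → Series → Series
(c ·ˢ a) n = c ℤ.* a n

-- 1 - q^m  (used with m ≥ 1)
oneMinusQ^ : ℕ → Series
oneMinusQ^ m n with n ℕ.≟ 0 | n ℕ.≟ m
... | yes _ | _     = + 1
... | no _  | yes _ = - (+ 1)
... | no _  | no _  = + 0

prodTo : ℕ → ℕ → Series
prodTo k zero    = one
prodTo k (suc N) = prodTo k N ⊛ oneMinusQ^ (suc N ℕ.* k)

-- f_k = ∏_{j≥1} (1 - q^{jk}); for k ≥ 1 the coefficient of q^n only depends
-- on the factors with j ≤ n.
f : ℕ → Series
f k n = prodTo k n n

-- Multiplicative inverse of a series a with constant term 1.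
-- invL a n = [c_n , c_{n-1} , … , c_0] where c_0 = 1 and
-- c_m = - Σ_{i=1}^{m} a_i c_{m-i}.
private
  conv : Series → ℕ → List ℤ → ℤ
  conv a j []       = + 0
  conv a j (x ∷ xs) = a (suc j) ℤ.* x ℤ.+ conv a (suc j) xs

invL : Series → ℕ → List ℤ
invL a zero    = + 1 ∷ []
invL a (suc n) = (- conv a 0 (invL a n)) ∷ invL a n

inv : Series → Series
inv a n with invL a n
... | []    = + 0
... | c ∷ _ = c

{-# OPTIONS --safe #-}

-- Write E_k = f_k(q).  With θ_G(q) = Σ (-ω)^n q^(n²) = E_2² E_3 / (E_1 E_6), the Jacobi triple product gives
-- θ_G(q) θ_G(q³) = E_2² E_6 E_9 / (E_1 E_18), a sum over the quadratic form m² + 3n².  A unit of ℤ[ω]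
-- rearranges its odd part into another product of theta functions, and hence
--   Σ b₉(2n+1) qⁿ = E_2² E_3 E_18 / (E_1³ E_6).
-- Here E_3 / E_1³ is, up to a series in q², the product θ_G(q) Σ q^(n²), a sum over m² + n² whose odd
-- part is 3 q E_12².  This gives the progression 4n+3.
-- The triple product is used only in the variable t = z + 1/z with t ∈ {2, 1, -1}, so all coefficients are
-- integers; the lattice sums are finite because they are formed in ℤ[[q]]/q^(N+1), where q is nilpotent.
module Submission where

open import Defs
open import Algebra.Bundles using (CommutativeRing)
open import Algebra.Solver.Ring.AlmostCommutativeRing
  using (fromCommutativeRing; _-Raw-AlmostCommutative⟶_)
import Algebra.Solver.Ring
import Algebra.Properties.Ring as RingProperties
import Algebra.Properties.CommutativeSemiring.Exp as Exp
import Algebra.Properties.Semiring.Mult.TCOptimised as Mult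
open import Data.Nat as ℕ using (ℕ; zero; suc; z≤n; s≤s)
import Data.Nat.Properties as ℕₚ
open import Data.Nat.DivMod using (m<n⇒m/n≡0; m/n≡1+[m∸n]/n)
open import Data.Nat.Divisibility using (_∣_; _∣?_; divides; n∣m*n; ∣m+n∣m⇒∣n; ∣⇒≤)
import Data.Nat.Solver
open import Data.Integer as ℤ using (ℤ; +_; -[1+_]; ∣_∣)
import Data.Integer.Properties as ℤₚ
import Data.Integer.Solver
open import Data.List using (List; []; _∷_)
open import Data.Maybe.Base using (Maybe; just; nothing)
open import Data.Product using (Σ; _×_; _,_; proj₁; proj₂)
open import Level using (_⊔_)
open import Relation.Binary.Definitions using (tri<; tri≈; tri>)
open import Relation.Nullary using (¬_; yes; no; contradiction)
open import Relation.Binary.PropositionalEquality using (_≡_)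
import Relation.Binary.PropositionalEquality as ≡
import Relation.Binary.Reasoning.Setoid as SetoidReasoning

open Data.Nat.Solver.+-*-Solver using ()
  renaming (solve to ℕ-solve; _:+_ to _:+ⁿ_; _:*_ to _:*ⁿ_; con to conⁿ; _:=_ to _:=ⁿ_)
open Data.Integer.Solver.+-*-Solver using ()
  renaming (solve to ℤ-solve; _:+_ to _:+ᶻ_; _:*_ to _:*ᶻ_; _:-_ to _:-ᶻ_; :-_ to :-ᶻ_; con to conᶻ; _:=_ to _:=ᶻ_)

-- No root of unity is adjoined to the ring. The powers of z are replaced by a sequence `W` on ℤ
-- with W(n+1) + W(n-1) = t W(n), that is, by a linear functional applied to z^n. Its normalisation
-- to 2 admits z^n + z^(-n) without a division. Each theta function is therefore half of a lattice
-- sum, each product of two of them carries a factor 4, and this 4 is cancelled coefficientwise in ℤ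
-- once the odd coefficients have been read off. The factor 3 of the theorem comes from (1 +
-- z^(-1))² = 3 z^(-1) for a primitive sixth root of unity z. The even halves of the two lattice
-- sums are never evaluated: it suffices that they lie in the subring generated by q². The eta
-- products multiplied onto b and c are series in q² as well, so they pass through the extraction of
-- odd coefficients. Nilpotency of q also replaces division: a factor 1 - q^k with k > 0 is
-- cancellable, so eta quotients are stated with their denominators multiplied out.

module _ {c ℓ} (R : CommutativeRing c ℓ) where

  open CommutativeRing R
  open SetoidReasoning setoid
  open RingProperties ring
    using (x∙y⁻¹≈ε⇒x≈y; -0#≈0#; -‿involutive; -‿+-comm; -‿distribˡ-*; -‿distribʳ-*)
  open Exp commutativeSemiring using (_^_; ^-homo-*; ^-assocʳ; ^-congˡ)
  open Mult semiring using (×-homo-+; ×1-homo-*) renaming (_×_ to _⋆_)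

  -- Integer constants in a commutative ring, for the ring solver.

  fromℤ : ℤ → Carrier
  fromℤ (+ n)    = n ⋆ 1#
  fromℤ -[1+ n ] = - (suc n ⋆ 1#)

  fromℤ-neg : ∀ i → fromℤ (ℤ.- i) ≈ - fromℤ i
  fromℤ-neg (+ zero)  = sym -0#≈0#
  fromℤ-neg (+ suc n) = refl
  fromℤ-neg -[1+ n ]  = sym (-‿involutive _)

  suc-× : ∀ n → suc n ⋆ 1# ≈ 1# + n ⋆ 1#
  suc-× n = ×-homo-+ 1# 1 n

  [1+x]-[1+y] : ∀ x y → (1# + x) - (1# + y) ≈ x - y
  [1+x]-[1+y] x y = begin
    (1# + x) - (1# + y)        ≈⟨ +-congˡ (-‿+-comm 1# y) ⟨
    (1# + x) + (- 1# - y)      ≈⟨ +-congʳ (+-comm 1# x) ⟩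
    (x + 1#) + (- 1# - y)      ≈⟨ +-assoc x 1# _ ⟩
    x + (1# + (- 1# - y))      ≈⟨ +-congˡ (+-assoc 1# (- 1#) (- y)) ⟨
    x + ((1# - 1#) - y)        ≈⟨ +-congˡ (+-congʳ (-‿inverseʳ 1#)) ⟩
    x + (0# - y)               ≈⟨ +-congˡ (+-identityˡ (- y)) ⟩
    x - y                      ∎

  fromℤ-⊖ : ∀ m n → fromℤ (m ℤ.⊖ n) ≈ m ⋆ 1# - n ⋆ 1#
  fromℤ-⊖ m zero = begin
    m ⋆ 1#         ≈⟨ +-identityʳ _ ⟨
    m ⋆ 1# + 0#    ≈⟨ +-congˡ -0#≈0# ⟨
    m ⋆ 1# - 0#    ∎
  fromℤ-⊖ zero    (suc n) = sym (+-identityˡ _)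
  fromℤ-⊖ (suc m) (suc n) = begin
    fromℤ (suc m ℤ.⊖ suc n)            ≈⟨ reflexive (≡.cong fromℤ (ℤₚ.[1+m]⊖[1+n]≡m⊖n m n)) ⟩
    fromℤ (m ℤ.⊖ n)                    ≈⟨ fromℤ-⊖ m n ⟩
    m ⋆ 1# - n ⋆ 1#                    ≈⟨ [1+x]-[1+y] _ _ ⟨
    (1# + m ⋆ 1#) - (1# + n ⋆ 1#)      ≈⟨ +-cong (suc-× m) (-‿cong (suc-× n)) ⟨
    suc m ⋆ 1# - suc n ⋆ 1#            ∎

  fromℤ-+ : ∀ i j → fromℤ (i ℤ.+ j) ≈ fromℤ i + fromℤ j
  fromℤ-+ (+ m)    (+ n)    = ×-homo-+ 1# m n
  fromℤ-+ (+ m)    -[1+ n ] = fromℤ-⊖ m (suc n)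
  fromℤ-+ -[1+ m ] (+ n)    = trans (fromℤ-⊖ n (suc m)) (+-comm _ _)
  fromℤ-+ -[1+ m ] -[1+ n ] = begin
    - (suc (suc (m ℕ.+ n)) ⋆ 1#)       ≈⟨ reflexive (≡.cong (λ k → - (suc k ⋆ 1#)) (ℕₚ.+-suc m n)) ⟨
    - ((suc m ℕ.+ suc n) ⋆ 1#)         ≈⟨ -‿cong (×-homo-+ 1# (suc m) (suc n)) ⟩
    - (suc m ⋆ 1# + suc n ⋆ 1#)        ≈⟨ -‿+-comm _ _ ⟨
    - (suc m ⋆ 1#) - suc n ⋆ 1#        ∎

  fromℤ-*⁺ : ∀ m n → fromℤ (+ m ℤ.* + n) ≈ (m ⋆ 1#) * (n ⋆ 1#)
  fromℤ-*⁺ m n = trans (reflexive (≡.cong fromℤ (≡.sym (ℤₚ.pos-* m n)))) (×1-homo-* m n)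

  fromℤ-*-neg : ∀ i n → fromℤ (i ℤ.* + suc n) ≈ fromℤ i * (suc n ⋆ 1#) →
                fromℤ (i ℤ.* -[1+ n ]) ≈ fromℤ i * - (suc n ⋆ 1#)
  fromℤ-*-neg i n eq = begin
    fromℤ (i ℤ.* -[1+ n ])             ≈⟨ reflexive (≡.cong fromℤ (≡.sym (ℤₚ.neg-distribʳ-* i (+ suc n)))) ⟩
    fromℤ (ℤ.- (i ℤ.* + suc n))        ≈⟨ fromℤ-neg (i ℤ.* + suc n) ⟩
    - fromℤ (i ℤ.* + suc n)            ≈⟨ -‿cong eq ⟩
    - (fromℤ i * (suc n ⋆ 1#))         ≈⟨ -‿distribʳ-* _ _ ⟩
    fromℤ i * - (suc n ⋆ 1#)           ∎

  fromℤ-*ᵖ : ∀ i n → fromℤ (i ℤ.* + n) ≈ fromℤ i * (n ⋆ 1#)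
  fromℤ-*ᵖ (+ m)    n = fromℤ-*⁺ m n
  fromℤ-*ᵖ -[1+ m ] n = begin
    fromℤ (-[1+ m ] ℤ.* + n)           ≈⟨ reflexive (≡.cong fromℤ (≡.sym (ℤₚ.neg-distribˡ-* (+ suc m) (+ n)))) ⟩
    fromℤ (ℤ.- (+ suc m ℤ.* + n))      ≈⟨ fromℤ-neg (+ suc m ℤ.* + n) ⟩
    - fromℤ (+ suc m ℤ.* + n)          ≈⟨ -‿cong (fromℤ-*⁺ (suc m) n) ⟩
    - ((suc m ⋆ 1#) * (n ⋆ 1#))        ≈⟨ -‿distribˡ-* _ _ ⟩
    - (suc m ⋆ 1#) * (n ⋆ 1#)          ∎

  fromℤ-* : ∀ i j → fromℤ (i ℤ.* j) ≈ fromℤ i * fromℤ j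
  fromℤ-* i (+ n)    = fromℤ-*ᵖ i n
  fromℤ-* i -[1+ n ] = fromℤ-*-neg i n (fromℤ-*ᵖ i (suc n))

  fromℤ-morphism : CommutativeRing.rawRing ℤₚ.+-*-commutativeRing
                     -Raw-AlmostCommutative⟶ fromCommutativeRing R
  fromℤ-morphism = record
    { ⟦_⟧ = fromℤ ; +-homo = fromℤ-+ ; *-homo = fromℤ-* ; -‿homo = fromℤ-neg
    ; 0-homo = refl ; 1-homo = refl }

  fromℤ-≟ : ∀ i j → Maybe (fromℤ i ≈ fromℤ j)
  fromℤ-≟ i j with i ℤ.≟ j
  ... | yes ≡.refl = just refl
  ... | no  _      = nothing

  open Algebra.Solver.Ring _ _ fromℤ-morphism fromℤ-≟ using (solve; con; _:+_; _:*_; _:-_; :-_; _:=_)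

  -- Symmetric sums over the integers

  Σᶻ : ℕ → (ℤ → Carrier) → Carrier
  Σᶻ zero    g = g (+ 0)
  Σᶻ (suc K) g = Σᶻ K g + (g (+ suc K) + g -[1+ K ])

  Σᶻ-cong : ∀ {g h} → (∀ i → g i ≈ h i) → ∀ K → Σᶻ K g ≈ Σᶻ K h
  Σᶻ-cong g≈h zero    = g≈h (+ 0)
  Σᶻ-cong g≈h (suc K) = +-cong (Σᶻ-cong g≈h K) (+-cong (g≈h _) (g≈h _))

  Σᶻ-zero : ∀ {g} → (∀ i → g i ≈ 0#) → ∀ K → Σᶻ K g ≈ 0#
  Σᶻ-zero g≈0 zero    = g≈0 (+ 0)
  Σᶻ-zero g≈0 (suc K) =
    trans (+-cong (Σᶻ-zero g≈0 K) (trans (+-cong (g≈0 _) (g≈0 _)) (+-identityˡ _))) (+-identityˡ _)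

  Σᶻ-+ : ∀ K g h → Σᶻ K (λ i → g i + h i) ≈ Σᶻ K g + Σᶻ K h
  Σᶻ-+ zero    g h = refl
  Σᶻ-+ (suc K) g h = trans (+-congʳ (Σᶻ-+ K g h))
    (solve 6 (λ a b c d e f → (a :+ b) :+ ((c :+ d) :+ (e :+ f)) := (a :+ (c :+ e)) :+ (b :+ (d :+ f)))
      refl _ _ _ _ _ _)

  Σᶻ-*ˡ : ∀ a K g → Σᶻ K (λ i → a * g i) ≈ a * Σᶻ K g
  Σᶻ-*ˡ a zero    g = refl
  Σᶻ-*ˡ a (suc K) g = trans (+-congʳ (Σᶻ-*ˡ a K g))
    (solve 4 (λ a b c d → a :* b :+ (a :* c :+ a :* d) := a :* (b :+ (c :+ d))) refl _ _ _ _)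

  Σᶻ-*ʳ : ∀ a K g → Σᶻ K (λ i → g i * a) ≈ Σᶻ K g * a
  Σᶻ-*ʳ a K g = trans (Σᶻ-cong (λ i → *-comm (g i) a) K) (trans (Σᶻ-*ˡ a K g) (*-comm a _))

  Σᶻ-swap : ∀ K K′ (F : ℤ → ℤ → Carrier) →
            Σᶻ K (λ i → Σᶻ K′ (F i)) ≈ Σᶻ K′ (λ j → Σᶻ K (λ i → F i j))
  Σᶻ-swap zero    K′ F = refl
  Σᶻ-swap (suc K) K′ F = sym (begin
    Σᶻ K′ (λ j → Σᶻ K (λ i → F i j) + (F (+ suc K) j + F -[1+ K ] j))
      ≈⟨ Σᶻ-+ K′ _ _ ⟩
    Σᶻ K′ (λ j → Σᶻ K (λ i → F i j)) + Σᶻ K′ (λ j → F (+ suc K) j + F -[1+ K ] j)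
      ≈⟨ +-cong (sym (Σᶻ-swap K K′ F)) (Σᶻ-+ K′ _ _) ⟩
    Σᶻ K (λ i → Σᶻ K′ (F i)) + (Σᶻ K′ (F (+ suc K)) + Σᶻ K′ (F -[1+ K ])) ∎)

  Σᶻ-* : ∀ K g h → Σᶻ K g * Σᶻ K h ≈ Σᶻ K (λ i → Σᶻ K (λ j → g i * h j))
  Σᶻ-* K g h = sym (trans (Σᶻ-cong (λ i → Σᶻ-*ˡ (g i) K h) K) (Σᶻ-*ʳ (Σᶻ K h) K g))

  Σᶻ-neg : ∀ K g → Σᶻ K (λ i → g (ℤ.- i)) ≈ Σᶻ K g
  Σᶻ-neg zero    g = refl
  Σᶻ-neg (suc K) g = +-cong (Σᶻ-neg K g) (+-comm _ _)

  -- Support inside [-b, b]. Under this hypothesis a symmetric sum over a large enough range behaves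
  -- like a sum over all of ℤ, so that reindexing leaves no boundary terms.
  Vanishes : ℕ → (ℤ → Carrier) → Set ℓ
  Vanishes b g = ∀ i → b ℕ.< ∣ i ∣ → g i ≈ 0#

  Σᶻ-extend : ∀ {b g} → Vanishes b g → ∀ d → Σᶻ (d ℕ.+ b) g ≈ Σᶻ b g
  Σᶻ-extend v zero    = refl
  Σᶻ-extend {b} v (suc d) = trans
    (+-cong (Σᶻ-extend v d) (trans (+-cong (v _ b<) (v _ b<)) (+-identityˡ 0#)))
    (+-identityʳ _)
    where
    b< : b ℕ.< suc (d ℕ.+ b)
    b< = s≤s (ℕₚ.m≤n+m b d)

  Σᶻ-range : ∀ {b K K′ g} → Vanishes b g → b ℕ.≤ K → b ℕ.≤ K′ → Σᶻ K g ≈ Σᶻ K′ g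
  Σᶻ-range {b} {K} {K′} {g} v b≤K b≤K′ = trans (to b≤K) (sym (to b≤K′))
    where
    to : ∀ {K} → b ℕ.≤ K → Σᶻ K g ≈ Σᶻ b g
    to {K} b≤K = trans
      (reflexive (≡.cong (λ k → Σᶻ k g) (≡.sym (ℕₚ.m∸n+n≡m b≤K)))) (Σᶻ-extend v (K ℕ.∸ b))

  -- Both sides run over the window from -K to K + 1. Keeping the two boundary terms makes the
  -- induction on `K` possible without any hypothesis on `g`.
  Σᶻ-suc-boundary : ∀ K g → Σᶻ K (λ i → g (ℤ.suc i)) + g (ℤ.- (+ K)) ≈ Σᶻ K g + g (+ suc K)
  Σᶻ-suc-boundary zero    g = +-comm _ _
  Σᶻ-suc-boundary (suc K) g = begin
    (Σᶻ K g⁺ + (g (+ suc (suc K)) + g (ℤ.suc -[1+ K ]))) + g -[1+ K ]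
      ≈⟨ +-congʳ (+-congˡ (+-congˡ (reflexive (≡.cong g (suc-neg K))))) ⟩
    (Σᶻ K g⁺ + (g (+ suc (suc K)) + g (ℤ.- (+ K)))) + g -[1+ K ]
      ≈⟨ solve 4 (λ a b c d → (a :+ (b :+ c)) :+ d := (a :+ c) :+ (b :+ d)) refl _ _ _ _ ⟩
    (Σᶻ K g⁺ + g (ℤ.- (+ K))) + (g (+ suc (suc K)) + g -[1+ K ])
      ≈⟨ +-congʳ (Σᶻ-suc-boundary K g) ⟩
    (Σᶻ K g + g (+ suc K)) + (g (+ suc (suc K)) + g -[1+ K ])
      ≈⟨ solve 4 (λ a b c d → (a :+ b) :+ (c :+ d) := (a :+ (b :+ d)) :+ c) refl _ _ _ _ ⟩
    (Σᶻ K g + (g (+ suc K) + g -[1+ K ])) + g (+ suc (suc K)) ∎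
    where
    g⁺ : ℤ → Carrier
    g⁺ i = g (ℤ.suc i)
    suc-neg : ∀ K → ℤ.suc -[1+ K ] ≡ ℤ.- (+ K)
    suc-neg zero    = ≡.refl
    suc-neg (suc K) = ≡.refl

  Σᶻ-suc : ∀ {b K g} → Vanishes b g → b ℕ.< K → Σᶻ K (λ i → g (ℤ.suc i)) ≈ Σᶻ K g
  Σᶻ-suc {b} {K} {g} v b<K = begin
    Σᶻ K (λ i → g (ℤ.suc i))                     ≈⟨ +-identityʳ _ ⟨
    Σᶻ K (λ i → g (ℤ.suc i)) + 0#                ≈⟨ +-congˡ (v _ (≡.subst (b ℕ.<_) (≡.sym (ℤₚ.∣-i∣≡∣i∣ (+ K))) b<K)) ⟨
    Σᶻ K (λ i → g (ℤ.suc i)) + g (ℤ.- (+ K))     ≈⟨ Σᶻ-suc-boundary K g ⟩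
    Σᶻ K g + g (+ suc K)                         ≈⟨ +-congˡ (v _ (ℕₚ.m<n⇒m<1+n b<K)) ⟩
    Σᶻ K g + 0#                                  ≈⟨ +-identityʳ _ ⟩
    Σᶻ K g ∎

  ∣j∣≤∣i+j∣+∣i∣ : ∀ i j → ∣ j ∣ ℕ.≤ ∣ i ℤ.+ j ∣ ℕ.+ ∣ i ∣
  ∣j∣≤∣i+j∣+∣i∣ i j = ≡.subst (λ k → ∣ k ∣ ℕ.≤ ∣ i ℤ.+ j ∣ ℕ.+ ∣ i ∣)
    (ℤ-solve 2 (λ i j → (i :+ᶻ j) :-ᶻ i :=ᶻ j) ≡.refl i j) (ℤₚ.∣i-j∣≤∣i∣+∣j∣ (i ℤ.+ j) i)

  Vanishes-shift : ∀ {b g} i → Vanishes b g → Vanishes (b ℕ.+ ∣ i ∣) (λ j → g (i ℤ.+ j))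
  Vanishes-shift {b} i v j b+∣i∣<∣j∣ = v (i ℤ.+ j)
    (ℕₚ.+-cancelʳ-< ∣ i ∣ b _ (ℕₚ.<-≤-trans b+∣i∣<∣j∣ (∣j∣≤∣i+j∣+∣i∣ i j)))

  Σᶻ-shift⁺ : ∀ {b K g} n → Vanishes b g → b ℕ.+ n ℕ.≤ K → Σᶻ K (λ j → g (+ n ℤ.+ j)) ≈ Σᶻ K g
  Σᶻ-shift⁺ {K = K} {g} zero v _ = Σᶻ-cong (λ j → reflexive (≡.cong g (ℤₚ.+-identityˡ j))) K
  Σᶻ-shift⁺ {b} {K} {g} (suc n) v b+n<K = begin
    Σᶻ K (λ j → g (+ suc n ℤ.+ j))
      ≈⟨ Σᶻ-cong (λ j → reflexive (≡.cong g
           (ℤ-solve 2 (λ n j → (conᶻ (+ 1) :+ᶻ n) :+ᶻ j :=ᶻ n :+ᶻ (conᶻ (+ 1) :+ᶻ j)) ≡.refl (+ n) j))) K ⟩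
    Σᶻ K (λ j → g (+ n ℤ.+ ℤ.suc j))
      ≈⟨ Σᶻ-suc (Vanishes-shift (+ n) v) b+n<K′ ⟩
    Σᶻ K (λ j → g (+ n ℤ.+ j))
      ≈⟨ Σᶻ-shift⁺ n v (ℕₚ.<⇒≤ b+n<K′) ⟩
    Σᶻ K g ∎
    where
    b+n<K′ : b ℕ.+ n ℕ.< K
    b+n<K′ = ≡.subst (ℕ._≤ K) (ℕₚ.+-suc b n) b+n<K

  Σᶻ-shift : ∀ {b K g} i → Vanishes b g → b ℕ.+ ∣ i ∣ ℕ.≤ K → Σᶻ K (λ j → g (i ℤ.+ j)) ≈ Σᶻ K g
  Σᶻ-shift (+ n) v b+n≤K = Σᶻ-shift⁺ n v b+n≤K
  Σᶻ-shift {b} {K} {g} -[1+ n ] v b+n≤K = begin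
    -- Conjugation by j ↦ -j turns a negative shift into a positive one; the symmetric range is
    -- invariant under it.
    Σᶻ K (λ j → g (-[1+ n ] ℤ.+ j))          ≈⟨ Σᶻ-neg K _ ⟨
    Σᶻ K (λ j → g (-[1+ n ] ℤ.+ ℤ.- j))
      ≈⟨ Σᶻ-cong (λ j → reflexive (≡.cong g (≡.sym (ℤₚ.neg-distrib-+ (+ suc n) j)))) K ⟩
    Σᶻ K (λ j → g (ℤ.- (+ suc n ℤ.+ j)))
      ≈⟨ Σᶻ-shift⁺ (suc n) (λ j b<∣j∣ → v (ℤ.- j) (≡.subst (b ℕ.<_) (≡.sym (ℤₚ.∣-i∣≡∣i∣ j)) b<∣j∣)) b+n≤K ⟩
    Σᶻ K (λ j → g (ℤ.- j))                   ≈⟨ Σᶻ-neg K g ⟩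
    Σᶻ K g ∎

  -- The even indices 2i and the odd indices 2i + 1 with |i| ≤ K fill the window from -2K to 2K + 1,
  -- one index more than the symmetric range.
  Σᶻ-parity-boundary : ∀ K g → Σᶻ K (λ i → g (i ℤ.+ i)) + Σᶻ K (λ i → g (ℤ.suc (i ℤ.+ i)))
                             ≈ Σᶻ (K ℕ.+ K) g + g (+ suc (K ℕ.+ K))
  Σᶻ-parity-boundary zero    g = refl
  Σᶻ-parity-boundary (suc K) g rewrite ℕₚ.+-suc K K = begin
    (Σᶻ K gᵉ + (g (+ suc (suc (K ℕ.+ K))) + g -[1+ suc (K ℕ.+ K) ]))
      + (Σᶻ K gᵒ + (g (+ suc (suc (suc (K ℕ.+ K)))) + g -[1+ K ℕ.+ K ]))
      ≈⟨ solve 6 (λ a b c d e f → (a :+ (b :+ c)) :+ (d :+ (e :+ f)) := (a :+ d) :+ (f :+ (b :+ c) :+ e))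
           refl _ _ _ _ _ _ ⟩
    (Σᶻ K gᵉ + Σᶻ K gᵒ) + (g -[1+ K ℕ.+ K ] + (g (+ suc (suc (K ℕ.+ K))) + g -[1+ suc (K ℕ.+ K) ]) + g (+ suc (suc (suc (K ℕ.+ K)))))
      ≈⟨ +-congʳ (Σᶻ-parity-boundary K g) ⟩
    (Σᶻ (K ℕ.+ K) g + g (+ suc (K ℕ.+ K))) + (g -[1+ K ℕ.+ K ] + (g (+ suc (suc (K ℕ.+ K))) + g -[1+ suc (K ℕ.+ K) ]) + g (+ suc (suc (suc (K ℕ.+ K)))))
      ≈⟨ solve 5 (λ a b c d e → (a :+ b) :+ (c :+ d :+ e) := ((a :+ (b :+ c)) :+ d) :+ e) refl _ _ _ _ _ ⟩
    ((Σᶻ (K ℕ.+ K) g + (g (+ suc (K ℕ.+ K)) + g -[1+ K ℕ.+ K ])) + (g (+ suc (suc (K ℕ.+ K))) + g -[1+ suc (K ℕ.+ K) ])) + g (+ suc (suc (suc (K ℕ.+ K)))) ∎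
    where
    gᵉ gᵒ : ℤ → Carrier
    gᵉ i = g (i ℤ.+ i)
    gᵒ i = g (ℤ.suc (i ℤ.+ i))

  Σᶻ-parity : ∀ {b K g} → Vanishes b g → b ℕ.≤ K →
              Σᶻ K g ≈ Σᶻ K (λ i → g (i ℤ.+ i)) + Σᶻ K (λ i → g (ℤ.suc (i ℤ.+ i)))
  Σᶻ-parity {b} {K} {g} v b≤K = begin
    Σᶻ K g                                  ≈⟨ Σᶻ-range v b≤K b≤K+K ⟩
    Σᶻ (K ℕ.+ K) g                          ≈⟨ +-identityʳ _ ⟨
    Σᶻ (K ℕ.+ K) g + 0#                     ≈⟨ +-congˡ (v _ (s≤s b≤K+K)) ⟨
    Σᶻ (K ℕ.+ K) g + g (+ suc (K ℕ.+ K))    ≈⟨ Σᶻ-parity-boundary K g ⟨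
    Σᶻ K (λ i → g (i ℤ.+ i)) + Σᶻ K (λ i → g (ℤ.suc (i ℤ.+ i))) ∎
    where
    b≤K+K : b ℕ.≤ K ℕ.+ K
    b≤K+K = ℕₚ.≤-trans b≤K (ℕₚ.m≤m+n K K)

  record Vanishes₂ (b : ℕ) (F : ℤ → ℤ → Carrier) : Set ℓ where
    field
      ₁ : ∀ i j → b ℕ.< ∣ i ∣ → F i j ≈ 0#
      ₂ : ∀ i → Vanishes b (F i)

  -- A shear moves the row of index i by `c i`, hence by at most `b` where that row is nonzero. A
  -- support in the square of size `b` thus ends up in the square of size `b + b`. The map `c` will
  -- be the identity or negation.
  Vanishes₂-shift : ∀ {b F} (c : ℤ → ℤ) → (∀ i → ∣ c i ∣ ≡ ∣ i ∣) → Vanishes₂ b F →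
                    Vanishes₂ (b ℕ.+ b) (λ i j → F i (c i ℤ.+ j))
  Vanishes₂-shift {b} {F} c ∣c∣ v = record
    { ₁ = λ i j b+b<i → ₁ i _ (ℕₚ.≤-<-trans (ℕₚ.m≤m+n b b) b+b<i)
    ; ₂ = vanishes }
    where
    open Vanishes₂ v
    vanishes : ∀ i → Vanishes (b ℕ.+ b) (λ j → F i (c i ℤ.+ j))
    vanishes i j b+b<j with ∣ i ∣ ℕ.≤? b
    ... | yes i≤b = Vanishes-shift (c i) (₂ i) j
                      (ℕₚ.≤-<-trans (ℕₚ.+-monoʳ-≤ b (≡.subst (ℕ._≤ b) (≡.sym (∣c∣ i)) i≤b)) b+b<j)
    ... | no  i≰b = ₁ i _ (ℕₚ.≰⇒> i≰b)

  Σᶻ-shift₂ : ∀ {b K F} (c : ℤ → ℤ) → (∀ i → ∣ c i ∣ ≡ ∣ i ∣) → Vanishes₂ b F → b ℕ.+ b ℕ.≤ K →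
              Σᶻ K (λ i → Σᶻ K (λ j → F i (c i ℤ.+ j))) ≈ Σᶻ K (λ i → Σᶻ K (F i))
  Σᶻ-shift₂ {b} {K} {F} c ∣c∣ v b+b≤K = Σᶻ-cong inner K
    where
    open Vanishes₂ v
    inner : ∀ i → Σᶻ K (λ j → F i (c i ℤ.+ j)) ≈ Σᶻ K (F i)
    inner i with ∣ i ∣ ℕ.≤? b
    ... | yes i≤b = Σᶻ-shift (c i) (₂ i)
                      (ℕₚ.≤-trans (ℕₚ.+-monoʳ-≤ b (≡.subst (ℕ._≤ b) (≡.sym (∣c∣ i)) i≤b)) b+b≤K)
    ... | no  i≰b = trans (Σᶻ-zero (λ j → ₁ i _ (ℕₚ.≰⇒> i≰b)) K)
                          (sym (Σᶻ-zero (λ j → ₁ i j (ℕₚ.≰⇒> i≰b)) K))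

  -- The splitting is by the parity of j - i. This is the parity of j² + 3i² and of i² + j², so for
  -- both quadratic forms the two halves collect the even and the odd exponents.
  Σᶻ-parity₂ : ∀ {b K F} → Vanishes₂ b F → b ℕ.+ b ℕ.≤ K →
               Σᶻ K (λ i → Σᶻ K (F i)) ≈ Σᶻ K (λ i → Σᶻ K (λ j → F i (i ℤ.+ (j ℤ.+ j))))
                                       + Σᶻ K (λ i → Σᶻ K (λ j → F i (i ℤ.+ ℤ.suc (j ℤ.+ j))))
  Σᶻ-parity₂ {b} {K} {F} v b+b≤K = begin
    Σᶻ K (λ i → Σᶻ K (F i))
      ≈⟨ Σᶻ-shift₂ (λ i → i) (λ _ → ≡.refl) v b+b≤K ⟨
    Σᶻ K (λ i → Σᶻ K (λ j → F i (i ℤ.+ j)))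
      ≈⟨ Σᶻ-cong (λ i → Σᶻ-parity (Vanishes₂.₂ (Vanishes₂-shift (λ i → i) (λ _ → ≡.refl) v) i) b+b≤K) K ⟩
    Σᶻ K (λ i → Σᶻ K (λ j → F i (i ℤ.+ (j ℤ.+ j))) + Σᶻ K (λ j → F i (i ℤ.+ ℤ.suc (j ℤ.+ j))))
      ≈⟨ Σᶻ-+ K _ _ ⟩
    _ ∎

  Πⁿ : ℕ → (ℕ → Carrier) → Carrier
  Πⁿ zero    g = 1#
  Πⁿ (suc n) g = Πⁿ n g * g n

  -- The finite Jacobi triple product

  module FiniteTripleProduct (Q : Carrier) (s : ℕ) (s≤1 : s ℕ.≤ 1) where

    e : ℤ → ℕ
    e n = ∣ n ℤ.* (n ℤ.+ + s) ∣

    -- The roots 0 and -s of n(n + s) have no integer strictly between them when s ≤ 1, so the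
    -- absolute value in `e` changes nothing.
    +e≡ : ∀ n → + e n ≡ n ℤ.* (n ℤ.+ + s)
    +e≡ n = ℤₚ.0≤i⇒+∣i∣≡i (nonNeg s≤1 n)
      where
      nonNeg : ∀ {s} → s ℕ.≤ 1 → ∀ n → + 0 ℤ.≤ n ℤ.* (n ℤ.+ + s)
      nonNeg _ (+ n) = ≡.subst (+ 0 ℤ.≤_) (ℤₚ.pos-* n _) (ℤ.+≤+ z≤n)
      nonNeg z≤n       -[1+ n ] = ℤ.+≤+ z≤n
      nonNeg (s≤s z≤n) -[1+ zero  ] = ℤ.+≤+ z≤n
      nonNeg (s≤s z≤n) -[1+ suc n ] = ℤ.+≤+ z≤n

    y : ℕ → Carrier
    y N = Q ^ (1 ℕ.+ (N ℕ.+ N ℕ.+ s))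

    -- The coefficients of 1 for s = 0 and of 1 + z^(-1) for s = 1. The latter is the unpaired
    -- factor of the triple product for Σ z^n Q^(n²+n); the other factors pair up as (1 + z y)(1 +
    -- z^(-1) y) = 1 + (z + z^(-1)) y + y², and multiplication by such a pair is the recursion of
    -- `coeff`.
    base : ℕ → ℤ → Carrier
    base _       (+ zero)     = 1#
    base _       (+ suc _)    = 0#
    base _       -[1+ suc _ ] = 0#
    base zero    -[1+ zero  ] = 0#
    base (suc _) -[1+ zero  ] = 1#

    -- For N − n = a ≥ 0 and N + n + s = b ≥ 0, coeff N n is the Gaussian binomial (a + b choose a)
    -- in base Q², multiplied by Q^(n² + s n).
    coeff : ℕ → ℤ → Carrier
    coeff zero    n = base s n
    coeff (suc N) n = (1# + y N * y N) * coeff N n + y N * (coeff N (ℤ.pred n) + coeff N (ℤ.suc n))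

    p : ℕ → Carrier
    p j = Πⁿ j (λ i → 1# - Q ^ (suc i ℕ.+ suc i))

    coeff-step-zero : ∀ N n → coeff N n ≈ 0# → coeff N (ℤ.pred n) ≈ 0# → coeff N (ℤ.suc n) ≈ 0# →
                      coeff (suc N) n ≈ 0#
    coeff-step-zero N n c₀ c₋ c₊ = begin
      (1# + y N * y N) * coeff N n + y N * (coeff N (ℤ.pred n) + coeff N (ℤ.suc n))
        ≈⟨ +-cong (*-congˡ c₀) (*-congˡ (+-cong c₋ c₊)) ⟩
      (1# + y N * y N) * 0# + y N * (0# + 0#)
        ≈⟨ solve 1 (λ y → (con (+ 1) :+ y :* y) :* con (+ 0) :+ y :* (con (+ 0) :+ con (+ 0)) := con (+ 0)) refl (y N) ⟩
      0# ∎

    coeff-above : ∀ N {n} → N ℕ.< n → coeff N (+ n) ≈ 0#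
    coeff-above zero    (s≤s _) = refl
    coeff-above (suc N) {suc n} (s≤s N<n) = coeff-step-zero N (+ suc n)
      (coeff-above N (ℕₚ.m<n⇒m<1+n N<n)) (coeff-above N N<n) (coeff-above N (ℕₚ.m<n⇒m<1+n (ℕₚ.m<n⇒m<1+n N<n)))

    coeff-below : ∀ N {n} → N ℕ.+ s ℕ.≤ n → coeff N -[1+ n ] ≈ 0#
    coeff-below zero    {zero}  z≤n = refl
    coeff-below zero    {suc n} _   = refl
    coeff-below (suc N) {suc n} (s≤s N+s≤n) = coeff-step-zero N -[1+ suc n ]
      (coeff-below N (ℕₚ.m≤n⇒m≤1+n N+s≤n)) (coeff-below N (ℕₚ.m≤n⇒m≤1+n (ℕₚ.m≤n⇒m≤1+n N+s≤n))) (coeff-below N N+s≤n)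

    i≡[i+j]-j : ∀ {i j k} → i ℤ.+ j ≡ k → i ≡ k ℤ.- j
    i≡[i+j]-j {i} {j} ≡.refl = ℤ-solve 2 (λ i j → i :=ᶻ (i :+ᶻ j) :-ᶻ j) ≡.refl i j

    i+suc⇒i+ : ∀ {i a m} → i ℤ.+ + suc a ≡ + suc m → i ℤ.+ + a ≡ + m
    i+suc⇒i+ {i} {a} {m} eq = i≡[i+j]-j {i ℤ.+ + a} {+ 1}
      (≡.trans (ℤ-solve 2 (λ i a → (i :+ᶻ a) :+ᶻ conᶻ (+ 1) :=ᶻ i :+ᶻ (conᶻ (+ 1) :+ᶻ a)) ≡.refl i (+ a)) eq)

    -- Multiplication by `y N` turns Q^(e (n - 1)) into Q^(e n) Q^(2a). Together with `exponent₊`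
    -- this makes `Q ^ e n` a common factor of all three terms of the recursion.
    exponent₋ : ∀ N n a → n ℤ.+ + a ≡ + suc N →
                suc (N ℕ.+ N ℕ.+ s) ℕ.+ e (ℤ.pred n) ≡ e n ℕ.+ (a ℕ.+ a)
    exponent₋ N n a n+a with i≡[i+j]-j {n} {+ a} n+a
    ... | ≡.refl = ℤₚ.+-injective (≡.trans (≡.cong (λ k → + suc (N ℕ.+ N ℕ.+ s) ℤ.+ k) (+e≡ (ℤ.pred (+ suc N ℤ.- + a))))
      (≡.trans
        (ℤ-solve 3 (λ N s a → conᶻ (+ 1) :+ᶻ (N :+ᶻ N :+ᶻ s)
              :+ᶻ (conᶻ (ℤ.- + 1) :+ᶻ (conᶻ (+ 1) :+ᶻ N :-ᶻ a)) :*ᶻ ((conᶻ (ℤ.- + 1) :+ᶻ (conᶻ (+ 1) :+ᶻ N :-ᶻ a)) :+ᶻ s)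
            :=ᶻ (conᶻ (+ 1) :+ᶻ N :-ᶻ a) :*ᶻ ((conᶻ (+ 1) :+ᶻ N :-ᶻ a) :+ᶻ s) :+ᶻ (a :+ᶻ a)) ≡.refl (+ N) (+ s) (+ a))
        (≡.cong (λ k → k ℤ.+ (+ a ℤ.+ + a)) (≡.sym (+e≡ (+ suc N ℤ.- + a))))))

    exponent₊ : ∀ N n a b → n ℤ.+ + a ≡ + suc N → a ℕ.+ b ≡ suc N ℕ.+ suc N ℕ.+ s →
                suc (N ℕ.+ N ℕ.+ s) ℕ.+ e (ℤ.suc n) ≡ e n ℕ.+ (b ℕ.+ b)
    exponent₊ N n a b n+a a+b with i≡[i+j]-j {n} {+ a} n+a
    ... | ≡.refl = ℤₚ.+-injective (≡.trans (≡.cong (λ k → + suc (N ℕ.+ N ℕ.+ s) ℤ.+ k) (+e≡ (ℤ.suc (+ suc N ℤ.- + a))))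
      (≡.trans
        (ℤ-solve 3 (λ N s a → conᶻ (+ 1) :+ᶻ (N :+ᶻ N :+ᶻ s)
              :+ᶻ (conᶻ (+ 1) :+ᶻ (conᶻ (+ 1) :+ᶻ N :-ᶻ a)) :*ᶻ ((conᶻ (+ 1) :+ᶻ (conᶻ (+ 1) :+ᶻ N :-ᶻ a)) :+ᶻ s)
            :=ᶻ (conᶻ (+ 1) :+ᶻ N :-ᶻ a) :*ᶻ ((conᶻ (+ 1) :+ᶻ N :-ᶻ a) :+ᶻ s)
              :+ᶻ (((conᶻ (+ 1) :+ᶻ N) :+ᶻ (conᶻ (+ 1) :+ᶻ N) :+ᶻ s :-ᶻ a) :+ᶻ ((conᶻ (+ 1) :+ᶻ N) :+ᶻ (conᶻ (+ 1) :+ᶻ N) :+ᶻ s :-ᶻ a)))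
          ≡.refl (+ N) (+ s) (+ a))
        (≡.cong₂ (λ u v → u ℤ.+ (v ℤ.+ v)) (≡.sym (+e≡ (+ suc N ℤ.- + a)))
          (≡.sym (i≡[i+j]-j {+ b} {+ a} (≡.trans (ℤₚ.+-comm (+ b) (+ a)) (≡.cong +_ a+b)))))))

    Q^-cong : ∀ m {n} → m ≡ n → Q ^ m ≈ Q ^ n
    Q^-cong _ ≡.refl = refl

    Q^-*-cong : ∀ a b c d → a ℕ.+ b ≡ c ℕ.+ d → Q ^ a * Q ^ b ≈ Q ^ c * Q ^ d
    Q^-*-cong a b c d eq = trans (sym (^-homo-* Q a b)) (trans (Q^-cong (a ℕ.+ b) eq) (^-homo-* Q c d))

    -- The Gaussian binomial formula with its denominators (Q²; Q²)_a and (Q²; Q²)_b multiplied out,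
    -- since the ring has no division. As a and b are natural numbers, n stays between -N - s and N.
    Closed : ℕ → Set _
    Closed N = ∀ n a b → n ℤ.+ + a ≡ + N → a ℕ.+ b ≡ N ℕ.+ N ℕ.+ s →
               coeff N n * (p a * p b) ≈ Q ^ e n * p (N ℕ.+ N ℕ.+ s)

    module ClosedStep (N : ℕ) (closed : Closed N) where

      S : ℕ
      S = suc (N ℕ.+ N ℕ.+ s)

      X Y : Carrier
      X = p (N ℕ.+ N ℕ.+ s)
      Y = y N * y N

      2·-suc : suc N ℕ.+ suc N ℕ.+ s ≡ suc (suc (N ℕ.+ N ℕ.+ s))
      2·-suc = ≡.cong (λ k → suc (k ℕ.+ s)) (ℕₚ.+-suc N N)

      -- At the same n the level drops from N + 1 to N, so (a, b) becomes (a - 1, b - 1). If a or b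
      -- is 0, then n lies outside the support of `coeff N`, and the factor 1 - Q^0 on the right
      -- vanishes as well.
      middle : ∀ n a b → n ℤ.+ + a ≡ + suc N → a ℕ.+ b ≡ suc N ℕ.+ suc N ℕ.+ s →
               coeff N n * (p a * p b) ≈ Q ^ e n * X * ((1# - Q ^ (a ℕ.+ a)) * (1# - Q ^ (b ℕ.+ b)))
      middle n zero b n+a a+b = begin
        coeff N n * (1# * p b)  ≈⟨ *-congʳ (trans (reflexive (≡.cong (coeff N) (≡.trans (≡.sym (ℤₚ.+-identityʳ n)) n+a)))
                                                 (coeff-above N ℕₚ.≤-refl)) ⟩
        0# * (1# * p b)
          ≈⟨ solve 3 (λ P E B → con (+ 0) :* P := E :* ((con (+ 1) :- con (+ 1)) :* B)) refl _ _ _ ⟩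
        Q ^ e n * X * ((1# - 1#) * (1# - Q ^ (b ℕ.+ b))) ∎
      middle n (suc a) zero n+a a+b = begin
        coeff N n * (p (suc a) * 1#)
          ≈⟨ *-congʳ (trans (reflexive (≡.cong (coeff N) n≡)) (coeff-below N ℕₚ.≤-refl)) ⟩
        0# * (p (suc a) * 1#)
          ≈⟨ solve 3 (λ P E A → con (+ 0) :* P := E :* (A :* (con (+ 1) :- con (+ 1)))) refl _ _ _ ⟩
        Q ^ e n * X * ((1# - Q ^ (suc a ℕ.+ suc a)) * (1# - 1#)) ∎
        where
        n≡ : n ≡ -[1+ N ℕ.+ s ]
        n≡ = ≡.trans (i≡[i+j]-j {n} n+a) (≡.trans (≡.cong (λ k → + suc N ℤ.- + k) (≡.trans (≡.sym (ℕₚ.+-identityʳ _)) a+b))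
          (ℤ-solve 2 (λ N s → (conᶻ (+ 1) :+ᶻ N) :-ᶻ ((conᶻ (+ 1) :+ᶻ N) :+ᶻ (conᶻ (+ 1) :+ᶻ N) :+ᶻ s)
            :=ᶻ :-ᶻ (conᶻ (+ 1) :+ᶻ (N :+ᶻ s))) ≡.refl (+ N) (+ s)))
      middle n (suc a) (suc b) n+a a+b = begin
        coeff N n * ((p a * A) * (p b * B))
          ≈⟨ solve 5 (λ c p A q B → c :* ((p :* A) :* (q :* B)) := (c :* (p :* q)) :* (A :* B)) refl _ _ _ _ _ ⟩
        coeff N n * (p a * p b) * (A * B)
          ≈⟨ *-congʳ (closed n a b
               (i+suc⇒i+ {n} n+a)
               (ℕₚ.suc-injective (ℕₚ.suc-injective (≡.trans (≡.sym (≡.cong suc (ℕₚ.+-suc a b))) (≡.trans a+b 2·-suc))))) ⟩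
        Q ^ e n * X * (A * B) ∎
        where
        A B : Carrier
        A = 1# - Q ^ (suc a ℕ.+ suc a)
        B = 1# - Q ^ (suc b ℕ.+ suc b)

      -- For n - 1 the pair (a, b) becomes (a, b - 2), so b = 0 and b = 1 fall outside the support.
      -- On the right the vanishing factor is 1 - Q^0 if b = 0; if b = 1 then a = 2N + 1 + s, and
      -- Q^(2a) - Y vanishes. The lemma `right` is the mirror image, with (a - 2, b).
      left : ∀ n a b → n ℤ.+ + a ≡ + suc N → a ℕ.+ b ≡ suc N ℕ.+ suc N ℕ.+ s →
             y N * coeff N (ℤ.pred n) * (p a * p b)
               ≈ Q ^ e n * X * ((1# - Q ^ (b ℕ.+ b)) * (Q ^ (a ℕ.+ a) - Y))
      left n a zero n+a a+b = begin
        y N * coeff N (ℤ.pred n) * (p a * 1#)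
          ≈⟨ *-congʳ (*-congˡ (trans (reflexive (≡.cong (coeff N) n≡)) (coeff-below N (ℕₚ.n≤1+n (N ℕ.+ s))))) ⟩
        y N * 0# * (p a * 1#)
          ≈⟨ solve 4 (λ y P E A → y :* con (+ 0) :* P := E :* ((con (+ 1) :- con (+ 1)) :* A)) refl _ _ _ _ ⟩
        Q ^ e n * X * ((1# - 1#) * (Q ^ (a ℕ.+ a) - Y)) ∎
        where
        n≡ : ℤ.pred n ≡ -[1+ suc (N ℕ.+ s) ]
        n≡ = ≡.trans (≡.cong ℤ.pred (i≡[i+j]-j {n} n+a))
          (≡.trans (≡.cong (λ k → ℤ.pred (+ suc N ℤ.- + k)) (≡.trans (≡.sym (ℕₚ.+-identityʳ _)) a+b))
          (ℤ-solve 2 (λ N s → conᶻ (ℤ.- + 1) :+ᶻ ((conᶻ (+ 1) :+ᶻ N) :-ᶻ ((conᶻ (+ 1) :+ᶻ N) :+ᶻ (conᶻ (+ 1) :+ᶻ N) :+ᶻ s))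
            :=ᶻ :-ᶻ (conᶻ (+ 2) :+ᶻ (N :+ᶻ s))) ≡.refl (+ N) (+ s)))
      left n a (suc zero) n+a a+b = begin
        y N * coeff N (ℤ.pred n) * (p a * p 1)
          ≈⟨ *-congʳ (*-congˡ (trans (reflexive (≡.cong (coeff N) n≡)) (coeff-below N ℕₚ.≤-refl))) ⟩
        y N * 0# * (p a * p 1)
          ≈⟨ solve 5 (λ y P E B A → y :* con (+ 0) :* P := E :* (B :* (A :- A))) refl _ _ _ _ _ ⟩
        Q ^ e n * X * ((1# - Q ^ 2) * (Y - Y))
          ≈⟨ *-congˡ (*-congˡ (+-congʳ (trans (Q^-cong (a ℕ.+ a) (≡.cong (λ k → k ℕ.+ k) a≡)) (^-homo-* Q S S)))) ⟨
        Q ^ e n * X * ((1# - Q ^ 2) * (Q ^ (a ℕ.+ a) - Y)) ∎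
        where
        a≡ : a ≡ suc (N ℕ.+ N ℕ.+ s)
        a≡ = ℕₚ.suc-injective (≡.trans (ℕₚ.+-comm 1 a) (≡.trans a+b 2·-suc))
        n≡ : ℤ.pred n ≡ -[1+ N ℕ.+ s ]
        n≡ = ≡.trans (≡.cong ℤ.pred (i≡[i+j]-j {n} n+a))
          (≡.trans (≡.cong (λ k → ℤ.pred (+ suc N ℤ.- + k)) a≡)
          (ℤ-solve 2 (λ N s → conᶻ (ℤ.- + 1) :+ᶻ ((conᶻ (+ 1) :+ᶻ N) :-ᶻ (conᶻ (+ 1) :+ᶻ (N :+ᶻ N :+ᶻ s)))
            :=ᶻ :-ᶻ (conᶻ (+ 1) :+ᶻ (N :+ᶻ s))) ≡.refl (+ N) (+ s)))
      left n a (suc (suc b)) n+a a+b = begin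
        y N * coeff N (ℤ.pred n) * (p a * (p b * (1# - β) * (1# - B)))
          ≈⟨ solve 6 (λ y c p q β B → y :* c :* (p :* (q :* β :* B)) := (y :* (c :* (p :* q))) :* (β :* B)) refl _ _ _ _ _ _ ⟩
        y N * (coeff N (ℤ.pred n) * (p a * p b)) * ((1# - β) * (1# - B))
          ≈⟨ *-congʳ (*-congˡ (closed (ℤ.pred n) a b pn+a a+b′)) ⟩
        y N * (Q ^ e (ℤ.pred n) * X) * ((1# - β) * (1# - B))
          ≈⟨ *-congʳ (trans (sym (*-assoc _ _ _)) (*-congʳ (Q^-*-cong S (e (ℤ.pred n)) (e n) (a ℕ.+ a) (exponent₋ N n a n+a)))) ⟩
        Q ^ e n * A * X * ((1# - β) * (1# - B))
          ≈⟨ solve 5 (λ E A X β B → E :* A :* X :* ((con (+ 1) :- β) :* (con (+ 1) :- B)) := E :* X :* ((con (+ 1) :- B) :* (A :- A :* β)))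
               refl _ _ _ _ _ ⟩
        Q ^ e n * X * ((1# - B) * (A - A * β))
          ≈⟨ *-congˡ (*-congˡ (+-congˡ (-‿cong (Q^-*-cong (a ℕ.+ a) (suc b ℕ.+ suc b) S S Aβ≡)))) ⟩
        Q ^ e n * X * ((1# - B) * (A - Y)) ∎
        where
        A B β : Carrier
        A = Q ^ (a ℕ.+ a)
        β = Q ^ (suc b ℕ.+ suc b)
        B = Q ^ (suc (suc b) ℕ.+ suc (suc b))
        a+suc-b : a ℕ.+ suc b ≡ suc (N ℕ.+ N ℕ.+ s)
        a+suc-b = ℕₚ.suc-injective (≡.trans (≡.sym (ℕₚ.+-suc a (suc b))) (≡.trans a+b 2·-suc))
        a+b′ : a ℕ.+ b ≡ N ℕ.+ N ℕ.+ s
        a+b′ = ℕₚ.suc-injective (≡.trans (≡.sym (ℕₚ.+-suc a b)) a+suc-b)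
        pn+a : ℤ.pred n ℤ.+ + a ≡ + N
        pn+a = ≡.trans (ℤₚ.pred-+ n (+ a)) (≡.cong ℤ.pred n+a)
        Aβ≡ : a ℕ.+ a ℕ.+ (suc b ℕ.+ suc b) ≡ suc (N ℕ.+ N ℕ.+ s) ℕ.+ suc (N ℕ.+ N ℕ.+ s)
        Aβ≡ = ≡.trans (ℕ-solve 2 (λ a b → a :+ⁿ a :+ⁿ (b :+ⁿ b) :=ⁿ (a :+ⁿ b) :+ⁿ (a :+ⁿ b)) ≡.refl a (suc b))
                      (≡.cong (λ k → k ℕ.+ k) a+suc-b)

      right : ∀ n a b → n ℤ.+ + a ≡ + suc N → a ℕ.+ b ≡ suc N ℕ.+ suc N ℕ.+ s →
              y N * coeff N (ℤ.suc n) * (p a * p b)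
                ≈ Q ^ e n * X * ((1# - Q ^ (a ℕ.+ a)) * (Q ^ (b ℕ.+ b) - Y))
      right n zero b n+a a+b = begin
        y N * coeff N (ℤ.suc n) * (1# * p b)
          ≈⟨ *-congʳ (*-congˡ (trans (reflexive (≡.cong (λ k → coeff N (ℤ.suc k)) (≡.trans (≡.sym (ℤₚ.+-identityʳ n)) n+a)))
                                     (coeff-above N (ℕₚ.n≤1+n _)))) ⟩
        y N * 0# * (1# * p b)
          ≈⟨ solve 4 (λ y P E B → y :* con (+ 0) :* P := E :* ((con (+ 1) :- con (+ 1)) :* B)) refl _ _ _ _ ⟩
        Q ^ e n * X * ((1# - 1#) * (Q ^ (b ℕ.+ b) - Y)) ∎
      right n (suc zero) b n+a a+b = begin
        y N * coeff N (ℤ.suc n) * (p 1 * p b)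
          ≈⟨ *-congʳ (*-congˡ (trans (reflexive (≡.cong (λ k → coeff N (ℤ.suc k)) n≡)) (coeff-above N ℕₚ.≤-refl))) ⟩
        y N * 0# * (p 1 * p b)
          ≈⟨ solve 5 (λ y P E B A → y :* con (+ 0) :* P := E :* (B :* (A :- A))) refl _ _ _ _ _ ⟩
        Q ^ e n * X * ((1# - Q ^ 2) * (Y - Y))
          ≈⟨ *-congˡ (*-congˡ (+-congʳ (trans (Q^-cong (b ℕ.+ b) (≡.cong (λ k → k ℕ.+ k) b≡)) (^-homo-* Q S S)))) ⟨
        Q ^ e n * X * ((1# - Q ^ 2) * (Q ^ (b ℕ.+ b) - Y)) ∎
        where
        b≡ : b ≡ suc (N ℕ.+ N ℕ.+ s)
        b≡ = ℕₚ.suc-injective (≡.trans a+b 2·-suc)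
        n≡ : n ≡ + N
        n≡ = ≡.trans (≡.sym (ℤₚ.+-identityʳ n)) (i+suc⇒i+ {n} n+a)
      right n (suc (suc a)) b n+a a+b = begin
        y N * coeff N (ℤ.suc n) * ((p a * (1# - α) * (1# - A)) * p b)
          ≈⟨ solve 6 (λ y c p q α A → y :* c :* ((p :* α :* A) :* q) := (y :* (c :* (p :* q))) :* (α :* A)) refl _ _ _ _ _ _ ⟩
        y N * (coeff N (ℤ.suc n) * (p a * p b)) * ((1# - α) * (1# - A))
          ≈⟨ *-congʳ (*-congˡ (closed (ℤ.suc n) a b sn+a a+b′)) ⟩
        y N * (Q ^ e (ℤ.suc n) * X) * ((1# - α) * (1# - A))
          ≈⟨ *-congʳ (trans (sym (*-assoc _ _ _)) (*-congʳ (Q^-*-cong S (e (ℤ.suc n)) (e n) (b ℕ.+ b)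
               (exponent₊ N n (suc (suc a)) b n+a a+b)))) ⟩
        Q ^ e n * B * X * ((1# - α) * (1# - A))
          ≈⟨ solve 5 (λ E B X α A → E :* B :* X :* ((con (+ 1) :- α) :* (con (+ 1) :- A)) := E :* X :* ((con (+ 1) :- A) :* (B :- B :* α)))
               refl _ _ _ _ _ ⟩
        Q ^ e n * X * ((1# - A) * (B - B * α))
          ≈⟨ *-congˡ (*-congˡ (+-congˡ (-‿cong (Q^-*-cong (b ℕ.+ b) (suc a ℕ.+ suc a) S S Bα≡)))) ⟩
        Q ^ e n * X * ((1# - A) * (B - Y)) ∎
        where
        A B α : Carrier
        A = Q ^ (suc (suc a) ℕ.+ suc (suc a))
        α = Q ^ (suc a ℕ.+ suc a)
        B = Q ^ (b ℕ.+ b)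
        suc-a+b : suc a ℕ.+ b ≡ suc (N ℕ.+ N ℕ.+ s)
        suc-a+b = ℕₚ.suc-injective (≡.trans a+b 2·-suc)
        a+b′ : a ℕ.+ b ≡ N ℕ.+ N ℕ.+ s
        a+b′ = ℕₚ.suc-injective suc-a+b
        sn+a : ℤ.suc n ℤ.+ + a ≡ + N
        sn+a = ≡.trans (ℤ-solve 2 (λ n a → (conᶻ (+ 1) :+ᶻ n) :+ᶻ a :=ᶻ n :+ᶻ (conᶻ (+ 1) :+ᶻ a)) ≡.refl n (+ a)) (i+suc⇒i+ {n} n+a)
        Bα≡ : b ℕ.+ b ℕ.+ (suc a ℕ.+ suc a) ≡ suc (N ℕ.+ N ℕ.+ s) ℕ.+ suc (N ℕ.+ N ℕ.+ s)
        Bα≡ = ≡.trans (ℕ-solve 2 (λ a b → b :+ⁿ b :+ⁿ (a :+ⁿ a) :=ⁿ (a :+ⁿ b) :+ⁿ (a :+ⁿ b)) ≡.refl (suc a) b)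
                      (≡.cong (λ k → k ℕ.+ k) suc-a+b)

      step : Closed (suc N)
      step n a b n+a a+b = begin
        ((1# + Y) * coeff N n + y N * (coeff N (ℤ.pred n) + coeff N (ℤ.suc n))) * (p a * p b)
          ≈⟨ solve 6 (λ Y y c₀ c₋ c₊ P → ((con (+ 1) :+ Y) :* c₀ :+ y :* (c₋ :+ c₊)) :* P
                 := (con (+ 1) :+ Y) :* (c₀ :* P) :+ (y :* c₋ :* P :+ y :* c₊ :* P)) refl _ _ _ _ _ _ ⟩
        (1# + Y) * (coeff N n * (p a * p b)) + (y N * coeff N (ℤ.pred n) * (p a * p b) + y N * coeff N (ℤ.suc n) * (p a * p b))
          ≈⟨ +-cong (*-congˡ (middle n a b n+a a+b)) (+-cong (left n a b n+a a+b) (right n a b n+a a+b)) ⟩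
        (1# + Y) * (Q ^ e n * X * ((1# - A) * (1# - B)))
          + (Q ^ e n * X * ((1# - B) * (A - Y)) + Q ^ e n * X * ((1# - A) * (B - Y)))
          -- The q-Pascal identity in polynomial form: (1 + Y)(1 - A)(1 - B) + (1 - B)(A - Y) + (1 -
          -- A)(B - Y) = (1 - Y)(1 - AB). Here 1 - Y and 1 - AB are the last two factors of p(2N + 2
          -- + s).
          ≈⟨ solve 5 (λ E X Y A B →
                 (con (+ 1) :+ Y) :* (E :* X :* ((con (+ 1) :- A) :* (con (+ 1) :- B)))
                   :+ (E :* X :* ((con (+ 1) :- B) :* (A :- Y)) :+ E :* X :* ((con (+ 1) :- A) :* (B :- Y)))
                 := E :* (X :* (con (+ 1) :- Y) :* (con (+ 1) :- A :* B))) refl _ _ _ _ _ ⟩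
        Q ^ e n * (X * (1# - Y) * (1# - A * B))
          ≈⟨ *-congˡ (*-cong (*-congˡ (+-congˡ (-‿cong (sym (^-homo-* Q S S)))))
               (+-congˡ (-‿cong (trans (sym (^-homo-* Q (a ℕ.+ a) (b ℕ.+ b))) (Q^-cong (a ℕ.+ a ℕ.+ (b ℕ.+ b)) AB≡))))) ⟩
        Q ^ e n * p (suc (suc (N ℕ.+ N ℕ.+ s)))
          ≈⟨ reflexive (≡.cong (λ k → Q ^ e n * p k) (≡.sym 2·-suc)) ⟩
        Q ^ e n * p (suc N ℕ.+ suc N ℕ.+ s) ∎
        where
        A B : Carrier
        A = Q ^ (a ℕ.+ a)
        B = Q ^ (b ℕ.+ b)
        AB≡ : a ℕ.+ a ℕ.+ (b ℕ.+ b) ≡ suc (suc (N ℕ.+ N ℕ.+ s)) ℕ.+ suc (suc (N ℕ.+ N ℕ.+ s))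
        AB≡ = ≡.trans (ℕ-solve 2 (λ a b → a :+ⁿ a :+ⁿ (b :+ⁿ b) :=ⁿ (a :+ⁿ b) :+ⁿ (a :+ⁿ b)) ≡.refl a b)
                      (≡.cong (λ k → k ℕ.+ k) (≡.trans a+b 2·-suc))

    closed : ∀ N → Closed N
    closed zero    n zero    b n+a a+b = begin
      coeff 0 n * (1# * p b)  ≈⟨ *-cong (reflexive (≡.cong (coeff 0) n≡)) (reflexive (≡.cong (λ k → 1# * p k) a+b)) ⟩
      1# * (1# * p s)         ≈⟨ *-congˡ (*-identityˡ _) ⟩
      1# * p s                ≈⟨ *-congʳ (reflexive (≡.cong (λ k → Q ^ e k) n≡)) ⟨
      Q ^ e n * p s           ∎
      where
      n≡ : n ≡ + 0
      n≡ = ≡.trans (≡.sym (ℤₚ.+-identityʳ n)) n+a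
    closed zero    n (suc zero) zero n+a a+b = begin
      coeff 0 n * (p 1 * 1#)  ≈⟨ *-cong (reflexive (≡.cong₂ base (≡.sym a+b) n≡)) (*-identityʳ (p 1)) ⟩
      1# * p 1                ≈⟨ *-cong (reflexive (≡.cong₂ (λ k l → Q ^ ∣ k ℤ.* (k ℤ.+ + l) ∣) n≡ (≡.sym a+b))) (reflexive (≡.cong p (≡.sym a+b))) ⟨
      Q ^ e n * p s           ∎
      where
      n≡ : n ≡ -[1+ 0 ]
      n≡ = i≡[i+j]-j {n} n+a
    closed zero    n (suc zero) (suc b) _ a+b with ≡.subst (ℕ._≤ 1) (≡.sym a+b) s≤1
    ... | s≤s ()
    closed zero    n (suc (suc a)) b _ a+b with ≡.subst (ℕ._≤ 1) (≡.sym a+b) s≤1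
    ... | s≤s ()
    closed (suc N) = ClosedStep.step N (closed N)

    coeff-vanishes : ∀ N → Vanishes (N ℕ.+ s) (coeff N)
    coeff-vanishes N (+ n)    N+s<n = coeff-above N (ℕₚ.≤-<-trans (ℕₚ.m≤m+n N s) N+s<n)
    coeff-vanishes N -[1+ n ] (s≤s N+s≤n) = coeff-below N N+s≤n

    -- With it, nilpotency kills all terms whose index exceeds M in absolute value. The additional 1
    -- is attained at i = -1 for s = 1, where the exponent is 0.
    ∣i∣≤1+e : ∀ i → ∣ i ∣ ℕ.≤ suc (e i)
    ∣i∣≤1+e i rewrite ℤₚ.abs-* i (i ℤ.+ + s)
      with ∣ i ℤ.+ + s ∣ | ℤₚ.∣i-j∣≤∣i∣+∣j∣ (i ℤ.+ + s) (+ s)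
    ... | zero  | le = ℕₚ.≤-trans (≡.subst (λ k → ∣ k ∣ ℕ.≤ s) (≡.sym (i≡[i+j]-j {i} {+ s} ≡.refl)) le) (ℕₚ.≤-trans s≤1 (s≤s z≤n))
    ... | suc m | _  = ℕₚ.≤-trans (ℕₚ.m≤m*n ∣ i ∣ (suc m)) (ℕₚ.n≤1+n _)

    -- `W` stands for the values of a linear functional on z^n for which multiplication by z +
    -- z^(-1) acts as the scalar t. The sum of `W n * coeff N n` is then the value of the whole
    -- Laurent polynomial, and each pair of factors contributes 1 + t y + y². The initial value 2 is
    -- that of z^n + z^(-n) at n = 0.
    module Weighted (t : Carrier) (W : ℤ → Carrier)
      (W-rec : ∀ n → W (ℤ.suc n) + W (ℤ.pred n) ≈ t * W n)
      (W-init : W (+ 0) + W -[1+ 0 ] * base s -[1+ 0 ] ≈ 1# + 1#) where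

      P : ℕ → Carrier
      P N = Πⁿ N (λ j → 1# + t * y j + y j * y j)

      Σ-coeff : ∀ N {K} → N ℕ.+ s ℕ.< K → Σᶻ K (λ n → W n * coeff N n) ≈ (1# + 1#) * P N
      Σ-coeff zero {K} s<K = begin
        Σᶻ K (λ n → W n * base s n)       ≈⟨ Σᶻ-range vanishes (ℕₚ.≤-trans (s≤s z≤n) s<K) ℕₚ.≤-refl ⟩
        W (+ 0) * 1# + (W (+ 1) * 0# + W -[1+ 0 ] * base s -[1+ 0 ])
          ≈⟨ solve 3 (λ a b c → a :* con (+ 1) :+ (b :* con (+ 0) :+ c) := (a :+ c) :* con (+ 1)) refl _ _ _ ⟩
        (W (+ 0) + W -[1+ 0 ] * base s -[1+ 0 ]) * 1#   ≈⟨ *-congʳ W-init ⟩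
        (1# + 1#) * 1#                    ∎
        where
        vanishes : Vanishes 1 (λ n → W n * base s n)
        vanishes (+ suc n)    _ = zeroʳ _
        vanishes -[1+ zero ]  (s≤s ())
        vanishes -[1+ suc n ] _ = zeroʳ _
      Σ-coeff (suc N) {K} 1+N+s<K = begin
        Σᶻ K (λ n → W n * ((1# + Y) * coeff N n + y N * (coeff N (ℤ.pred n) + coeff N (ℤ.suc n))))
          ≈⟨ Σᶻ-cong (λ n → solve 6 (λ w Y c₀ y c₋ c₊ → w :* ((con (+ 1) :+ Y) :* c₀ :+ y :* (c₋ :+ c₊))
               := (con (+ 1) :+ Y) :* (w :* c₀) :+ y :* (w :* c₋ :+ w :* c₊)) refl _ _ _ _ _ _) K ⟩
        Σᶻ K (λ n → (1# + Y) * (W n * coeff N n) + y N * (W n * coeff N (ℤ.pred n) + W n * coeff N (ℤ.suc n)))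
          ≈⟨ trans (Σᶻ-+ K _ _) (+-cong (Σᶻ-*ˡ (1# + Y) K _) (trans (Σᶻ-*ˡ (y N) K _) (*-congˡ (Σᶻ-+ K _ _)))) ⟩
        (1# + Y) * S₀ + y N * (Σᶻ K (λ n → W n * coeff N (ℤ.pred n)) + Σᶻ K (λ n → W n * coeff N (ℤ.suc n)))
          -- Reindexing moves the shifts from `coeff` to `W`, whose recurrence merges the two
          -- neighbours into the factor t.
          ≈⟨ +-congˡ (*-congˡ (+-cong shift₋ shift₊)) ⟩
        (1# + Y) * S₀ + y N * (Σᶻ K (λ n → W (ℤ.suc n) * coeff N n) + Σᶻ K (λ n → W (ℤ.pred n) * coeff N n))
          ≈⟨ +-congˡ (*-congˡ (trans (sym (Σᶻ-+ K _ _)) (trans (Σᶻ-cong recurrence K) (Σᶻ-*ˡ t K _)))) ⟩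
        (1# + Y) * S₀ + y N * (t * S₀)
          ≈⟨ +-cong (*-congˡ IH) (*-congˡ (*-congˡ IH)) ⟩
        (1# + Y) * ((1# + 1#) * P N) + y N * (t * ((1# + 1#) * P N))
          ≈⟨ solve 4 (λ y Y t P → (con (+ 1) :+ Y) :* (con (+ 2) :* P) :+ y :* (t :* (con (+ 2) :* P))
               := con (+ 2) :* (P :* (con (+ 1) :+ t :* y :+ Y))) refl _ _ _ _ ⟩
        (1# + 1#) * P (suc N) ∎
        where
        Y S₀ : Carrier
        Y = y N * y N
        S₀ = Σᶻ K (λ n → W n * coeff N n)
        N+s<K : N ℕ.+ s ℕ.< K
        N+s<K = ℕₚ.<-trans (ℕₚ.n<1+n _) 1+N+s<K
        IH : S₀ ≈ (1# + 1#) * P N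
        IH = Σ-coeff N N+s<K
        shift₋ : Σᶻ K (λ n → W n * coeff N (ℤ.pred n)) ≈ Σᶻ K (λ n → W (ℤ.suc n) * coeff N n)
        shift₋ = begin
          Σᶻ K (λ n → W n * coeff N (ℤ.pred n))
            ≈⟨ Σᶻ-suc {suc (N ℕ.+ s)} (λ i lt → trans (*-congˡ (coeff-vanishes N (ℤ.pred i)
                 (ℕₚ.≤-trans (ℕₚ.<⇒≤pred lt) (∣i∣-1≤∣pred∣ i)))) (zeroʳ _)) 1+N+s<K ⟨
          Σᶻ K (λ n → W (ℤ.suc n) * coeff N (ℤ.pred (ℤ.suc n)))
            ≈⟨ Σᶻ-cong (λ n → reflexive (≡.cong (λ k → W (ℤ.suc n) * coeff N k) (ℤₚ.pred-suc n))) K ⟩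
          Σᶻ K (λ n → W (ℤ.suc n) * coeff N n) ∎
          where
          ∣i∣-1≤∣pred∣ : ∀ i → ℕ.pred ∣ i ∣ ℕ.≤ ∣ ℤ.pred i ∣
          ∣i∣-1≤∣pred∣ (+ zero)  = z≤n
          ∣i∣-1≤∣pred∣ (+ suc n) = ℕₚ.≤-refl
          ∣i∣-1≤∣pred∣ -[1+ n ]  = ℕₚ.m≤n⇒m≤1+n (ℕₚ.n≤1+n n)
        shift₊ : Σᶻ K (λ n → W n * coeff N (ℤ.suc n)) ≈ Σᶻ K (λ n → W (ℤ.pred n) * coeff N n)
        shift₊ = begin
          Σᶻ K (λ n → W n * coeff N (ℤ.suc n))
            ≈⟨ Σᶻ-cong (λ n → reflexive (≡.cong (λ k → W k * coeff N (ℤ.suc n)) (≡.sym (ℤₚ.pred-suc n)))) K ⟩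
          Σᶻ K (λ n → W (ℤ.pred (ℤ.suc n)) * coeff N (ℤ.suc n))
            ≈⟨ Σᶻ-suc (λ i lt → trans (*-congˡ (coeff-vanishes N i lt)) (zeroʳ _)) N+s<K ⟩
          Σᶻ K (λ n → W (ℤ.pred n) * coeff N n) ∎
        recurrence : ∀ n → W (ℤ.suc n) * coeff N n + W (ℤ.pred n) * coeff N n ≈ t * (W n * coeff N n)
        recurrence n = trans (sym (distribʳ _ _ _)) (trans (*-congʳ (W-rec n)) (*-assoc _ _ _))

  -- The triple product when q is nilpotent

  Nilpotent : Carrier → ℕ → Set ℓ
  Nilpotent Q M = ∀ k → M ℕ.≤ k → Q ^ k ≈ 0#

  module _ {Q M} (nil : Nilpotent Q M) where

    -- If x = Q^(k+1), the difference a - b equals x (a - b), hence x^M (a - b), and x^M is zero. No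
    -- inverse has to be constructed.
    1-Q^-cancel : ∀ k {a b} → (1# - Q ^ suc k) * a ≈ (1# - Q ^ suc k) * b → a ≈ b
    1-Q^-cancel k {a} {b} eq = x∙y⁻¹≈ε⇒x≈y a b (begin
      a - b                     ≈⟨ iterate M ⟩
      (Q ^ suc k) ^ M * (a - b) ≈⟨ *-congʳ (trans (^-assocʳ Q (suc k) M) (nil (suc k ℕ.* M) (ℕₚ.m≤n*m M (suc k)))) ⟩
      0# * (a - b)              ≈⟨ zeroˡ _ ⟩
      0#                        ∎)
      where
      once : a - b ≈ Q ^ suc k * (a - b)
      once = begin
        a - b
          ≈⟨ solve 3 (λ x a b → a :- b := ((con (+ 1) :- x) :* a :- (con (+ 1) :- x) :* b) :+ x :* (a :- b)) refl (Q ^ suc k) a b ⟩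
        ((1# - Q ^ suc k) * a - (1# - Q ^ suc k) * b) + Q ^ suc k * (a - b)
          ≈⟨ +-congʳ (trans (+-congʳ eq) (-‿inverseʳ _)) ⟩
        0# + Q ^ suc k * (a - b)
          ≈⟨ +-identityˡ _ ⟩
        Q ^ suc k * (a - b) ∎
      iterate : ∀ m → a - b ≈ (Q ^ suc k) ^ m * (a - b)
      iterate zero    = sym (*-identityˡ _)
      iterate (suc m) = begin
        a - b                                          ≈⟨ once ⟩
        Q ^ suc k * (a - b)                            ≈⟨ *-congˡ (iterate m) ⟩
        Q ^ suc k * ((Q ^ suc k) ^ m * (a - b))        ≈⟨ *-assoc _ _ _ ⟨
        Q ^ suc k * (Q ^ suc k) ^ m * (a - b)          ∎

    Π-cancel : ∀ (k : ℕ → ℕ) n {a b} → Πⁿ n (λ i → 1# - Q ^ suc (k i)) * a ≈ Πⁿ n (λ i → 1# - Q ^ suc (k i)) * b → a ≈ b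
    Π-cancel k zero    eq = trans (sym (*-identityˡ _)) (trans eq (*-identityˡ _))
    Π-cancel k (suc n) eq = 1-Q^-cancel (k n) (Π-cancel k n (trans (sym (*-assoc _ _ _)) (trans eq (*-assoc _ _ _))))

    -- A factor of index at least M has the form 1 - Q^m with m > M, which is 1 by nilpotency;
    -- infinite products therefore become finite ones.
    Π-stable : ∀ (k : ℕ → ℕ) → (∀ i → i ℕ.≤ k i) → ∀ {n} → M ℕ.≤ n →
               Πⁿ n (λ i → 1# - Q ^ suc (k i)) ≈ Πⁿ M (λ i → 1# - Q ^ suc (k i))
    Π-stable k i≤k {n} M≤n = trans
      (reflexive (≡.cong (λ m → Πⁿ m (λ i → 1# - Q ^ suc (k i))) (≡.sym (ℕₚ.m∸n+n≡m M≤n)))) (go (n ℕ.∸ M))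
      where
      go : ∀ d → Πⁿ (d ℕ.+ M) (λ i → 1# - Q ^ suc (k i)) ≈ Πⁿ M (λ i → 1# - Q ^ suc (k i))
      go zero    = refl
      go (suc d) = begin
        Πⁿ (d ℕ.+ M) (λ i → 1# - Q ^ suc (k i)) * (1# - Q ^ suc (k (d ℕ.+ M)))
          ≈⟨ *-cong (go d) (+-congˡ (-‿cong (nil _ (ℕₚ.m≤n⇒m≤1+n (ℕₚ.≤-trans (ℕₚ.m≤n+m M d) (i≤k _)))))) ⟩
        Πⁿ M (λ i → 1# - Q ^ suc (k i)) * (1# - 0#)
          ≈⟨ solve 1 (λ x → x :* (con (+ 1) :- con (+ 0)) := x) refl _ ⟩
        Πⁿ M (λ i → 1# - Q ^ suc (k i)) ∎

    module TripleProduct (s : ℕ) (s≤1 : s ℕ.≤ 1) where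

      open FiniteTripleProduct Q s s≤1

      k : ℕ → ℕ
      k i = i ℕ.+ suc i

      p-stable : ∀ {n} → M ℕ.≤ n → p n ≈ p M
      p-stable = Π-stable k (λ i → ℕₚ.m≤m+n i (suc i))

      module _ {N} (2M<N : M ℕ.+ M ℕ.< N) where

        M≤N : M ℕ.≤ N
        M≤N = ℕₚ.≤-trans (ℕₚ.m≤m+n M M) (ℕₚ.<⇒≤ 2M<N)

        p-2N : p (N ℕ.+ N ℕ.+ s) ≈ p M
        p-2N = p-stable (ℕₚ.≤-trans M≤N (ℕₚ.≤-trans (ℕₚ.m≤m+n N N) (ℕₚ.m≤m+n (N ℕ.+ N) s)))

        -- Once a and b reach M, all three Pochhammer products in `closed` have stabilised at `p M`,
        -- and one copy of it can be cancelled.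
        coeff-limit-near : ∀ n a b → n ℤ.+ + a ≡ + N → a ℕ.+ b ≡ N ℕ.+ N ℕ.+ s → M ℕ.≤ a → M ℕ.≤ b →
                           coeff N n * p M ≈ Q ^ e n
        coeff-limit-near n a b n+a a+b M≤a M≤b = Π-cancel k M (begin
          p M * (coeff N n * p M)     ≈⟨ solve 2 (λ c p → p :* (c :* p) := c :* (p :* p)) refl _ _ ⟩
          coeff N n * (p M * p M)     ≈⟨ *-congˡ (*-cong (p-stable M≤a) (p-stable M≤b)) ⟨
          coeff N n * (p a * p b)     ≈⟨ closed N n a b n+a a+b ⟩
          Q ^ e n * p (N ℕ.+ N ℕ.+ s) ≈⟨ *-congˡ p-2N ⟩
          Q ^ e n * p M               ≈⟨ *-comm _ _ ⟩
          p M * Q ^ e n               ∎)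

        coeff-limit-far : ∀ n a b → n ℤ.+ + a ≡ + N → a ℕ.+ b ≡ N ℕ.+ N ℕ.+ s → Q ^ e n ≈ 0# → coeff N n ≈ 0#
        coeff-limit-far n a b n+a a+b Q^e≈0 = Π-cancel k a (Π-cancel k b (begin
          p b * (p a * coeff N n)       ≈⟨ solve 3 (λ a b c → b :* (a :* c) := c :* (a :* b)) refl _ _ _ ⟩
          coeff N n * (p a * p b)       ≈⟨ closed N n a b n+a a+b ⟩
          Q ^ e n * p (N ℕ.+ N ℕ.+ s)   ≈⟨ *-congʳ Q^e≈0 ⟩
          0# * p (N ℕ.+ N ℕ.+ s)        ≈⟨ solve 3 (λ a b c → con (+ 0) :* c := b :* (a :* con (+ 0))) refl (p a) (p b) _ ⟩
          p b * (p a * 0#)              ∎))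

        M≤N∸M : M ℕ.≤ N ℕ.∸ M
        M≤N∸M = ≡.subst (ℕ._≤ N ℕ.∸ M) (ℕₚ.m+n∸n≡m M M) (ℕₚ.∸-monoˡ-≤ M (ℕₚ.<⇒≤ 2M<N))

        index⁺ : ∀ {k} → k ℕ.≤ N → + k ℤ.+ + (N ℕ.∸ k) ≡ + N × (N ℕ.∸ k) ℕ.+ (k ℕ.+ N ℕ.+ s) ≡ N ℕ.+ N ℕ.+ s
        index⁺ {k} k≤N = ≡.cong +_ (ℕₚ.m+[n∸m]≡n k≤N) ,
          ≡.trans (≡.sym (ℕₚ.+-assoc (N ℕ.∸ k) (k ℕ.+ N) s)) (≡.cong (ℕ._+ s)
            (≡.trans (≡.sym (ℕₚ.+-assoc (N ℕ.∸ k) k N)) (≡.cong (ℕ._+ N) (ℕₚ.m∸n+n≡m k≤N))))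

        index⁻ : ∀ {k} → k ℕ.< N ℕ.+ s →
                 -[1+ k ] ℤ.+ + (N ℕ.+ suc k) ≡ + N × N ℕ.+ suc k ℕ.+ (N ℕ.+ s ℕ.∸ suc k) ≡ N ℕ.+ N ℕ.+ s
        index⁻ {k} k<N+s = ℤ-solve 2 (λ k N → :-ᶻ k :+ᶻ (N :+ᶻ k) :=ᶻ N) ≡.refl (+ suc k) (+ N) ,
          ≡.trans (ℕₚ.+-assoc N (suc k) _) (≡.trans (≡.cong (N ℕ.+_) (ℕₚ.m+[n∸m]≡n k<N+s)) (≡.sym (ℕₚ.+-assoc N N s)))

        coeff-limit-outside : ∀ n → M ℕ.< ∣ n ∣ → coeff N n * p M ≈ Q ^ e n
        coeff-limit-outside n M<∣n∣ = trans (trans (*-congʳ (far n Q^e≈0)) (zeroˡ _)) (sym Q^e≈0)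
          where
          Q^e≈0 : Q ^ e n ≈ 0#
          Q^e≈0 = nil _ (ℕₚ.≤-pred (ℕₚ.≤-trans M<∣n∣ (∣i∣≤1+e n)))
          far : ∀ n → Q ^ e n ≈ 0# → coeff N n ≈ 0#
          far (+ k) Q^e≈0 with k ℕ.≤? N
          ... | yes k≤N = let n+a , a+b = index⁺ k≤N in coeff-limit-far (+ k) (N ℕ.∸ k) (k ℕ.+ N ℕ.+ s) n+a a+b Q^e≈0
          ... | no  k≰N = coeff-above N (ℕₚ.≰⇒> k≰N)
          far -[1+ k ] Q^e≈0 with suc k ℕ.≤? N ℕ.+ s
          ... | yes k<N+s = let n+a , a+b = index⁻ k<N+s in coeff-limit-far -[1+ k ] (N ℕ.+ suc k) (N ℕ.+ s ℕ.∸ suc k) n+a a+b Q^e≈0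
          ... | no  k≮N+s = coeff-below N (ℕₚ.≮⇒≥ k≮N+s)

        -- The bound N > 2M ensures that every n with |n| ≤ M has both a and b at least M. For
        -- larger |n| the power Q^(e n) is already zero, and `closed` (or the support of `coeff N`)
        -- forces the coefficient to be zero too.
        coeff-limit : ∀ n → coeff N n * p M ≈ Q ^ e n
        coeff-limit (+ k) with k ℕ.≤? M
        ... | no k≰M  = coeff-limit-outside (+ k) (ℕₚ.≰⇒> k≰M)
        ... | yes k≤M =
          let n+a , a+b = index⁺ (ℕₚ.≤-trans k≤M M≤N) in
          coeff-limit-near (+ k) (N ℕ.∸ k) (k ℕ.+ N ℕ.+ s) n+a a+b
            (ℕₚ.≤-trans M≤N∸M (ℕₚ.∸-monoʳ-≤ N k≤M))
            (ℕₚ.≤-trans M≤N (ℕₚ.≤-trans (ℕₚ.m≤n+m N k) (ℕₚ.m≤m+n (k ℕ.+ N) s)))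
        coeff-limit -[1+ k ] with suc k ℕ.≤? M
        ... | no k≮M  = coeff-limit-outside -[1+ k ] (ℕₚ.≰⇒> k≮M)
        ... | yes k<M =
          let n+a , a+b = index⁻ (ℕₚ.≤-trans k<M (ℕₚ.≤-trans M≤N (ℕₚ.m≤m+n N s))) in
          coeff-limit-near -[1+ k ] (N ℕ.+ suc k) (N ℕ.+ s ℕ.∸ suc k) n+a a+b
            (ℕₚ.≤-trans M≤N (ℕₚ.m≤m+n N (suc k)))
            (ℕₚ.≤-trans M≤N∸M (ℕₚ.≤-trans (ℕₚ.∸-monoʳ-≤ N k<M) (ℕₚ.∸-monoˡ-≤ (suc k) (ℕₚ.m≤m+n N s))))

        tripleProduct : ∀ (t : Carrier) (W : ℤ → Carrier) → (∀ n → W (ℤ.suc n) + W (ℤ.pred n) ≈ t * W n) →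
          W (+ 0) + W -[1+ 0 ] * base s -[1+ 0 ] ≈ 1# + 1# → ∀ {K} → N ℕ.+ s ℕ.< K →
          Σᶻ K (λ n → W n * Q ^ e n) ≈ (1# + 1#) * (p M * Πⁿ N (λ j → 1# + t * y j + y j * y j))
        tripleProduct t W W-rec W-init {K} N+s<K = begin
          Σᶻ K (λ n → W n * Q ^ e n)
            ≈⟨ Σᶻ-cong (λ n → trans (*-congˡ (sym (coeff-limit n))) (sym (*-assoc _ _ _))) K ⟩
          Σᶻ K (λ n → W n * coeff N n * p M)
            ≈⟨ Σᶻ-*ʳ (p M) K _ ⟩
          Σᶻ K (λ n → W n * coeff N n) * p M
            ≈⟨ *-congʳ (Σ-coeff N N+s<K) ⟩
          (1# + 1#) * P N * p M
            ≈⟨ solve 3 (λ a b c → a :* b :* c := a :* (c :* b)) refl _ _ _ ⟩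
          (1# + 1#) * (p M * P N) ∎
          where
          open Weighted t W W-rec W-init

  Πⁿ-cong : ∀ {g h} n → (∀ i → g i ≈ h i) → Πⁿ n g ≈ Πⁿ n h
  Πⁿ-cong zero    g≈h = refl
  Πⁿ-cong (suc n) g≈h = *-cong (Πⁿ-cong n g≈h) (g≈h n)

  Πⁿ-* : ∀ n g h → Πⁿ n g * Πⁿ n h ≈ Πⁿ n (λ i → g i * h i)
  Πⁿ-* zero    g h = *-identityˡ 1#
  Πⁿ-* (suc n) g h = trans
    (solve 4 (λ a b c d → (a :* b) :* (c :* d) := (a :* c) :* (b :* d)) refl _ _ _ _) (*-congʳ (Πⁿ-* n g h))

  -- Products occurring as theta functions

  module EtaQuotients (M : ℕ) where

    -- Euler's product of all 1 - Q^i with i ≥ 1; for Q^M = 0 the omitted factors equal 1.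
    η : Carrier → Carrier
    η Q = Πⁿ M (λ i → 1# - Q ^ suc i)

    η-cong : ∀ {Q Q′} → Q ≈ Q′ → η Q ≈ η Q′
    η-cong Q≈Q′ = Πⁿ-cong M (λ i → +-congˡ (-‿cong (^-congˡ (suc i) Q≈Q′)))

    ^-nil : ∀ {Q} k → Nilpotent Q M → Nilpotent (Q ^ suc k) M
    ^-nil {Q} k nil m M≤m = trans (^-assocʳ Q (suc k) m) (nil _ (ℕₚ.≤-trans M≤m (ℕₚ.m≤n*m m (suc k))))

    -- The least number of factors satisfying the bound `M + M < N` of the triple product.
    T : ℕ
    T = suc (M ℕ.+ M)

    M≤T : M ℕ.≤ T
    M≤T = ℕₚ.m≤n⇒m≤1+n (ℕₚ.m≤m+n M M)

    ^-double : ∀ Q n → Q ^ (n ℕ.+ n) ≈ (Q ^ 2) ^ n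
    ^-double Q n = trans (reflexive (≡.cong (Q ^_) (≡.cong (n ℕ.+_) (≡.sym (ℕₚ.+-identityʳ n))))) (sym (^-assocʳ Q 2 n))

    -- The quantities `y` for s = 0 and s = 1, with the exponents left in that form so that the
    -- products agree definitionally with those of the triple product.
    odds evens : Carrier → ℕ → Carrier
    odds  Q i = Q ^ suc (i ℕ.+ i ℕ.+ 0)
    evens Q i = Q ^ suc (i ℕ.+ i ℕ.+ 1)

    evens≈ : ∀ Q i → evens Q i ≈ Q ^ (suc i ℕ.+ suc i)
    evens≈ Q i = reflexive (≡.cong (Q ^_) (≡.cong suc (≡.trans (ℕₚ.+-assoc i i 1) (≡.cong (i ℕ.+_) (ℕₚ.+-comm i 1)))))

    ^-comm : ∀ Q k n → (Q ^ k) ^ n ≈ (Q ^ n) ^ k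
    ^-comm Q k n = trans (^-assocʳ Q k n)
      (trans (reflexive (≡.cong (Q ^_) (ℕₚ.*-comm k n))) (sym (^-assocʳ Q n k)))

    minus plus : Carrier → Carrier
    minus y = 1# - y
    plus  y = 1# + y

    Πᵒ Πᵉ : (Carrier → Carrier) → Carrier → Carrier
    Πᵒ g Q = Πⁿ T (λ i → g (odds Q i))
    Πᵉ g Q = Πⁿ T (λ i → g (evens Q i))

    module _ {Q} (nil : Nilpotent Q M) where

      η-any : ∀ {n} → M ℕ.≤ n → Πⁿ n (λ i → 1# - Q ^ suc i) ≈ η Q
      η-any = Π-stable nil (λ i → i) (λ _ → ℕₚ.≤-refl)

      Πᵒ-Πᵉ : Πᵒ minus Q * Πᵉ minus Q ≈ η Q
      Πᵒ-Πᵉ = trans (go T) (η-any (ℕₚ.≤-trans M≤T (ℕₚ.m≤m+n T T)))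
        where
        go : ∀ n → Πⁿ n (λ i → 1# - odds Q i) * Πⁿ n (λ i → 1# - evens Q i) ≈ Πⁿ (n ℕ.+ n) (λ i → 1# - Q ^ suc i)
        go zero    = *-identityˡ 1#
        go (suc n) = begin
          (Πⁿ n (λ i → 1# - odds Q i) * (1# - odds Q n)) * (Πⁿ n (λ i → 1# - evens Q i) * (1# - evens Q n))
            ≈⟨ solve 4 (λ a b c d → (a :* b) :* (c :* d) := ((a :* c) :* b) :* d) refl _ _ _ _ ⟩
          Πⁿ n (λ i → 1# - odds Q i) * Πⁿ n (λ i → 1# - evens Q i) * (1# - odds Q n) * (1# - evens Q n)
            ≈⟨ *-cong (*-cong (go n) (+-congˡ (-‿cong (reflexive (≡.cong (λ k → Q ^ suc k) (ℕₚ.+-identityʳ (n ℕ.+ n)))))))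
                      (+-congˡ (-‿cong (reflexive (≡.cong (λ k → Q ^ suc k) (ℕₚ.+-comm (n ℕ.+ n) 1))))) ⟩
          Πⁿ (suc (suc (n ℕ.+ n))) (λ i → 1# - Q ^ suc i)
            ≈⟨ reflexive (≡.cong (λ k → Πⁿ k (λ i → 1# - Q ^ suc i)) (≡.cong suc (≡.sym (ℕₚ.+-suc n n)))) ⟩
          Πⁿ (suc n ℕ.+ suc n) (λ i → 1# - Q ^ suc i) ∎

    Πᵉ≈η : ∀ {Q} → Nilpotent Q M → Πᵉ minus Q ≈ η (Q ^ 2)
    Πᵉ≈η {Q} nil = trans (Πⁿ-cong T (λ i → +-congˡ (-‿cong (trans (evens≈ Q i) (^-double Q (suc i))))))
                         (η-any (^-nil 1 nil) M≤T)

    Πᵒ-η : ∀ {Q} → Nilpotent Q M → Πᵒ minus Q * η (Q ^ 2) ≈ η Q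
    Πᵒ-η nil = trans (*-congˡ (sym (Πᵉ≈η nil))) (Πᵒ-Πᵉ nil)

    Πᵉ-pow : ∀ {Q} k → Nilpotent Q M → Πᵉ (λ y → 1# - y ^ suc k) Q ≈ η ((Q ^ suc k) ^ 2)
    Πᵉ-pow {Q} k nil = trans (Πⁿ-cong T (λ i → +-congˡ (-‿cong (sym (^-comm Q (suc k) (suc (i ℕ.+ i ℕ.+ 1))))))) (Πᵉ≈η (^-nil k nil))

    Πᵒ-pow : ∀ Q k → Πᵒ (λ y → 1# - y ^ k) Q ≈ Πᵒ minus (Q ^ k)
    Πᵒ-pow Q k = Πⁿ-cong T (λ i → +-congˡ (-‿cong (sym (^-comm Q k (suc (i ℕ.+ i ℕ.+ 0))))))

    trinomial : Carrier → Carrier → Carrier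
    trinomial t y = 1# + t * y + y * y

    2# : Carrier
    2# = 1# + 1#

    -- Product sides of the triple product for s = 0 with t = 2, 1 and for s = 1 with t = 2, 1, -1.
    -- They are halves of lattice sums: of Σ 2 Q^(n²) and Σ L(n) Q^(n²), and of Σ Q^(n²+n), Σ V(n)
    -- Q^(n²+n) and Σ L(2n+1) Q^(n²+n). The third is Ramanujan's ψ(Q²).
    Θφ ΘG Θψ ΘB ΘD : Carrier → Carrier
    Θφ Q = η (Q ^ 2) * Πᵒ (trinomial 2#) Q
    ΘG Q = η (Q ^ 2) * Πᵒ (trinomial 1#) Q
    Θψ Q = η (Q ^ 2) * Πᵉ (trinomial 2#) Q
    ΘB Q = η (Q ^ 2) * Πᵉ (trinomial 1#) Q
    ΘD Q = η (Q ^ 2) * Πᵉ (trinomial (- 1#)) Q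

    pow-pow : ∀ Q a b → η ((Q ^ a) ^ b) ≈ η (Q ^ (a ℕ.* b))
    pow-pow Q a b = η-cong (^-assocʳ Q a b)

    square : ∀ y → (1# + y) * (1# + y) ≈ trinomial 2# y
    square = solve 1 (λ y → (con (+ 1) :+ y) :* (con (+ 1) :+ y) := con (+ 1) :+ con (+ 2) :* y :+ y :* y) refl

    1-y² : ∀ y → (1# + y) * (1# - y) ≈ 1# - y ^ 2
    1-y² = solve 1 (λ y → (con (+ 1) :+ y) :* (con (+ 1) :- y) := con (+ 1) :- y :* (y :* con (+ 1))) refl

    1-y³ : ∀ y → trinomial 1# y * (1# - y) ≈ 1# - y ^ 3
    1-y³ = solve 1 (λ y → (con (+ 1) :+ con (+ 1) :* y :+ y :* y) :* (con (+ 1) :- y) := con (+ 1) :- y :* (y :* (y :* con (+ 1)))) refl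

    1-y⁶ : ∀ y → (trinomial (- 1#) y * (1# + y)) * (1# - y ^ 3) ≈ 1# - y ^ 6
    1-y⁶ = solve 1 (λ y → ((con (+ 1) :+ con (ℤ.- + 1) :* y :+ y :* y) :* (con (+ 1) :+ y)) :* (con (+ 1) :- y :* (y :* (y :* con (+ 1))))
      := con (+ 1) :- y :* (y :* (y :* (y :* (y :* (y :* con (+ 1))))))) refl

    module _ {Q} (nil : Nilpotent Q M) where

      Πᵒ-square : Πᵒ (trinomial 2#) Q ≈ Πᵒ plus Q * Πᵒ plus Q
      Πᵒ-square = sym (trans (Πⁿ-* T _ _) (Πⁿ-cong T (λ i → square _)))

      Πᵉ-square : Πᵉ (trinomial 2#) Q ≈ Πᵉ plus Q * Πᵉ plus Q
      Πᵉ-square = sym (trans (Πⁿ-* T _ _) (Πⁿ-cong T (λ i → square _)))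

      Πᵉ-plus : Πᵉ plus Q * η (Q ^ 2) ≈ η (Q ^ 4)
      Πᵉ-plus = begin
        Πᵉ plus Q * η (Q ^ 2)          ≈⟨ *-congˡ (Πᵉ≈η nil) ⟨
        Πᵉ plus Q * Πᵉ minus Q       ≈⟨ trans (Πⁿ-* T _ _) (Πⁿ-cong T (λ i → 1-y² _)) ⟩
        Πᵉ (λ y → 1# - y ^ 2) Q           ≈⟨ Πᵉ-pow 1 nil ⟩
        η ((Q ^ 2) ^ 2)                   ≈⟨ pow-pow Q 2 2 ⟩
        η (Q ^ 4)                         ∎

      -- As in the four evaluations that follow, the trinomials are completed to binomials 1 - y², 1
      -- - y³ or 1 - y⁶, and a product of such binomials over odd or over even exponents is an eta
      -- quotient of a power of Q.
      Θφ-eta : Θφ Q * (η Q * η Q) * (η (Q ^ 4) * η (Q ^ 4))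
             ≈ η (Q ^ 2) * η (Q ^ 2) * η (Q ^ 2) * η (Q ^ 2) * η (Q ^ 2)
      Θφ-eta = begin
        Θφ Q * (η Q * η Q) * (h₄ * h₄)
          ≈⟨ *-cong (*-cong (*-congˡ Πᵒ-square) (*-cong (sym (Πᵒ-η nil)) (sym (Πᵒ-η nil)))) refl ⟩
        h₂ * (p * p) * ((o * h₂) * (o * h₂)) * (h₄ * h₄)
          ≈⟨ solve 4 (λ h p o g → h :* (p :* p) :* ((o :* h) :* (o :* h)) :* (g :* g)
               := h :* (h :* (h :* ((p :* o :* g) :* (p :* o :* g))))) refl _ _ _ _ ⟩
        h₂ * (h₂ * (h₂ * ((p * o * h₄) * (p * o * h₄))))
          ≈⟨ *-congˡ (*-congˡ (*-congˡ (*-cong po po))) ⟩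
        h₂ * (h₂ * (h₂ * (h₂ * h₂)))
          ≈⟨ solve 1 (λ h → h :* (h :* (h :* (h :* h))) := h :* h :* h :* h :* h) refl _ ⟩
        h₂ * h₂ * h₂ * h₂ * h₂ ∎
        where
        h₂ h₄ p o : Carrier
        h₂ = η (Q ^ 2)
        h₄ = η (Q ^ 4)
        p = Πᵒ plus Q
        o = Πᵒ minus Q
        po : p * o * h₄ ≈ h₂
        po = begin
          p * o * h₄                        ≈⟨ *-congʳ (trans (Πⁿ-* T _ _) (Πⁿ-cong T (λ i → 1-y² _))) ⟩
          Πᵒ (λ y → 1# - y ^ 2) Q * h₄      ≈⟨ *-cong (Πᵒ-pow Q 2) (sym (pow-pow Q 2 2)) ⟩
          Πᵒ minus (Q ^ 2) * η ((Q ^ 2) ^ 2) ≈⟨ Πᵒ-η (^-nil 1 nil) ⟩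
          h₂                                ∎

      ΘG-eta : ΘG Q * (η Q * η (Q ^ 6)) ≈ η (Q ^ 2) * η (Q ^ 2) * η (Q ^ 3)
      ΘG-eta = begin
        h₂ * p * (η Q * η (Q ^ 6))     ≈⟨ *-congˡ (*-congʳ (sym (Πᵒ-η nil))) ⟩
        h₂ * p * (o * h₂ * η (Q ^ 6))  ≈⟨ solve 4 (λ h p o g → h :* p :* (o :* h :* g) := h :* h :* (p :* o :* g)) refl _ _ _ _ ⟩
        h₂ * h₂ * (p * o * η (Q ^ 6))  ≈⟨ *-congˡ po ⟩
        h₂ * h₂ * η (Q ^ 3)            ∎
        where
        h₂ p o : Carrier
        h₂ = η (Q ^ 2)
        p = Πᵒ (trinomial 1#) Q
        o = Πᵒ minus Q
        po : p * o * η (Q ^ 6) ≈ η (Q ^ 3)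
        po = begin
          p * o * η (Q ^ 6)                     ≈⟨ *-congʳ (trans (Πⁿ-* T _ _) (Πⁿ-cong T (λ i → 1-y³ _))) ⟩
          Πᵒ (λ y → 1# - y ^ 3) Q * η (Q ^ 6)   ≈⟨ *-cong (Πᵒ-pow Q 3) (sym (pow-pow Q 3 2)) ⟩
          Πᵒ minus (Q ^ 3) * η ((Q ^ 3) ^ 2)  ≈⟨ Πᵒ-η (^-nil 2 nil) ⟩
          η (Q ^ 3)                             ∎

      Θψ-eta : Θψ Q * η (Q ^ 2) ≈ η (Q ^ 4) * η (Q ^ 4)
      Θψ-eta = begin
        η (Q ^ 2) * Πᵉ (trinomial 2#) Q * η (Q ^ 2)  ≈⟨ *-congʳ (*-congˡ Πᵉ-square) ⟩
        η (Q ^ 2) * (Πᵉ plus Q * Πᵉ plus Q) * η (Q ^ 2)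
          ≈⟨ solve 2 (λ h p → h :* (p :* p) :* h := (p :* h) :* (p :* h)) refl _ _ ⟩
        (Πᵉ plus Q * η (Q ^ 2)) * (Πᵉ plus Q * η (Q ^ 2))  ≈⟨ *-cong Πᵉ-plus Πᵉ-plus ⟩
        η (Q ^ 4) * η (Q ^ 4) ∎

      ΘB-eta : ΘB Q ≈ η (Q ^ 6)
      ΘB-eta = begin
        η (Q ^ 2) * Πᵉ (trinomial 1#) Q        ≈⟨ *-comm _ _ ⟩
        Πᵉ (trinomial 1#) Q * η (Q ^ 2)        ≈⟨ *-congˡ (Πᵉ≈η nil) ⟨
        Πᵉ (trinomial 1#) Q * Πᵉ minus Q     ≈⟨ trans (Πⁿ-* T _ _) (Πⁿ-cong T (λ i → 1-y³ _)) ⟩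
        Πᵉ (λ y → 1# - y ^ 3) Q                ≈⟨ trans (Πᵉ-pow 2 nil) (pow-pow Q 3 2) ⟩
        η (Q ^ 6)                              ∎

      ΘD-eta : ΘD Q * (η (Q ^ 4) * η (Q ^ 6)) ≈ η (Q ^ 2) * η (Q ^ 2) * η (Q ^ 12)
      ΘD-eta = begin
        h₂ * d * (η (Q ^ 4) * η (Q ^ 6))       ≈⟨ *-congˡ (*-congʳ Πᵉ-plus) ⟨
        h₂ * d * (p * h₂ * η (Q ^ 6))          ≈⟨ solve 4 (λ h d p g → h :* d :* (p :* h :* g) := h :* h :* ((d :* p) :* g)) refl _ _ _ _ ⟩
        h₂ * h₂ * ((d * p) * η (Q ^ 6))        ≈⟨ *-congˡ dp ⟩
        h₂ * h₂ * η (Q ^ 12)                   ∎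
        where
        h₂ d p : Carrier
        h₂ = η (Q ^ 2)
        d = Πᵉ (trinomial (- 1#)) Q
        p = Πᵉ plus Q
        dp : (d * p) * η (Q ^ 6) ≈ η (Q ^ 12)
        dp = begin
          (d * p) * η (Q ^ 6)                  ≈⟨ *-congˡ (trans (Πᵉ-pow 2 nil) (pow-pow Q 3 2)) ⟨
          (d * p) * Πᵉ (λ y → 1# - y ^ 3) Q    ≈⟨ trans (*-congʳ (Πⁿ-* T _ _)) (trans (Πⁿ-* T _ _) (Πⁿ-cong T (λ i → 1-y⁶ _))) ⟩
          Πᵉ (λ y → 1# - y ^ 6) Q              ≈⟨ trans (Πᵉ-pow 5 nil) (pow-pow Q 6 2) ⟩
          η (Q ^ 12)                           ∎

  -- Weights z^n + z^(-n) and (z^n + z^(-n-1)) / (1 + z^(-1)) for a primitive sixth root of unity z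

  L⁺ V⁺ : ℕ → Carrier
  L⁺ zero          = 1# + 1#
  L⁺ (suc zero)    = 1#
  L⁺ (suc (suc n)) = L⁺ (suc n) - L⁺ n
  V⁺ zero          = 1#
  V⁺ (suc zero)    = 0#
  V⁺ (suc (suc n)) = V⁺ (suc n) - V⁺ n

  L V : ℤ → Carrier
  L (+ n)    = L⁺ n
  L -[1+ n ] = L⁺ (suc n)
  V (+ n)    = V⁺ n
  V -[1+ n ] = V⁺ n

  -- The factor `1#` is kept so that this is literally the hypothesis on `W` in the triple product
  -- at t = 1.
  Recurrent : (ℤ → Carrier) → Set ℓ
  Recurrent W = ∀ n → W (ℤ.suc n) + W (ℤ.pred n) ≈ 1# * W n

  x-y+y≈1*x : ∀ x y → (x - y) + y ≈ 1# * x
  x-y+y≈1*x = solve 2 (λ x y → (x :- y) :+ y := con (+ 1) :* x) refl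

  y+[x-y]≈1*x : ∀ x y → y + (x - y) ≈ 1# * x
  y+[x-y]≈1*x = solve 2 (λ x y → y :+ (x :- y) := con (+ 1) :* x) refl

  L-rec : Recurrent L
  L-rec (+ zero)     = sym (*-identityˡ _)
  L-rec (+ suc n)    = x-y+y≈1*x _ _
  L-rec -[1+ zero ]  = y+[x-y]≈1*x _ _
  L-rec -[1+ suc n ] = y+[x-y]≈1*x _ _

  V-rec : Recurrent V
  V-rec (+ zero)     = trans (+-comm _ _) (trans (+-identityʳ _) (sym (*-identityˡ _)))
  V-rec (+ suc n)    = x-y+y≈1*x _ _
  V-rec -[1+ zero ]  = trans (+-identityʳ _) (sym (*-identityˡ _))
  V-rec -[1+ suc n ] = y+[x-y]≈1*x _ _

  forward : ∀ {W} → Recurrent W → ∀ n → W (ℤ.suc n) ≈ W n - W (ℤ.pred n)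
  forward {W} rec n = begin
    W (ℤ.suc n)                                   ≈⟨ solve 2 (λ a b → a := (a :+ b) :- b) refl _ (W (ℤ.pred n)) ⟩
    (W (ℤ.suc n) + W (ℤ.pred n)) - W (ℤ.pred n)   ≈⟨ +-congʳ (trans (rec n) (*-identityˡ _)) ⟩
    W n - W (ℤ.pred n)                            ∎

  backward : ∀ {W} → Recurrent W → ∀ n → W (ℤ.pred n) ≈ W n - W (ℤ.suc n)
  backward {W} rec n = begin
    W (ℤ.pred n)                                  ≈⟨ solve 2 (λ a b → b := (a :+ b) :- a) refl (W (ℤ.suc n)) _ ⟩
    (W (ℤ.suc n) + W (ℤ.pred n)) - W (ℤ.suc n)    ≈⟨ +-congʳ (trans (rec n) (*-identityˡ _)) ⟩
    W n - W (ℤ.suc n)                             ∎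

  -- Two consecutive values determine a solution in both directions. This replaces calculations with
  -- explicit roots of unity: an identity between weights is checked at 0 and -1 only.
  Recurrent-unique : ∀ {X Y} → Recurrent X → Recurrent Y → X (+ 0) ≈ Y (+ 0) → X -[1+ 0 ] ≈ Y -[1+ 0 ] →
                     ∀ n → X n ≈ Y n
  Recurrent-unique {X} {Y} X-rec Y-rec eq₀ eq₋₁ = λ where
      (+ n)    → proj₂ (up n)
      -[1+ n ] → proj₂ (down n)
    where
    up : ∀ n → X (ℤ.pred (+ n)) ≈ Y (ℤ.pred (+ n)) × X (+ n) ≈ Y (+ n)
    up zero    = eq₋₁ , eq₀
    up (suc n) with up n
    ... | eq₋ , eq = eq , trans (forward X-rec (+ n)) (trans (+-cong eq (-‿cong eq₋)) (sym (forward Y-rec (+ n))))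
    down : ∀ n → X (ℤ.suc -[1+ n ]) ≈ Y (ℤ.suc -[1+ n ]) × X -[1+ n ] ≈ Y -[1+ n ]
    down zero    = eq₀ , eq₋₁
    down (suc n) with down n
    ... | eq₊ , eq = eq , trans (backward X-rec -[1+ n ]) (trans (+-cong eq (-‿cong eq₊)) (sym (backward Y-rec -[1+ n ])))

  Recurrent-shift : ∀ {W} i → Recurrent W → Recurrent (λ n → W (i ℤ.+ n))
  Recurrent-shift {W} i rec n = trans
    (+-cong (reflexive (≡.cong W (ℤ-solve 2 (λ i n → i :+ᶻ (conᶻ (+ 1) :+ᶻ n) :=ᶻ conᶻ (+ 1) :+ᶻ (i :+ᶻ n)) ≡.refl i n)))
            (reflexive (≡.cong W (ℤₚ.+-pred i n))))
    (rec (i ℤ.+ n))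

  Recurrent-reflect : ∀ {W} i → Recurrent W → Recurrent (λ n → W (i ℤ.- n))
  Recurrent-reflect {W} i rec n = trans (+-comm _ _) (trans
    (+-cong (reflexive (≡.cong W (ℤ-solve 2 (λ i n → i :-ᶻ (conᶻ (ℤ.- + 1) :+ᶻ n) :=ᶻ conᶻ (+ 1) :+ᶻ (i :-ᶻ n)) ≡.refl i n)))
            (reflexive (≡.cong W (ℤ-solve 2 (λ i n → i :-ᶻ (conᶻ (+ 1) :+ᶻ n) :=ᶻ conᶻ (ℤ.- + 1) :+ᶻ (i :-ᶻ n)) ≡.refl i n))))
    (rec (i ℤ.- n)))

  Recurrent-+ : ∀ {X Y} → Recurrent X → Recurrent Y → Recurrent (λ n → X n + Y n)
  Recurrent-+ X-rec Y-rec n = trans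
    (solve 4 (λ a b c d → (a :+ b) :+ (c :+ d) := (a :+ c) :+ (b :+ d)) refl _ _ _ _)
    (trans (+-cong (X-rec n) (Y-rec n)) (sym (distribˡ _ _ _)))

  Recurrent-* : ∀ {X} a → Recurrent X → Recurrent (λ n → a * X n)
  Recurrent-* a X-rec n = trans (sym (distribˡ _ _ _)) (trans (*-congˡ (X-rec n))
    (solve 2 (λ a x → a :* (con (+ 1) :* x) := con (+ 1) :* (a :* x)) refl _ _))

  -- The product formula for z^m + z^(-m). For fixed m both sides solve the same recurrence in n.
  L-* : ∀ m n → L m * L n ≈ L (m ℤ.+ n) + L (m ℤ.- n)
  L-* m = Recurrent-unique (Recurrent-* (L m) L-rec) (Recurrent-+ (Recurrent-shift m L-rec) (Recurrent-reflect m L-rec))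
    (trans (solve 1 (λ x → x :* con (+ 2) := x :+ x) refl (L m))
      (+-cong (reflexive (≡.cong L (≡.sym (ℤₚ.+-identityʳ m)))) (reflexive (≡.cong L (≡.sym (ℤₚ.+-identityʳ m))))))
    (begin
      L m * 1#                           ≈⟨ *-comm _ _ ⟩
      1# * L m                           ≈⟨ L-rec m ⟨
      L (ℤ.suc m) + L (ℤ.pred m)         ≈⟨ +-comm _ _ ⟩
      L (ℤ.pred m) + L (ℤ.suc m)         ≈⟨ +-cong (reflexive (≡.cong L (ℤₚ.+-comm -[1+ 0 ] m))) (reflexive (≡.cong L (ℤₚ.+-comm (+ 1) m))) ⟩
      L (m ℤ.+ -[1+ 0 ]) + L (m ℤ.+ + 1) ∎)

  -- Bracketed exactly as `fromℤ (+ 3)` unfolds, so that solver proofs with the constant 3 apply to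
  -- it.
  3# : Carrier
  3# = (1# + 1#) + 1#

  3V : ∀ n → 3# * V n ≈ L (ℤ.suc n) + L n
  3V = Recurrent-unique (Recurrent-* 3# V-rec) (Recurrent-+ (Recurrent-shift (+ 1) L-rec) L-rec)
    (solve 0 (con (+ 3) :* con (+ 1) := con (+ 1) :+ con (+ 2)) refl)
    (solve 0 (con (+ 3) :* con (+ 1) := con (+ 2) :+ con (+ 1)) refl)

  -- The source of the factor 3. The product of the numerators z^n + z^(-n-1) of V(m) and V(n) is
  -- z^(-1) times the right-hand side, and the squared denominator is (1 + z^(-1))² = z^(-1) (z + 2
  -- + z^(-1)) = 3 z^(-1).
  3V-* : ∀ m n → 3# * (V m * V n) ≈ L (ℤ.suc m ℤ.+ n) + L (m ℤ.- n)
  3V-* m n = trans (sym (*-assoc _ _ _)) (Recurrent-unique (Recurrent-* (3# * V m) V-rec)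
    (Recurrent-+ (Recurrent-shift (ℤ.suc m) L-rec) (Recurrent-reflect m L-rec))
    (trans (*-identityʳ _) (trans (3V m) (+-cong (reflexive (≡.cong L (≡.sym (ℤₚ.+-identityʳ (ℤ.suc m)))))
                                                 (reflexive (≡.cong L (≡.sym (ℤₚ.+-identityʳ m)))))))
    (trans (*-identityʳ _) (trans (3V m) (trans (+-comm _ _)
      (+-cong (reflexive (≡.cong L (ℤ-solve 1 (λ m → m :=ᶻ (conᶻ (+ 1) :+ᶻ m) :+ᶻ conᶻ (ℤ.- + 1)) ≡.refl m)))
              (reflexive (≡.cong L (ℤₚ.+-comm (+ 1) m))))))) n)

  -- The step from n to n + 1 multiplies by z², a primitive cube root of unity; hence t = z² +
  -- z^(-2) = -1.
  L-odd : ℤ → Carrier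
  L-odd n = L (ℤ.suc (n ℤ.+ n))

  L-odd-rec : ∀ n → L-odd (ℤ.suc n) + L-odd (ℤ.pred n) ≈ - 1# * L-odd n
  L-odd-rec n = begin
    L-odd (ℤ.suc n) + L-odd (ℤ.pred n)
      ≈⟨ +-cong (reflexive (≡.cong L (ℤ-solve 1 (λ n → conᶻ (+ 1) :+ᶻ ((conᶻ (+ 1) :+ᶻ n) :+ᶻ (conᶻ (+ 1) :+ᶻ n))
                    :=ᶻ conᶻ (+ 1) :+ᶻ (conᶻ (+ 1) :+ᶻ (conᶻ (+ 1) :+ᶻ (n :+ᶻ n)))) ≡.refl n)))
                (reflexive (≡.cong L (ℤ-solve 1 (λ n → conᶻ (+ 1) :+ᶻ ((conᶻ (ℤ.- + 1) :+ᶻ n) :+ᶻ (conᶻ (ℤ.- + 1) :+ᶻ n))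
                    :=ᶻ conᶻ (ℤ.- + 1) :+ᶻ (conᶻ (ℤ.- + 1) :+ᶻ (conᶻ (+ 1) :+ᶻ (n :+ᶻ n)))) ≡.refl n))) ⟩
    L (ℤ.suc (ℤ.suc m)) + L (ℤ.pred (ℤ.pred m))
      ≈⟨ +-cong (forward L-rec (ℤ.suc m)) (backward L-rec (ℤ.pred m)) ⟩
    (L (ℤ.suc m) - L (ℤ.pred (ℤ.suc m))) + (L (ℤ.pred m) - L (ℤ.suc (ℤ.pred m)))
      ≈⟨ +-cong (+-congˡ (-‿cong (reflexive (≡.cong L (ℤₚ.pred-suc m))))) (+-congˡ (-‿cong (reflexive (≡.cong L (ℤₚ.suc-pred m))))) ⟩
    (L (ℤ.suc m) - L m) + (L (ℤ.pred m) - L m)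
      ≈⟨ solve 3 (λ a b c → (a :- c) :+ (b :- c) := (a :+ b) :- con (+ 2) :* c) refl _ _ _ ⟩
    (L (ℤ.suc m) + L (ℤ.pred m)) - (1# + 1#) * L m
      ≈⟨ +-congʳ (L-rec m) ⟩
    1# * L m - (1# + 1#) * L m
      ≈⟨ solve 1 (λ x → con (+ 1) :* x :- con (+ 2) :* x := con (ℤ.- + 1) :* x) refl _ ⟩
    - 1# * L m ∎
    where
    m : ℤ
    m = ℤ.suc (n ℤ.+ n)

  ∣i∣≤∣i+i∣ : ∀ i → ∣ i ∣ ℕ.≤ ∣ i ℤ.+ i ∣
  ∣i∣≤∣i+i∣ (+ n)    = ℕₚ.m≤m+n n n
  ∣i∣≤∣i+i∣ -[1+ n ] = s≤s (ℕₚ.m≤n⇒m≤1+n (ℕₚ.m≤m+n n n))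

  ∣i∣≤∣1+[i+i]∣ : ∀ i → ∣ i ∣ ℕ.≤ ∣ ℤ.suc (i ℤ.+ i) ∣
  ∣i∣≤∣1+[i+i]∣ (+ n)    = ℕₚ.m≤n⇒m≤1+n (ℕₚ.m≤m+n n n)
  ∣i∣≤∣1+[i+i]∣ -[1+ n ] = s≤s (ℕₚ.m≤m+n n n)

  Vanishes₂-map : ∀ {b F} (h : ℤ → ℤ) → (∀ j → ∣ j ∣ ℕ.≤ ∣ h j ∣) → Vanishes₂ b F → Vanishes₂ b (λ i j → F i (h j))
  Vanishes₂-map h ∣h∣ v = record
    { ₁ = λ i j → Vanishes₂.₁ v i (h j)
    ; ₂ = λ i j b<j → Vanishes₂.₂ v i (h j) (ℕₚ.<-≤-trans b<j (∣h∣ j)) }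

  Σᶻ-cong₂ : ∀ {F G : ℤ → ℤ → Carrier} → (∀ i j → F i j ≈ G i j) → ∀ K →
             Σᶻ K (λ i → Σᶻ K (F i)) ≈ Σᶻ K (λ i → Σᶻ K (G i))
  Σᶻ-cong₂ F≈G K = Σᶻ-cong (λ i → Σᶻ-cong (F≈G i) K) K

  Σᶻ-+₂ : ∀ K (F G : ℤ → ℤ → Carrier) →
          Σᶻ K (λ i → Σᶻ K (λ j → F i j + G i j)) ≈ Σᶻ K (λ i → Σᶻ K (F i)) + Σᶻ K (λ i → Σᶻ K (G i))
  Σᶻ-+₂ K F G = trans (Σᶻ-cong (λ i → Σᶻ-+ K (F i) (G i)) K) (Σᶻ-+ K _ _)

  -- Even and odd parts of two products of theta functions.

  module Dissections {q M} (nil : Nilpotent q M) where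

    open EtaQuotients M

    -- The subring generated by q², up to the equality of the ring. Coefficients do not exist in an
    -- abstract ring, so membership takes the place of the statement that no odd power of q occurs.
    data Even : Carrier → Set (c ⊔ ℓ) where
      1ᵉ    : Even 1#
      q²ᵉ   : Even (q ^ 2)
      _+ᵉ_  : ∀ {x y} → Even x → Even y → Even (x + y)
      _*ᵉ_  : ∀ {x y} → Even x → Even y → Even (x * y)
      -ᵉ_   : ∀ {x} → Even x → Even (- x)
      resp  : ∀ {x y} → x ≈ y → Even x → Even y

    ^ᵉ : ∀ {x} n → Even x → Even (x ^ n)
    ^ᵉ zero    ev = 1ᵉ
    ^ᵉ (suc n) ev = ev *ᵉ ^ᵉ n ev

    q^2*ᵉ : ∀ n → Even (q ^ (2 ℕ.* n))
    q^2*ᵉ n = resp (^-assocʳ q 2 n) (^ᵉ n q²ᵉ)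

    Σᶻᵉ : ∀ K {g} → (∀ i → Even (g i)) → Even (Σᶻ K g)
    Σᶻᵉ zero    ev = ev _
    Σᶻᵉ (suc K) ev = Σᶻᵉ K ev +ᵉ (ev _ +ᵉ ev _)

    Πⁿᵉ : ∀ n {g} → (∀ i → Even (g i)) → Even (Πⁿ n g)
    Πⁿᵉ zero    ev = 1ᵉ
    Πⁿᵉ (suc n) ev = Πⁿᵉ n ev *ᵉ ev n

    ηᵉ : ∀ n → Even (η (q ^ (2 ℕ.* n)))
    ηᵉ n = Πⁿᵉ M (λ i → 1ᵉ +ᵉ (-ᵉ ^ᵉ (suc i) (q^2*ᵉ n)))

    L⁺ᵉ : ∀ n → Even (L⁺ n)
    L⁺ᵉ zero          = 1ᵉ +ᵉ 1ᵉ
    L⁺ᵉ (suc zero)    = 1ᵉ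
    L⁺ᵉ (suc (suc n)) = L⁺ᵉ (suc n) +ᵉ (-ᵉ L⁺ᵉ n)

    Lᵉ : ∀ i → Even (L i)
    Lᵉ (+ n)    = L⁺ᵉ n
    Lᵉ -[1+ n ] = L⁺ᵉ (suc n)

    q^-cong : ∀ {m n} → m ≡ n → q ^ m ≈ q ^ n
    q^-cong ≡.refl = refl

    abstract
      -- One range for all sums: shears enlarge a support of size M twice, to 4M, and the triple
      -- product asks for more than T + 1 = 2M + 2. Opacity keeps the number from being unfolded.
      K : ℕ
      K = suc (suc (suc (M ℕ.+ M ℕ.+ (M ℕ.+ M))))

      4M≤K : M ℕ.+ M ℕ.+ (M ℕ.+ M) ℕ.≤ K
      4M≤K = ℕₚ.m≤n+m _ 3

      2M<K : M ℕ.+ M ℕ.< K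
      2M<K = s≤s (ℕₚ.≤-trans (ℕₚ.m≤m+n (M ℕ.+ M) (M ℕ.+ M)) (ℕₚ.m≤n+m _ 2))

      T+s<K : ∀ {s} → s ℕ.≤ 1 → T ℕ.+ s ℕ.< K
      T+s<K s≤1 = s≤s (ℕₚ.≤-trans (ℕₚ.+-monoʳ-≤ T s≤1)
        (ℕₚ.≤-trans (ℕₚ.≤-reflexive (ℕₚ.+-comm T 1)) (s≤s (s≤s (ℕₚ.m≤m+n (M ℕ.+ M) (M ℕ.+ M))))))

    module E₀ = FiniteTripleProduct q 0 z≤n
    module E₁ = FiniteTripleProduct q 1 ℕₚ.≤-refl

    e₀ e₁ : ℤ → ℕ
    e₀ = E₀.e
    e₁ = E₁.e

    Σ₀ : ∀ k t W → (∀ n → W (ℤ.suc n) + W (ℤ.pred n) ≈ t * W n) → W (+ 0) ≈ 2# →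
         Σᶻ K (λ n → W n * q ^ (suc k ℕ.* e₀ n)) ≈ 2# * (η ((q ^ suc k) ^ 2) * Πᵒ (trinomial t) (q ^ suc k))
    Σ₀ k t W W-rec W-init = begin
      Σᶻ K (λ n → W n * q ^ (suc k ℕ.* e₀ n))
        ≈⟨ Σᶻ-cong (λ n → *-congˡ (sym (^-assocʳ q (suc k) (e₀ n)))) K ⟩
      Σᶻ K (λ n → W n * (q ^ suc k) ^ e₀ n)
        ≈⟨ TripleProduct.tripleProduct (^-nil k nil) 0 z≤n {T} ℕₚ.≤-refl t W W-rec
             (trans (+-congˡ (zeroʳ _)) (trans (+-identityʳ _) W-init)) (T+s<K z≤n) ⟩
      2# * (Πⁿ M (λ i → 1# - (q ^ suc k) ^ (suc i ℕ.+ suc i)) * Πᵒ (trinomial t) (q ^ suc k))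
        ≈⟨ *-congˡ (*-congʳ (Πⁿ-cong M (λ i → +-congˡ (-‿cong (^-double (q ^ suc k) (suc i)))))) ⟩
      2# * (η ((q ^ suc k) ^ 2) * Πᵒ (trinomial t) (q ^ suc k)) ∎

    Σ₁ : ∀ k t W → (∀ n → W (ℤ.suc n) + W (ℤ.pred n) ≈ t * W n) → W (+ 0) + W -[1+ 0 ] ≈ 2# →
         Σᶻ K (λ n → W n * q ^ (suc k ℕ.* e₁ n)) ≈ 2# * (η ((q ^ suc k) ^ 2) * Πᵉ (trinomial t) (q ^ suc k))
    Σ₁ k t W W-rec W-init = begin
      Σᶻ K (λ n → W n * q ^ (suc k ℕ.* e₁ n))
        ≈⟨ Σᶻ-cong (λ n → *-congˡ (sym (^-assocʳ q (suc k) (e₁ n)))) K ⟩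
      Σᶻ K (λ n → W n * (q ^ suc k) ^ e₁ n)
        ≈⟨ TripleProduct.tripleProduct (^-nil k nil) 1 ℕₚ.≤-refl {T} ℕₚ.≤-refl t W W-rec
             (trans (+-congˡ (*-identityʳ _)) W-init) (T+s<K ℕₚ.≤-refl) ⟩
      2# * (Πⁿ M (λ i → 1# - (q ^ suc k) ^ (suc i ℕ.+ suc i)) * Πᵉ (trinomial t) (q ^ suc k))
        ≈⟨ *-congˡ (*-congʳ (Πⁿ-cong M (λ i → +-congˡ (-‿cong (^-double (q ^ suc k) (suc i)))))) ⟩
      2# * (η ((q ^ suc k) ^ 2) * Πᵉ (trinomial t) (q ^ suc k)) ∎

    Vanishes₂-q^ : ∀ (W : ℤ → ℤ → Carrier) (ε : ℤ → ℤ → ℕ) →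
                   (∀ i j → ∣ i ∣ ℕ.≤ suc (ε i j)) → (∀ i j → ∣ j ∣ ℕ.≤ suc (ε i j)) →
                   Vanishes₂ M (λ i j → W i j * q ^ ε i j)
    Vanishes₂-q^ W ε ∣i∣≤ ∣j∣≤ = record
      { ₁ = λ i j M<i → trans (*-congˡ (nil _ (ℕₚ.≤-pred (ℕₚ.<-≤-trans M<i (∣i∣≤ i j))))) (zeroʳ _)
      ; ₂ = λ i j M<j → trans (*-congˡ (nil _ (ℕₚ.≤-pred (ℕₚ.<-≤-trans M<j (∣j∣≤ i j))))) (zeroʳ _) }

    e₀-neg : ∀ i → e₀ (ℤ.- i) ≡ e₀ i
    e₀-neg i = ℤₚ.+-injective (≡.trans (E₀.+e≡ (ℤ.- i)) (≡.trans
      (ℤ-solve 1 (λ i → (:-ᶻ i) :*ᶻ ((:-ᶻ i) :+ᶻ conᶻ (+ 0)) :=ᶻ i :*ᶻ (i :+ᶻ conᶻ (+ 0))) ≡.refl i) (≡.sym (E₀.+e≡ i))))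

    e₁-reflect : ∀ i → e₁ (ℤ.- ℤ.suc i) ≡ e₁ i
    e₁-reflect i = ℤₚ.+-injective (≡.trans (E₁.+e≡ (ℤ.- ℤ.suc i)) (≡.trans
      (ℤ-solve 1 (λ i → (:-ᶻ (conᶻ (+ 1) :+ᶻ i)) :*ᶻ ((:-ᶻ (conᶻ (+ 1) :+ᶻ i)) :+ᶻ conᶻ (+ 1)) :=ᶻ i :*ᶻ (i :+ᶻ conᶻ (+ 1))) ≡.refl i)
      (≡.sym (E₁.+e≡ i))))

    -- Θ_G(q) Θ_G(q³) is a sum over the form m² + 3n²; its odd part is matched with q Θ_ψ(q) Θ_D(q³) by
    -- multiplication with the unit (1 + √-3)/2, which sends m + n√-3 with m + n odd to (x + y√-3)/2
    -- with x ≡ y mod 4.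
    module A where

      F : ℤ → ℤ → Carrier
      F i j = L (j ℤ.- i) * q ^ (e₀ j ℕ.+ 3 ℕ.* e₀ i)

      F-vanishes : Vanishes₂ M F
      F-vanishes = Vanishes₂-q^ _ _
        (λ i j → ℕₚ.≤-trans (E₀.∣i∣≤1+e i) (s≤s (ℕₚ.≤-trans (ℕₚ.m≤n*m (e₀ i) 3) (ℕₚ.m≤n+m (3 ℕ.* e₀ i) (e₀ j)))))
        (λ i j → ℕₚ.≤-trans (E₀.∣i∣≤1+e j) (s≤s (ℕₚ.m≤m+n (e₀ j) (3 ℕ.* e₀ i))))

      ev od : Carrier
      ev = Σᶻ K (λ i → Σᶻ K (λ j → F i (i ℤ.+ (j ℤ.+ j))))
      od = Σᶻ K (λ i → Σᶻ K (λ j → F i (i ℤ.+ ℤ.suc (j ℤ.+ j))))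

      ev-even : Even ev
      ev-even = Σᶻᵉ K (λ i → Σᶻᵉ K (λ j → Lᵉ ((i ℤ.+ (j ℤ.+ j)) ℤ.- i) *ᵉ resp (sym (q^-cong (exponent i j))) (q^2*ᵉ (half i j))))
        where
        half : ℤ → ℤ → ℕ
        -- From (i + 2j)² + 3i² = 4 (i² + ij + j²).
        half i j = ∣ + 2 ℤ.* (i ℤ.* i ℤ.+ i ℤ.* j ℤ.+ j ℤ.* j) ∣
        exponent : ∀ i j → e₀ (i ℤ.+ (j ℤ.+ j)) ℕ.+ 3 ℕ.* e₀ i ≡ 2 ℕ.* half i j
        exponent i j = ≡.trans (≡.cong ∣_∣ {+ (e₀ (i ℤ.+ (j ℤ.+ j)) ℕ.+ 3 ℕ.* e₀ i)}
          (≡.trans (≡.cong₂ ℤ._+_ (E₀.+e≡ (i ℤ.+ (j ℤ.+ j))) (≡.trans (ℤₚ.pos-* 3 (e₀ i)) (≡.cong (+ 3 ℤ.*_) (E₀.+e≡ i))))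
            (ℤ-solve 2 (λ i j → (i :+ᶻ (j :+ᶻ j)) :*ᶻ ((i :+ᶻ (j :+ᶻ j)) :+ᶻ conᶻ (+ 0)) :+ᶻ conᶻ (+ 3) :*ᶻ (i :*ᶻ (i :+ᶻ conᶻ (+ 0)))
              :=ᶻ conᶻ (+ 2) :*ᶻ (conᶻ (+ 2) :*ᶻ (i :*ᶻ i :+ᶻ i :*ᶻ j :+ᶻ j :*ᶻ j))) ≡.refl i j)))
          (ℤₚ.abs-* (+ 2) (+ 2 ℤ.* (i ℤ.* i ℤ.+ i ℤ.* j ℤ.+ j ℤ.* j)))

      GG : (2# * ΘG (q ^ 1)) * (2# * ΘG (q ^ 3)) ≈ 2# * (ev + od)
      GG = begin
        (2# * ΘG (q ^ 1)) * (2# * ΘG (q ^ 3))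
          ≈⟨ trans (*-comm _ _) (sym (*-cong (Σ₀ 2 1# L L-rec refl) (Σ₀ 0 1# L L-rec refl))) ⟩
        Σᶻ K (λ n → L n * q ^ (3 ℕ.* e₀ n)) * Σᶻ K (λ n → L n * q ^ (1 ℕ.* e₀ n))
          ≈⟨ Σᶻ-* K _ _ ⟩
        Σᶻ K (λ i → Σᶻ K (λ j → (L i * q ^ (3 ℕ.* e₀ i)) * (L j * q ^ (1 ℕ.* e₀ j))))
          -- `L-*` splits each term into one with L(j + i) and one with L(j - i). The map i ↦ -i
          -- interchanges them and fixes the exponent, so the sum is twice that of `F`.
          ≈⟨ Σᶻ-cong₂ expand K ⟩
        Σᶻ K (λ i → Σᶻ K (λ j → F (ℤ.- i) j + F i j))
          ≈⟨ Σᶻ-+₂ K _ _ ⟩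
        Σᶻ K (λ i → Σᶻ K (F (ℤ.- i))) + Σᶻ K (λ i → Σᶻ K (F i))
          ≈⟨ +-congʳ (Σᶻ-neg K (λ i → Σᶻ K (F i))) ⟩
        Σᶻ K (λ i → Σᶻ K (F i)) + Σᶻ K (λ i → Σᶻ K (F i))
          ≈⟨ +-cong (Σᶻ-parity₂ F-vanishes 2M≤K) (Σᶻ-parity₂ F-vanishes 2M≤K) ⟩
        (ev + od) + (ev + od)
          ≈⟨ solve 1 (λ x → x :+ x := con (+ 2) :* x) refl _ ⟩
        2# * (ev + od) ∎
        where
        2M≤K : M ℕ.+ M ℕ.≤ K
        2M≤K = ℕₚ.<⇒≤ 2M<K
        expand : ∀ i j → (L i * q ^ (3 ℕ.* e₀ i)) * (L j * q ^ (1 ℕ.* e₀ j)) ≈ F (ℤ.- i) j + F i j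
        expand i j = begin
          (L i * q ^ (3 ℕ.* e₀ i)) * (L j * q ^ (1 ℕ.* e₀ j))
            ≈⟨ solve 4 (λ a b c d → (a :* b) :* (c :* d) := (c :* a) :* (d :* b)) refl _ _ _ _ ⟩
          (L j * L i) * (q ^ (1 ℕ.* e₀ j) * q ^ (3 ℕ.* e₀ i))
            ≈⟨ *-cong (L-* j i) (trans (*-congʳ (q^-cong (ℕₚ.*-identityˡ (e₀ j)))) (sym (^-homo-* q (e₀ j) (3 ℕ.* e₀ i)))) ⟩
          (L (j ℤ.+ i) + L (j ℤ.- i)) * q ^ (e₀ j ℕ.+ 3 ℕ.* e₀ i)
            ≈⟨ distribʳ _ _ _ ⟩
          L (j ℤ.+ i) * q ^ (e₀ j ℕ.+ 3 ℕ.* e₀ i) + F i j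
            ≈⟨ +-congʳ (*-cong (reflexive (≡.cong (λ k → L (j ℤ.+ k)) (≡.sym (ℤₚ.neg-involutive i))))
                               (q^-cong (≡.cong (λ k → e₀ j ℕ.+ 3 ℕ.* k) (≡.sym (e₀-neg i))))) ⟩
          F (ℤ.- i) j + F i j ∎

      F′ : ℤ → ℤ → Carrier
      F′ i j = L-odd i * q ^ (suc (e₁ j) ℕ.+ 3 ℕ.* e₁ i)

      F′-vanishes : Vanishes₂ M F′
      F′-vanishes = Vanishes₂-q^ _ _
        (λ i j → ℕₚ.≤-trans (E₁.∣i∣≤1+e i) (s≤s (ℕₚ.≤-trans (ℕₚ.m≤n*m (e₁ i) 3) (ℕₚ.m≤n+m (3 ℕ.* e₁ i) (suc (e₁ j))))))
        (λ i j → ℕₚ.≤-trans (E₁.∣i∣≤1+e j) (ℕₚ.m≤n⇒m≤1+n (s≤s (ℕₚ.m≤m+n (e₁ j) (3 ℕ.* e₁ i)))))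

      F′-reflect : ∀ i j → F′ i (ℤ.- ℤ.suc j) ≈ F′ i j
      F′-reflect i j = *-congˡ (q^-cong (≡.cong (λ k → suc k ℕ.+ 3 ℕ.* e₁ i) (e₁-reflect j)))

      -- In coordinates: (c + 2b + 1)² + 3c² = (x² + 3y²)/4 with x = 2b + 4c + 1 and y = 2b + 1. The
      -- weight L(2b + 1) now depends on y alone, which is what makes the sum separable; b becomes
      -- the outer index, hence the exchange of summations.
      od≈ : od ≈ Σᶻ K (λ i → Σᶻ K (λ j → F′ i (i ℤ.+ (j ℤ.+ j))))
      od≈ = trans (Σᶻ-swap K K _) (Σᶻ-cong₂ (λ b c → *-cong
          (reflexive (≡.cong L (ℤ-solve 2 (λ b c → (c :+ᶻ (conᶻ (+ 1) :+ᶻ (b :+ᶻ b))) :-ᶻ c :=ᶻ conᶻ (+ 1) :+ᶻ (b :+ᶻ b)) ≡.refl b c)))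
          (q^-cong (ℤₚ.+-injective (exponent b c)))) K)
        where
        exponent : ∀ b c → + (e₀ (c ℤ.+ ℤ.suc (b ℤ.+ b)) ℕ.+ 3 ℕ.* e₀ c) ≡ + (suc (e₁ (b ℤ.+ (c ℤ.+ c))) ℕ.+ 3 ℕ.* e₁ b)
        exponent b c = ≡.trans
          (≡.cong₂ ℤ._+_ (E₀.+e≡ (c ℤ.+ ℤ.suc (b ℤ.+ b))) (≡.trans (ℤₚ.pos-* 3 (e₀ c)) (≡.cong (+ 3 ℤ.*_) (E₀.+e≡ c))))
          (≡.trans
            (ℤ-solve 2 (λ b c → (c :+ᶻ (conᶻ (+ 1) :+ᶻ (b :+ᶻ b))) :*ᶻ ((c :+ᶻ (conᶻ (+ 1) :+ᶻ (b :+ᶻ b))) :+ᶻ conᶻ (+ 0))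
                :+ᶻ conᶻ (+ 3) :*ᶻ (c :*ᶻ (c :+ᶻ conᶻ (+ 0)))
              :=ᶻ (conᶻ (+ 1) :+ᶻ (b :+ᶻ (c :+ᶻ c)) :*ᶻ ((b :+ᶻ (c :+ᶻ c)) :+ᶻ conᶻ (+ 1)))
                :+ᶻ conᶻ (+ 3) :*ᶻ (b :*ᶻ (b :+ᶻ conᶻ (+ 1)))) ≡.refl b c)
            (≡.sym (≡.cong₂ (λ u v → ℤ.suc u ℤ.+ v) (E₁.+e≡ (b ℤ.+ (c ℤ.+ c)))
              (≡.trans (ℤₚ.pos-* 3 (e₁ b)) (≡.cong (+ 3 ℤ.*_) (E₁.+e≡ b))))))

      -- A common form for both parity classes of j relative to i. The even class is i + 2j = -i +
      -- 2(i + j), and the reflection j ↦ -1 - j, which fixes `F′`, takes the odd class to -i - 2(j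
      -- + 1). With x = 2j + 1 this is x ↦ -x exchanging the two residues of x modulo 4. Both
      -- classes hence have the same sum, and all of `F′` sums to twice the odd half of `F`.
      F″ : ℤ → ℤ → Carrier
      F″ i j = F′ i (ℤ.- i ℤ.+ (j ℤ.+ j))

      F″-vanishes : Vanishes₂ (M ℕ.+ M) F″
      F″-vanishes = Vanishes₂-map (λ j → j ℤ.+ j) ∣i∣≤∣i+i∣ (Vanishes₂-shift ℤ.-_ ℤₚ.∣-i∣≡∣i∣ F′-vanishes)

      even-a : Σᶻ K (λ i → Σᶻ K (λ j → F′ i (i ℤ.+ (j ℤ.+ j)))) ≈ Σᶻ K (λ i → Σᶻ K (F″ i))
      even-a = trans
        (Σᶻ-cong₂ (λ i j → reflexive (≡.cong (F′ i)
          (ℤ-solve 2 (λ i j → i :+ᶻ (j :+ᶻ j) :=ᶻ (:-ᶻ i) :+ᶻ ((i :+ᶻ j) :+ᶻ (i :+ᶻ j))) ≡.refl i j))) K)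
        (Σᶻ-shift₂ (λ i → i) (λ _ → ≡.refl) F″-vanishes 4M≤K)

      odd-a : Σᶻ K (λ i → Σᶻ K (λ j → F′ i (i ℤ.+ ℤ.suc (j ℤ.+ j)))) ≈ Σᶻ K (λ i → Σᶻ K (F″ i))
      odd-a = Σᶻ-cong (λ i → begin
        Σᶻ K (λ j → F′ i (i ℤ.+ ℤ.suc (j ℤ.+ j)))
          ≈⟨ Σᶻ-cong (λ j → trans (sym (F′-reflect i (i ℤ.+ ℤ.suc (j ℤ.+ j)))) (reflexive (≡.cong (F′ i)
               (ℤ-solve 2 (λ i j → :-ᶻ (conᶻ (+ 1) :+ᶻ (i :+ᶻ (conᶻ (+ 1) :+ᶻ (j :+ᶻ j))))
                  :=ᶻ (:-ᶻ i) :+ᶻ (:-ᶻ (conᶻ (+ 1) :+ᶻ j) :+ᶻ :-ᶻ (conᶻ (+ 1) :+ᶻ j))) ≡.refl i j)))) K ⟩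
        Σᶻ K (λ j → F″ i (ℤ.- ℤ.suc j))
          ≈⟨ Σᶻ-suc (λ j lt → Vanishes₂.₂ F″-vanishes i (ℤ.- j) (≡.subst (M ℕ.+ M ℕ.<_) (≡.sym (ℤₚ.∣-i∣≡∣i∣ j)) lt)) 2M<K ⟩
        Σᶻ K (λ j → F″ i (ℤ.- j))
          ≈⟨ Σᶻ-neg K (F″ i) ⟩
        Σᶻ K (F″ i) ∎) K

      ψD : (2# * Θψ (q ^ 1)) * (2# * ΘD (q ^ 3)) * q ≈ 2# * od
      ψD = begin
        (2# * Θψ (q ^ 1)) * (2# * ΘD (q ^ 3)) * q
          ≈⟨ *-congʳ (trans (*-comm _ _) (sym (*-cong (Σ₁ 2 (- 1#) L-odd L-odd-rec refl) (Σ₁ 0 2# (λ _ → 1#) (λ _ → sym (*-identityʳ _)) refl)))) ⟩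
        Σᶻ K (λ n → L-odd n * q ^ (3 ℕ.* e₁ n)) * Σᶻ K (λ n → 1# * q ^ (1 ℕ.* e₁ n)) * q
          ≈⟨ trans (*-congʳ (Σᶻ-* K _ _)) (sym (trans (Σᶻ-cong (λ i → Σᶻ-*ʳ q K _) K) (Σᶻ-*ʳ q K _))) ⟩
        Σᶻ K (λ i → Σᶻ K (λ j → ((L-odd i * q ^ (3 ℕ.* e₁ i)) * (1# * q ^ (1 ℕ.* e₁ j))) * q))
          ≈⟨ Σᶻ-cong₂ expand K ⟩
        Σᶻ K (λ i → Σᶻ K (F′ i))
          ≈⟨ Σᶻ-parity₂ F′-vanishes (ℕₚ.<⇒≤ 2M<K) ⟩
        Σᶻ K (λ i → Σᶻ K (λ j → F′ i (i ℤ.+ (j ℤ.+ j)))) + Σᶻ K (λ i → Σᶻ K (λ j → F′ i (i ℤ.+ ℤ.suc (j ℤ.+ j))))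
          ≈⟨ +-cong (sym od≈) (trans odd-a (trans (sym even-a) (sym od≈))) ⟩
        od + od
          ≈⟨ solve 1 (λ x → x :+ x := con (+ 2) :* x) refl _ ⟩
        2# * od ∎
        where
        expand : ∀ i j → ((L-odd i * q ^ (3 ℕ.* e₁ i)) * (1# * q ^ (1 ℕ.* e₁ j))) * q ≈ F′ i j
        expand i j = begin
          ((L-odd i * q ^ (3 ℕ.* e₁ i)) * (1# * q ^ (1 ℕ.* e₁ j))) * q
            ≈⟨ solve 4 (λ a b c d → ((a :* b) :* (con (+ 1) :* c)) :* d := a :* ((d :* c) :* b)) refl _ _ _ _ ⟩
          L-odd i * ((q * q ^ (1 ℕ.* e₁ j)) * q ^ (3 ℕ.* e₁ i))
            ≈⟨ *-congˡ (*-congʳ (*-congˡ (q^-cong (ℕₚ.*-identityˡ (e₁ j))))) ⟩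
          L-odd i * (q ^ suc (e₁ j) * q ^ (3 ℕ.* e₁ i))
            ≈⟨ *-congˡ (^-homo-* q (suc (e₁ j)) (3 ℕ.* e₁ i)) ⟨
          F′ i j ∎

    module B where

      F : ℤ → ℤ → Carrier
      F i j = L i * q ^ (e₀ i ℕ.+ e₀ j)

      F-vanishes : Vanishes₂ M F
      F-vanishes = Vanishes₂-q^ _ _
        (λ i j → ℕₚ.≤-trans (E₀.∣i∣≤1+e i) (s≤s (ℕₚ.m≤m+n (e₀ i) (e₀ j))))
        (λ i j → ℕₚ.≤-trans (E₀.∣i∣≤1+e j) (s≤s (ℕₚ.m≤n+m (e₀ j) (e₀ i))))

      ev od : Carrier
      ev = Σᶻ K (λ i → Σᶻ K (λ j → F i (i ℤ.+ (j ℤ.+ j))))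
      od = Σᶻ K (λ i → Σᶻ K (λ j → F i (i ℤ.+ ℤ.suc (j ℤ.+ j))))

      ev-even : Even ev
      ev-even = Σᶻᵉ K (λ i → Σᶻᵉ K (λ j → Lᵉ i *ᵉ resp (sym (q^-cong (exponent i j))) (q^2*ᵉ (half i j))))
        where
        half : ℤ → ℤ → ℕ
        half i j = ∣ i ℤ.* i ℤ.+ + 2 ℤ.* (i ℤ.* j ℤ.+ j ℤ.* j) ∣
        exponent : ∀ i j → e₀ i ℕ.+ e₀ (i ℤ.+ (j ℤ.+ j)) ≡ 2 ℕ.* half i j
        exponent i j = ≡.trans (≡.cong ∣_∣ {+ (e₀ i ℕ.+ e₀ (i ℤ.+ (j ℤ.+ j)))}
          (≡.trans (≡.cong₂ ℤ._+_ (E₀.+e≡ i) (E₀.+e≡ (i ℤ.+ (j ℤ.+ j))))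
            (ℤ-solve 2 (λ i j → i :*ᶻ (i :+ᶻ conᶻ (+ 0)) :+ᶻ (i :+ᶻ (j :+ᶻ j)) :*ᶻ ((i :+ᶻ (j :+ᶻ j)) :+ᶻ conᶻ (+ 0))
              :=ᶻ conᶻ (+ 2) :*ᶻ (i :*ᶻ i :+ᶻ conᶻ (+ 2) :*ᶻ (i :*ᶻ j :+ᶻ j :*ᶻ j))) ≡.refl i j)))
          (ℤₚ.abs-* (+ 2) (i ℤ.* i ℤ.+ + 2 ℤ.* (i ℤ.* j ℤ.+ j ℤ.* j)))

      φG : (2# * Θφ (q ^ 1)) * (2# * ΘG (q ^ 1)) ≈ 2# * (ev + od)
      φG = begin
        (2# * Θφ (q ^ 1)) * (2# * ΘG (q ^ 1))
          ≈⟨ trans (*-comm _ _) (sym (*-cong (Σ₀ 0 1# L L-rec refl) (Σ₀ 0 2# (λ _ → 2#) (λ _ → 2+2≈2*2) refl))) ⟩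
        Σᶻ K (λ n → L n * q ^ (1 ℕ.* e₀ n)) * Σᶻ K (λ n → 2# * q ^ (1 ℕ.* e₀ n))
          ≈⟨ Σᶻ-* K _ _ ⟩
        Σᶻ K (λ i → Σᶻ K (λ j → (L i * q ^ (1 ℕ.* e₀ i)) * (2# * q ^ (1 ℕ.* e₀ j))))
          ≈⟨ Σᶻ-cong₂ expand K ⟩
        Σᶻ K (λ i → Σᶻ K (λ j → 2# * F i j))
          ≈⟨ trans (Σᶻ-cong (λ i → Σᶻ-*ˡ 2# K (F i)) K) (Σᶻ-*ˡ 2# K _) ⟩
        2# * Σᶻ K (λ i → Σᶻ K (F i))
          ≈⟨ *-congˡ (Σᶻ-parity₂ F-vanishes (ℕₚ.<⇒≤ 2M<K)) ⟩
        2# * (ev + od) ∎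
        where
        2+2≈2*2 : 2# + 2# ≈ 2# * 2#
        2+2≈2*2 = solve 0 (con (+ 2) :+ con (+ 2) := con (+ 2) :* con (+ 2)) refl
        expand : ∀ i j → (L i * q ^ (1 ℕ.* e₀ i)) * (2# * q ^ (1 ℕ.* e₀ j)) ≈ 2# * F i j
        expand i j = begin
          (L i * q ^ (1 ℕ.* e₀ i)) * (2# * q ^ (1 ℕ.* e₀ j))
            ≈⟨ solve 3 (λ a b c → (a :* b) :* (con (+ 2) :* c) := con (+ 2) :* (a :* (b :* c))) refl _ _ _ ⟩
          2# * (L i * (q ^ (1 ℕ.* e₀ i) * q ^ (1 ℕ.* e₀ j)))
            ≈⟨ *-congˡ (*-congˡ (*-cong (q^-cong (ℕₚ.*-identityˡ (e₀ i))) (q^-cong (ℕₚ.*-identityˡ (e₀ j))))) ⟩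
          2# * (L i * (q ^ e₀ i * q ^ e₀ j))
            ≈⟨ *-congˡ (*-congˡ (^-homo-* q (e₀ i) (e₀ j))) ⟨
          2# * F i j ∎

      F′ : ℤ → ℤ → Carrier
      F′ i j = L (i ℤ.- j) * q ^ (suc (2 ℕ.* e₁ i) ℕ.+ 2 ℕ.* e₁ j)

      F′-vanishes : Vanishes₂ M F′
      F′-vanishes = Vanishes₂-q^ _ _
        (λ i j → ℕₚ.≤-trans (E₁.∣i∣≤1+e i) (ℕₚ.m≤n⇒m≤1+n (s≤s (ℕₚ.≤-trans (ℕₚ.m≤n*m (e₁ i) 2) (ℕₚ.m≤m+n (2 ℕ.* e₁ i) (2 ℕ.* e₁ j))))))
        (λ i j → ℕₚ.≤-trans (E₁.∣i∣≤1+e j) (s≤s (ℕₚ.≤-trans (ℕₚ.m≤n*m (e₁ j) 2) (ℕₚ.m≤n+m (2 ℕ.* e₁ j) (suc (2 ℕ.* e₁ i))))))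

      -- A rotation by 45 degrees, i.e. multiplication by a Gaussian integer of norm 2. An odd m + n
      -- is parametrised by m = i - j, n = i + j + 1, and then m² + n² = 1 + 2i(i + 1) + 2j(j + 1).
      od≈ : od ≈ Σᶻ K (λ i → Σᶻ K (F′ i))
      od≈ = begin
        Σᶻ K (λ i → Σᶻ K (λ j → F i (i ℤ.+ ℤ.suc (j ℤ.+ j))))  ≈⟨ Σᶻ-swap K K _ ⟩
        Σᶻ K (λ j → Σᶻ K (H j))                                ≈⟨ Σᶻ-shift₂ ℤ.-_ ℤₚ.∣-i∣≡∣i∣ H-vanishes 4M≤K ⟨
        Σᶻ K (λ j → Σᶻ K (λ i → H j (ℤ.- j ℤ.+ i)))            ≈⟨ Σᶻ-cong₂ (λ j i → *-cong
          (reflexive (≡.cong L (ℤₚ.+-comm (ℤ.- j) i))) (q^-cong (ℤₚ.+-injective (exponent i j)))) K ⟩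
        Σᶻ K (λ j → Σᶻ K (λ i → F′ i j))                       ≈⟨ Σᶻ-swap K K (λ i j → F′ i j) ⟨
        Σᶻ K (λ i → Σᶻ K (F′ i))                               ∎
        where
        H : ℤ → ℤ → Carrier
        H j i = F i (i ℤ.+ ℤ.suc (j ℤ.+ j))
        H-transposed : Vanishes₂ (M ℕ.+ M) (λ i j → H j i)
        H-transposed = Vanishes₂-map (λ j → ℤ.suc (j ℤ.+ j)) ∣i∣≤∣1+[i+i]∣ (Vanishes₂-shift (λ i → i) (λ _ → ≡.refl) F-vanishes)
        H-vanishes : Vanishes₂ (M ℕ.+ M) H
        H-vanishes = record
          { ₁ = λ j i → Vanishes₂.₂ H-transposed i j
          ; ₂ = λ j i → Vanishes₂.₁ H-transposed i j }
        exponent : ∀ i j → + (e₀ (ℤ.- j ℤ.+ i) ℕ.+ e₀ ((ℤ.- j ℤ.+ i) ℤ.+ ℤ.suc (j ℤ.+ j))) ≡ + (suc (2 ℕ.* e₁ i) ℕ.+ 2 ℕ.* e₁ j)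
        exponent i j = ≡.trans
          (≡.cong₂ ℤ._+_ (E₀.+e≡ (ℤ.- j ℤ.+ i)) (E₀.+e≡ ((ℤ.- j ℤ.+ i) ℤ.+ ℤ.suc (j ℤ.+ j))))
          (≡.trans
            (ℤ-solve 2 (λ i j → ((:-ᶻ j) :+ᶻ i) :*ᶻ (((:-ᶻ j) :+ᶻ i) :+ᶻ conᶻ (+ 0))
                :+ᶻ (((:-ᶻ j) :+ᶻ i) :+ᶻ (conᶻ (+ 1) :+ᶻ (j :+ᶻ j))) :*ᶻ ((((:-ᶻ j) :+ᶻ i) :+ᶻ (conᶻ (+ 1) :+ᶻ (j :+ᶻ j))) :+ᶻ conᶻ (+ 0))
              :=ᶻ (conᶻ (+ 1) :+ᶻ conᶻ (+ 2) :*ᶻ (i :*ᶻ (i :+ᶻ conᶻ (+ 1)))) :+ᶻ conᶻ (+ 2) :*ᶻ (j :*ᶻ (j :+ᶻ conᶻ (+ 1)))) ≡.refl i j)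
            (≡.sym (≡.cong₂ (λ u v → ℤ.suc u ℤ.+ v)
              (≡.trans (ℤₚ.pos-* 2 (e₁ i)) (≡.cong (+ 2 ℤ.*_) (E₁.+e≡ i)))
              (≡.trans (ℤₚ.pos-* 2 (e₁ j)) (≡.cong (+ 2 ℤ.*_) (E₁.+e≡ j))))))

      -- The weight L(i - j) of `F′` does not factor by itself. Adding its image under j ↦ -1 - j,
      -- which leaves the exponent unchanged, gives L(i + j + 1) + L(i - j) = 3 V(i) V(j), so that
      -- twice the sum becomes three times the square of a one-variable sum.
      BB : (2# * ΘB (q ^ 2)) * (2# * ΘB (q ^ 2)) * (3# * q) ≈ 2# * od
      BB = begin
        (2# * ΘB (q ^ 2)) * (2# * ΘB (q ^ 2)) * (3# * q)
          ≈⟨ *-congʳ (sym (*-cong (Σ₁ 1 1# V V-rec refl) (Σ₁ 1 1# V V-rec refl))) ⟩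
        Σᶻ K (λ n → V n * q ^ (2 ℕ.* e₁ n)) * Σᶻ K (λ n → V n * q ^ (2 ℕ.* e₁ n)) * (3# * q)
          ≈⟨ trans (*-congʳ (Σᶻ-* K _ _)) (sym (trans (Σᶻ-cong (λ i → Σᶻ-*ʳ (3# * q) K _) K) (Σᶻ-*ʳ (3# * q) K _))) ⟩
        Σᶻ K (λ i → Σᶻ K (λ j → ((V i * q ^ (2 ℕ.* e₁ i)) * (V j * q ^ (2 ℕ.* e₁ j))) * (3# * q)))
          ≈⟨ Σᶻ-cong₂ expand K ⟩
        Σᶻ K (λ i → Σᶻ K (λ j → F′ i (ℤ.- ℤ.suc j) + F′ i j))
          ≈⟨ Σᶻ-+₂ K _ _ ⟩
        Σᶻ K (λ i → Σᶻ K (λ j → F′ i (ℤ.- ℤ.suc j))) + Σᶻ K (λ i → Σᶻ K (F′ i))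
          ≈⟨ +-congʳ (Σᶻ-cong (λ i → trans
               (Σᶻ-suc (λ j lt → Vanishes₂.₂ F′-vanishes i (ℤ.- j) (≡.subst (M ℕ.<_) (≡.sym (ℤₚ.∣-i∣≡∣i∣ j)) lt)) M<K)
               (Σᶻ-neg K (F′ i))) K) ⟩
        Σᶻ K (λ i → Σᶻ K (F′ i)) + Σᶻ K (λ i → Σᶻ K (F′ i))
          ≈⟨ +-cong od≈ od≈ ⟨
        od + od
          ≈⟨ solve 1 (λ x → x :+ x := con (+ 2) :* x) refl _ ⟩
        2# * od ∎
        where
        M<K : M ℕ.< K
        M<K = ℕₚ.≤-<-trans (ℕₚ.m≤m+n M M) 2M<K
        expand : ∀ i j → ((V i * q ^ (2 ℕ.* e₁ i)) * (V j * q ^ (2 ℕ.* e₁ j))) * (3# * q) ≈ F′ i (ℤ.- ℤ.suc j) + F′ i j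
        expand i j = begin
          ((V i * q ^ (2 ℕ.* e₁ i)) * (V j * q ^ (2 ℕ.* e₁ j))) * (3# * q)
            ≈⟨ solve 5 (λ a b c d q → ((a :* b) :* (c :* d)) :* (con (+ 3) :* q) := (con (+ 3) :* (a :* c)) :* ((q :* b) :* d)) refl _ _ _ _ _ ⟩
          (3# * (V i * V j)) * ((q * q ^ (2 ℕ.* e₁ i)) * q ^ (2 ℕ.* e₁ j))
            ≈⟨ *-cong (3V-* i j) (sym (^-homo-* q (suc (2 ℕ.* e₁ i)) (2 ℕ.* e₁ j))) ⟩
          (L (ℤ.suc i ℤ.+ j) + L (i ℤ.- j)) * q ^ (suc (2 ℕ.* e₁ i) ℕ.+ 2 ℕ.* e₁ j)
            ≈⟨ distribʳ _ _ _ ⟩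
          L (ℤ.suc i ℤ.+ j) * q ^ (suc (2 ℕ.* e₁ i) ℕ.+ 2 ℕ.* e₁ j) + F′ i j
            ≈⟨ +-congʳ (*-cong
                 (reflexive (≡.cong L (ℤ-solve 2 (λ i j → (conᶻ (+ 1) :+ᶻ i) :+ᶻ j :=ᶻ i :-ᶻ (:-ᶻ (conᶻ (+ 1) :+ᶻ j))) ≡.refl i j)))
                 (q^-cong (≡.cong (λ k → suc (2 ℕ.* e₁ i) ℕ.+ 2 ℕ.* k) (≡.sym (e₁-reflect j))))) ⟩
          F′ i (ℤ.- ℤ.suc j) + F′ i j ∎

    η-cancel : ∀ k {a b} → η (q ^ suc k) * a ≈ η (q ^ suc k) * b → a ≈ b
    η-cancel k = Π-cancel (^-nil k nil) (λ i → i) M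

    E : ℕ → Carrier
    E k = η (q ^ k)

    ΘG₁-eta : ΘG (q ^ 1) * (E 1 * E 6) ≈ E 2 * E 2 * E 3
    ΘG₁-eta = trans (*-congˡ (*-congˡ (sym (pow-pow q 1 6)))) (trans (ΘG-eta (^-nil 0 nil))
      (*-cong (*-cong (pow-pow q 1 2) (pow-pow q 1 2)) (pow-pow q 1 3)))

    ΘG₃-eta : ΘG (q ^ 3) * (E 3 * E 18) ≈ E 6 * E 6 * E 9
    ΘG₃-eta = trans (*-congˡ (*-congˡ (sym (pow-pow q 3 6)))) (trans (ΘG-eta (^-nil 2 nil))
      (*-cong (*-cong (pow-pow q 3 2) (pow-pow q 3 2)) (pow-pow q 3 3)))

    Θψ₁-eta : Θψ (q ^ 1) * E 2 ≈ E 4 * E 4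
    Θψ₁-eta = trans (*-congˡ (sym (pow-pow q 1 2))) (trans (Θψ-eta (^-nil 0 nil)) (*-cong (pow-pow q 1 4) (pow-pow q 1 4)))

    ΘD₃-eta : ΘD (q ^ 3) * (E 12 * E 18) ≈ E 6 * E 6 * E 36
    ΘD₃-eta = trans (*-congˡ (sym (*-cong (pow-pow q 3 4) (pow-pow q 3 6)))) (trans (ΘD-eta (^-nil 2 nil))
      (*-cong (*-cong (pow-pow q 3 2) (pow-pow q 3 2)) (pow-pow q 3 12)))

    Θφ₁-eta : Θφ (q ^ 1) * (E 1 * E 1) * (E 4 * E 4) ≈ E 2 * E 2 * E 2 * E 2 * E 2
    Θφ₁-eta = trans (*-congˡ (sym (*-cong (pow-pow q 1 4) (pow-pow q 1 4)))) (trans (Θφ-eta (^-nil 0 nil))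
      (*-cong (*-cong (*-cong (*-cong h₂ h₂) h₂) h₂) h₂))
      where
      h₂ : η ((q ^ 1) ^ 2) ≈ E 2
      h₂ = pow-pow q 1 2

    ΘB₂-eta : ΘB (q ^ 2) ≈ E 12
    ΘB₂-eta = trans (ΘB-eta (^-nil 1 nil)) (pow-pow q 2 6)

    4# 12# : Carrier
    4#  = fromℤ (+ 4)
    12# = fromℤ (+ 12)

    -- The multiplier E 2 E 12 E 18 clears the denominators of the two theta products, E 18 on one
    -- side and E 2, E 12, E 18 on the other. It is a series in q², hence respects the splitting by
    -- parity. The even part does not depend on `b`, which enters only through b = E 9 / E 1.
    first-dissection : Σ Carrier λ ev → Even ev × (∀ b → b * E 1 ≈ E 9 →
      4# * (E 2 * E 2 * E 2 * E 6 * E 12 * b) ≈ ev + 4# * (q * (E 4 * E 4 * E 6 * E 6 * E 36)))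
    first-dissection = 2# * A.ev * (E 18 * E 2 * E 12) ,
      ((1ᵉ +ᵉ 1ᵉ) *ᵉ A.ev-even) *ᵉ ((ηᵉ 9 *ᵉ ηᵉ 1) *ᵉ ηᵉ 6) ,
      λ b b*E₁ → begin
        4# * (E 2 * E 2 * E 2 * E 6 * E 12 * b)
          ≈⟨ solve 5 (λ x y z b w → w :* (x :* x :* x :* y :* z :* b) := w :* ((x :* x :* y :* b) :* (x :* z))) refl (E 2) (E 6) (E 12) b 4# ⟩
        4# * ((E 2 * E 2 * E 6 * b) * (E 2 * E 12))
          ≈⟨ *-congˡ (*-congʳ (sym (GG-eta b b*E₁))) ⟩
        4# * ((ΘG (q ^ 1) * ΘG (q ^ 3) * E 18) * (E 2 * E 12))
          ≈⟨ solve 5 (λ g h x y z → con (+ 4) :* ((g :* h :* x) :* (y :* z)) := ((con (+ 2) :* g) :* (con (+ 2) :* h)) :* (x :* y :* z))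
               refl (ΘG (q ^ 1)) (ΘG (q ^ 3)) (E 18) (E 2) (E 12) ⟩
        ((2# * ΘG (q ^ 1)) * (2# * ΘG (q ^ 3))) * (E 18 * E 2 * E 12)
          ≈⟨ *-congʳ (trans A.GG (trans (distribˡ _ _ _) (+-congˡ (sym A.ψD)))) ⟩
        (2# * A.ev + (2# * Θψ (q ^ 1)) * (2# * ΘD (q ^ 3)) * q) * (E 18 * E 2 * E 12)
          ≈⟨ solve 7 (λ e p d q x y z → (e :+ (con (+ 2) :* p) :* (con (+ 2) :* d) :* q) :* (x :* y :* z)
                 := e :* (x :* y :* z) :+ con (+ 4) :* (q :* ((p :* y) :* (d :* (z :* x)))))
               refl (2# * A.ev) (Θψ (q ^ 1)) (ΘD (q ^ 3)) q (E 18) (E 2) (E 12) ⟩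
        2# * A.ev * (E 18 * E 2 * E 12) + 4# * (q * ((Θψ (q ^ 1) * E 2) * (ΘD (q ^ 3) * (E 12 * E 18))))
          ≈⟨ +-congˡ (*-congˡ (*-congˡ (*-cong Θψ₁-eta ΘD₃-eta))) ⟩
        2# * A.ev * (E 18 * E 2 * E 12) + 4# * (q * ((E 4 * E 4) * (E 6 * E 6 * E 36)))
          ≈⟨ +-congˡ (*-congˡ (*-congˡ (solve 3 (λ x y z → (x :* x) :* (y :* y :* z) := x :* x :* y :* y :* z) refl (E 4) (E 6) (E 36)))) ⟩
        2# * A.ev * (E 18 * E 2 * E 12) + 4# * (q * (E 4 * E 4 * E 6 * E 6 * E 36)) ∎
      where
      GG-eta : ∀ b → b * E 1 ≈ E 9 → ΘG (q ^ 1) * ΘG (q ^ 3) * E 18 ≈ E 2 * E 2 * E 6 * b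
      GG-eta b b*E₁ = η-cancel 0 (η-cancel 2 (η-cancel 5 (begin
        E 6 * (E 3 * (E 1 * (ΘG (q ^ 1) * ΘG (q ^ 3) * E 18)))
          ≈⟨ solve 6 (λ x y z g h w → x :* (y :* (z :* (g :* h :* w))) := (g :* (z :* x)) :* (h :* (y :* w))) refl
               (E 6) (E 3) (E 1) (ΘG (q ^ 1)) (ΘG (q ^ 3)) (E 18) ⟩
        (ΘG (q ^ 1) * (E 1 * E 6)) * (ΘG (q ^ 3) * (E 3 * E 18))
          ≈⟨ *-cong ΘG₁-eta (trans ΘG₃-eta (*-congˡ (sym b*E₁))) ⟩
        (E 2 * E 2 * E 3) * (E 6 * E 6 * (b * E 1))
          ≈⟨ solve 5 (λ x y z w b → (x :* x :* y) :* (z :* z :* (b :* w)) := z :* (y :* (w :* (x :* x :* z :* b)))) refl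
               (E 2) (E 3) (E 6) (E 1) b ⟩
        E 6 * (E 3 * (E 1 * (E 2 * E 2 * E 6 * b))) ∎)))

    -- Here E 4² clears the denominator of Θφ(q), and E 18 completes Θφ(q) ΘG(q) to E 2⁵ c; both are
    -- series in q². The constant 12 is the 4 from the two halved theta functions times the 3 of
    -- `3V-*`.
    second-dissection : Σ Carrier λ ev → Even ev × (∀ c → c * (E 1 * E 1 * E 1 * E 6) ≈ E 2 * E 2 * E 3 * E 18 →
      4# * (E 2 * E 2 * E 2 * E 2 * E 2 * c) ≈ ev + 12# * (q * (E 12 * E 12 * E 4 * E 4 * E 18)))
    second-dissection = 2# * B.ev * (E 4 * E 4 * E 18) ,
      ((1ᵉ +ᵉ 1ᵉ) *ᵉ B.ev-even) *ᵉ ((ηᵉ 2 *ᵉ ηᵉ 2) *ᵉ ηᵉ 9) ,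
      λ c c*E → begin
        4# * (E 2 * E 2 * E 2 * E 2 * E 2 * c)
          ≈⟨ *-congˡ (φG-eta c c*E) ⟨
        4# * (Θφ (q ^ 1) * ΘG (q ^ 1) * (E 4 * E 4 * E 18))
          ≈⟨ solve 3 (λ p g x → con (+ 4) :* (p :* g :* x) := ((con (+ 2) :* p) :* (con (+ 2) :* g)) :* x) refl
               (Θφ (q ^ 1)) (ΘG (q ^ 1)) (E 4 * E 4 * E 18) ⟩
        ((2# * Θφ (q ^ 1)) * (2# * ΘG (q ^ 1))) * (E 4 * E 4 * E 18)
          ≈⟨ *-congʳ (trans B.φG (trans (distribˡ _ _ _) (+-congˡ (sym B.BB)))) ⟩
        (2# * B.ev + (2# * ΘB (q ^ 2)) * (2# * ΘB (q ^ 2)) * (3# * q)) * (E 4 * E 4 * E 18)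
          ≈⟨ *-congʳ (+-congˡ (*-congʳ (*-cong (*-congˡ ΘB₂-eta) (*-congˡ ΘB₂-eta)))) ⟩
        (2# * B.ev + (2# * E 12) * (2# * E 12) * (3# * q)) * (E 4 * E 4 * E 18)
          ≈⟨ solve 5 (λ e x q y z → (e :+ (con (+ 2) :* x) :* (con (+ 2) :* x) :* (con (+ 3) :* q)) :* (y :* y :* z)
                 := e :* (y :* y :* z) :+ con (+ 12) :* (q :* (x :* x :* y :* y :* z))) refl (2# * B.ev) (E 12) q (E 4) (E 18) ⟩
        2# * B.ev * (E 4 * E 4 * E 18) + 12# * (q * (E 12 * E 12 * E 4 * E 4 * E 18)) ∎
      where
      φG-eta : ∀ c → c * (E 1 * E 1 * E 1 * E 6) ≈ E 2 * E 2 * E 3 * E 18 →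
               Θφ (q ^ 1) * ΘG (q ^ 1) * (E 4 * E 4 * E 18) ≈ E 2 * E 2 * E 2 * E 2 * E 2 * c
      φG-eta c c*E = η-cancel 0 (η-cancel 0 (η-cancel 0 (η-cancel 5 (begin
        E 6 * (E 1 * (E 1 * (E 1 * (Θφ (q ^ 1) * ΘG (q ^ 1) * (E 4 * E 4 * E 18)))))
          ≈⟨ solve 6 (λ x z p g y w → x :* (z :* (z :* (z :* (p :* g :* (y :* y :* w))))) := (p :* (z :* z) :* (y :* y)) :* ((g :* (z :* x)) :* w)) refl
               (E 6) (E 1) (Θφ (q ^ 1)) (ΘG (q ^ 1)) (E 4) (E 18) ⟩
        (Θφ (q ^ 1) * (E 1 * E 1) * (E 4 * E 4)) * ((ΘG (q ^ 1) * (E 1 * E 6)) * E 18)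
          ≈⟨ *-cong Θφ₁-eta (trans (*-congʳ ΘG₁-eta) (sym c*E)) ⟩
        (E 2 * E 2 * E 2 * E 2 * E 2) * (c * (E 1 * E 1 * E 1 * E 6))
          ≈⟨ solve 4 (λ h c z x → h :* (c :* (z :* z :* z :* x)) := x :* (z :* (z :* (z :* (h :* c))))) refl
               (E 2 * E 2 * E 2 * E 2 * E 2) c (E 1) (E 6) ⟩
        E 6 * (E 1 * (E 1 * (E 1 * (E 2 * E 2 * E 2 * E 2 * E 2 * c)))) ∎))))

    module WithF (F : ℕ → Carrier) (E≈F : ∀ k → E (suc k) ≈ F (suc k)) where

      first-dissection-F : ∀ b → b * F 1 ≈ F 9 →
        4# * (F 2 * F 2 * F 2 * F 6 * F 12 * b) ≈ proj₁ first-dissection + 4# * (q * (F 4 * F 4 * F 6 * F 6 * F 36))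
      first-dissection-F b b*F₁ = begin
        4# * (F 2 * F 2 * F 2 * F 6 * F 12 * b)
          ≈⟨ *-congˡ (*-congʳ (*-cong (*-cong (*-cong (*-cong (E≈F 1) (E≈F 1)) (E≈F 1)) (E≈F 5)) (E≈F 11))) ⟨
        4# * (E 2 * E 2 * E 2 * E 6 * E 12 * b)
          ≈⟨ proj₂ (proj₂ first-dissection) b (trans (*-congˡ (E≈F 0)) (trans b*F₁ (sym (E≈F 8)))) ⟩
        proj₁ first-dissection + 4# * (q * (E 4 * E 4 * E 6 * E 6 * E 36))
          ≈⟨ +-congˡ (*-congˡ (*-congˡ (*-cong (*-cong (*-cong (*-cong (E≈F 3) (E≈F 3)) (E≈F 5)) (E≈F 5)) (E≈F 35)))) ⟩
        proj₁ first-dissection + 4# * (q * (F 4 * F 4 * F 6 * F 6 * F 36)) ∎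

      second-dissection-F : ∀ c → c * (F 1 * F 1 * F 1 * F 6) ≈ F 2 * F 2 * F 3 * F 18 →
        4# * (F 2 * F 2 * F 2 * F 2 * F 2 * c) ≈ proj₁ second-dissection + 12# * (q * (F 12 * F 12 * F 4 * F 4 * F 18))
      second-dissection-F c c*F = begin
        4# * (F 2 * F 2 * F 2 * F 2 * F 2 * c)
          ≈⟨ *-congˡ (*-congʳ (*-cong (*-cong (*-cong (*-cong (E≈F 1) (E≈F 1)) (E≈F 1)) (E≈F 1)) (E≈F 1))) ⟨
        4# * (E 2 * E 2 * E 2 * E 2 * E 2 * c)
          ≈⟨ proj₂ (proj₂ second-dissection) c (trans (*-congˡ (*-cong (*-cong (*-cong (E≈F 0) (E≈F 0)) (E≈F 0)) (E≈F 5)))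
               (trans c*F (sym (*-cong (*-cong (*-cong (E≈F 1) (E≈F 1)) (E≈F 2)) (E≈F 17))))) ⟩
        proj₁ second-dissection + 12# * (q * (E 12 * E 12 * E 4 * E 4 * E 18))
          ≈⟨ +-congˡ (*-congˡ (*-congˡ (*-cong (*-cong (*-cong (*-cong (E≈F 11) (E≈F 11)) (E≈F 3)) (E≈F 3)) (E≈F 17)))) ⟩
        proj₁ second-dissection + 12# * (q * (F 12 * F 12 * F 4 * F 4 * F 18)) ∎

      -- The E 6 in the multiplier of the first dissection becomes F 3 when q² is replaced by q, and
      -- the other side keeps a matching factor.
      cancel-F₃ : ∀ c → F 1 * F 1 * F 1 * F 3 * F 6 * c ≈ F 2 * F 2 * F 3 * F 3 * F 18 →
                  c * (F 1 * F 1 * F 1 * F 6) ≈ F 2 * F 2 * F 3 * F 18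
      cancel-F₃ c eq = η-cancel 2 (begin
        E 3 * (c * (F 1 * F 1 * F 1 * F 6))     ≈⟨ *-congʳ (E≈F 2) ⟩
        F 3 * (c * (F 1 * F 1 * F 1 * F 6))
          ≈⟨ solve 4 (λ x y z c → y :* (c :* (x :* x :* x :* z)) := x :* x :* x :* y :* z :* c) refl (F 1) (F 3) (F 6) c ⟩
        F 1 * F 1 * F 1 * F 3 * F 6 * c         ≈⟨ eq ⟩
        F 2 * F 2 * F 3 * F 3 * F 18
          ≈⟨ solve 3 (λ x y z → x :* x :* y :* y :* z := y :* (x :* x :* y :* z)) refl (F 2) (F 3) (F 18) ⟩
        F 3 * (F 2 * F 2 * F 3 * F 18)          ≈⟨ *-congʳ (E≈F 2) ⟨
        E 3 * (F 2 * F 2 * F 3 * F 18)          ∎)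

    -- The powers are written as `_^ˢ_` unfolds, so that the lemma meets the stated form of the
    -- theorem definitionally.
    quotient : ∀ x u v w d y → x * x * x * x * x * d ≈ fromℤ (+ 3) * (v * v * u * u * w) →
               (x * (x * (x * (x * (x * 1#))))) * y ≈ 1# →
               d ≈ fromℤ (+ 3) * ((u * (u * 1#)) * (v * (v * 1#)) * w * y)
    quotient x u v w d y eq xy≈1 = begin
      d                                            ≈⟨ *-identityˡ d ⟨
      1# * d                                       ≈⟨ *-congʳ xy≈1 ⟨
      (x * (x * (x * (x * (x * 1#))))) * y * d
        ≈⟨ solve 3 (λ x y d → (x :* (x :* (x :* (x :* (x :* con (+ 1)))))) :* y :* d := (x :* x :* x :* x :* x :* d) :* y) refl x y d ⟩
      (x * x * x * x * x * d) * y                  ≈⟨ *-congʳ eq ⟩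
      fromℤ (+ 3) * (v * v * u * u * w) * y
        ≈⟨ solve 4 (λ u v w y → con (+ 3) :* (v :* v :* u :* u :* w) :* y
             := con (+ 3) :* ((u :* (u :* con (+ 1))) :* (v :* (v :* con (+ 1))) :* w :* y)) refl u v w y ⟩
      fromℤ (+ 3) * ((u * (u * 1#)) * (v * (v * 1#)) * w * y) ∎

-- Truncated formal power series

sumℤ-cong : ∀ n {g h} → (∀ i → i ℕ.≤ n → g i ≡ h i) → sumℤ n g ≡ sumℤ n h
sumℤ-cong zero    g≡h = g≡h 0 z≤n
sumℤ-cong (suc n) g≡h = ≡.cong₂ ℤ._+_ (sumℤ-cong n (λ i i≤n → g≡h i (ℕₚ.m≤n⇒m≤1+n i≤n))) (g≡h (suc n) ℕₚ.≤-refl)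

sumℤ-zero : ∀ n {g} → (∀ i → i ℕ.≤ n → g i ≡ + 0) → sumℤ n g ≡ + 0
sumℤ-zero zero    g≡0 = g≡0 0 z≤n
sumℤ-zero (suc n) g≡0 = ≡.cong₂ ℤ._+_ (sumℤ-zero n (λ i i≤n → g≡0 i (ℕₚ.m≤n⇒m≤1+n i≤n))) (g≡0 (suc n) ℕₚ.≤-refl)

sumℤ-+ : ∀ n g h → sumℤ n (λ i → g i ℤ.+ h i) ≡ sumℤ n g ℤ.+ sumℤ n h
sumℤ-+ zero    g h = ≡.refl
sumℤ-+ (suc n) g h = ≡.trans (≡.cong (λ x → x ℤ.+ (g (suc n) ℤ.+ h (suc n))) (sumℤ-+ n g h))
  (ℤ-solve 4 (λ a b c d → (a :+ᶻ b) :+ᶻ (c :+ᶻ d) :=ᶻ (a :+ᶻ c) :+ᶻ (b :+ᶻ d)) ≡.refl (sumℤ n g) (sumℤ n h) (g (suc n)) (h (suc n)))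

sumℤ-* : ∀ n x g → sumℤ n (λ i → x ℤ.* g i) ≡ x ℤ.* sumℤ n g
sumℤ-* zero    x g = ≡.refl
sumℤ-* (suc n) x g = ≡.trans (≡.cong (λ y → y ℤ.+ x ℤ.* g (suc n)) (sumℤ-* n x g))
  (≡.sym (ℤₚ.*-distribˡ-+ x (sumℤ n g) (g (suc n))))

sumℤ-head : ∀ n g → sumℤ (suc n) g ≡ g 0 ℤ.+ sumℤ n (λ i → g (suc i))
sumℤ-head zero    g = ≡.refl
sumℤ-head (suc n) g = ≡.trans (≡.cong (λ x → x ℤ.+ g (suc (suc n))) (sumℤ-head n g)) (ℤₚ.+-assoc (g 0) _ _)

tail : Series → Series
tail a n = a (suc n)

-- The decomposition a = a(0) + q · tail a. It turns commutativity and associativity of convolution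
-- into inductions on the degree.
⊛-head : ∀ a b n → (a ⊛ b) (suc n) ≡ a 0 ℤ.* b (suc n) ℤ.+ (tail a ⊛ b) n
⊛-head a b n = sumℤ-head n (λ i → a i ℤ.* b (suc n ℕ.∸ i))

⊛-last : ∀ a b n → (a ⊛ b) (suc n) ≡ (a ⊛ tail b) n ℤ.+ a (suc n) ℤ.* b 0
⊛-last a b n = ≡.cong₂ ℤ._+_
  (sumℤ-cong n (λ i i≤n → ≡.cong (λ k → a i ℤ.* b k) (ℕₚ.+-∸-assoc 1 i≤n)))
  (≡.cong (λ k → a (suc n) ℤ.* b k) (ℕₚ.n∸n≡0 n))

_≈[_]_ : Series → ℕ → Series → Set
a ≈[ N ] b = ∀ i → i ℕ.≤ N → a i ≡ b i

_⊞_ : Series → Series → Series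
(a ⊞ b) n = a n ℤ.+ b n

⊟_ : Series → Series
(⊟ a) n = ℤ.- a n

0ˢ : Series
0ˢ _ = + 0

⊛-cong : ∀ {N a a′ b b′} → a ≈[ N ] a′ → b ≈[ N ] b′ → (a ⊛ b) ≈[ N ] (a′ ⊛ b′)
⊛-cong a≈a′ b≈b′ n n≤N = sumℤ-cong n (λ i i≤n →
  ≡.cong₂ ℤ._*_ (a≈a′ i (ℕₚ.≤-trans i≤n n≤N)) (b≈b′ (n ℕ.∸ i) (ℕₚ.≤-trans (ℕₚ.m∸n≤m n i) n≤N)))

⊛-comm : ∀ a b n → (a ⊛ b) n ≡ (b ⊛ a) n
⊛-comm a b zero    = ℤₚ.*-comm (a 0) (b 0)
⊛-comm a b (suc n) = ≡.trans (⊛-head a b n) (≡.trans (ℤₚ.+-comm _ ((tail a ⊛ b) n))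
  (≡.trans (≡.cong₂ ℤ._+_ (⊛-comm (tail a) b n) (ℤₚ.*-comm (a 0) (b (suc n)))) (≡.sym (⊛-last b a n))))

⊛-distribʳ : ∀ a b c n → ((b ⊞ c) ⊛ a) n ≡ ((b ⊛ a) ⊞ (c ⊛ a)) n
⊛-distribʳ a b c n = ≡.trans (sumℤ-cong n (λ i _ → ℤₚ.*-distribʳ-+ (a (n ℕ.∸ i)) (b i) (c i))) (sumℤ-+ n _ _)

⊛-scale : ∀ x a b n → ((x ·ˢ a) ⊛ b) n ≡ x ℤ.* (a ⊛ b) n
⊛-scale x a b n = ≡.trans (sumℤ-cong n (λ i _ → ℤₚ.*-assoc x (a i) (b (n ℕ.∸ i)))) (sumℤ-* n x _)

⊛-assoc : ∀ a b c n → ((a ⊛ b) ⊛ c) n ≡ (a ⊛ (b ⊛ c)) n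
⊛-assoc a b c zero    = ℤₚ.*-assoc (a 0) (b 0) (c 0)
⊛-assoc a b c (suc n) = begin
  ((a ⊛ b) ⊛ c) (suc n)
    ≡⟨ ⊛-head (a ⊛ b) c n ⟩
  a 0 ℤ.* b 0 ℤ.* c (suc n) ℤ.+ (tail (a ⊛ b) ⊛ c) n
    ≡⟨ ≡.cong (λ x → a 0 ℤ.* b 0 ℤ.* c (suc n) ℤ.+ x)
         (≡.trans (⊛-cong {n} {tail (a ⊛ b)} {(a 0 ·ˢ tail b) ⊞ (tail a ⊛ b)} {c} (λ i _ → ⊛-head a b i) (λ _ _ → ≡.refl) n ℕₚ.≤-refl)
           (⊛-distribʳ c (a 0 ·ˢ tail b) (tail a ⊛ b) n)) ⟩
  a 0 ℤ.* b 0 ℤ.* c (suc n) ℤ.+ (((a 0 ·ˢ tail b) ⊛ c) n ℤ.+ ((tail a ⊛ b) ⊛ c) n)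
    ≡⟨ ≡.cong₂ (λ x y → a 0 ℤ.* b 0 ℤ.* c (suc n) ℤ.+ (x ℤ.+ y)) (⊛-scale (a 0) (tail b) c n) (⊛-assoc (tail a) b c n) ⟩
  a 0 ℤ.* b 0 ℤ.* c (suc n) ℤ.+ (a 0 ℤ.* (tail b ⊛ c) n ℤ.+ (tail a ⊛ (b ⊛ c)) n)
    ≡⟨ ℤ-solve 5 (λ x y z u v → x :*ᶻ y :*ᶻ z :+ᶻ (x :*ᶻ u :+ᶻ v) :=ᶻ x :*ᶻ (y :*ᶻ z :+ᶻ u) :+ᶻ v) ≡.refl
         (a 0) (b 0) (c (suc n)) ((tail b ⊛ c) n) ((tail a ⊛ (b ⊛ c)) n) ⟩
  a 0 ℤ.* (b 0 ℤ.* c (suc n) ℤ.+ (tail b ⊛ c) n) ℤ.+ (tail a ⊛ (b ⊛ c)) n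
    ≡⟨ ≡.cong (λ x → a 0 ℤ.* x ℤ.+ (tail a ⊛ (b ⊛ c)) n) (⊛-head b c n) ⟨
  a 0 ℤ.* (b ⊛ c) (suc n) ℤ.+ (tail a ⊛ (b ⊛ c)) n
    ≡⟨ ⊛-head a (b ⊛ c) n ⟨
  (a ⊛ (b ⊛ c)) (suc n) ∎
  where open ≡.≡-Reasoning

⊛-zeroˡ : ∀ a n → (0ˢ ⊛ a) n ≡ + 0
⊛-zeroˡ a n = sumℤ-zero n (λ i _ → ℤₚ.*-zeroˡ (a (n ℕ.∸ i)))

⊛-identityˡ : ∀ a n → (one ⊛ a) n ≡ a n
⊛-identityˡ a zero    = ℤₚ.*-identityˡ (a 0)
⊛-identityˡ a (suc n) = ≡.trans (⊛-head one a n)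
  (≡.trans (≡.cong₂ ℤ._+_ (ℤₚ.*-identityˡ (a (suc n))) (⊛-zeroˡ a n)) (ℤₚ.+-identityʳ _))

-- The quotient is taken in the equality only. Elements remain full series, so an equation in this
-- ring is an equation between their coefficients up to `N`.
truncatedSeries : ℕ → CommutativeRing _ _
truncatedSeries N = record
  { Carrier = Series ; _≈_ = _≈[ N ]_ ; _+_ = _⊞_ ; _*_ = _⊛_ ; -_ = ⊟_ ; 0# = 0ˢ ; 1# = one
  ; isCommutativeRing = record
    { isRing = record
      { +-isAbelianGroup = record
        { isGroup = record
          { isMonoid = record
            { isSemigroup = record
              { isMagma = record
                { isEquivalence = record
                  { refl  = λ _ _ → ≡.refl
                  ; sym   = λ p i i≤N → ≡.sym (p i i≤N)
                  ; trans = λ p r i i≤N → ≡.trans (p i i≤N) (r i i≤N) }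
                ; ∙-cong = λ p r i i≤N → ≡.cong₂ ℤ._+_ (p i i≤N) (r i i≤N) }
              ; assoc = λ a b c i _ → ℤₚ.+-assoc (a i) (b i) (c i) }
            ; identity = (λ a i _ → ℤₚ.+-identityˡ (a i)) , (λ a i _ → ℤₚ.+-identityʳ (a i)) }
          ; inverse = (λ a i _ → ℤₚ.+-inverseˡ (a i)) , (λ a i _ → ℤₚ.+-inverseʳ (a i))
          ; ⁻¹-cong = λ p i i≤N → ≡.cong ℤ.-_ (p i i≤N) }
        ; comm = λ a b i _ → ℤₚ.+-comm (a i) (b i) }
      ; *-cong = ⊛-cong
      ; *-assoc = λ a b c i _ → ⊛-assoc a b c i
      ; *-identity = (λ a i _ → ⊛-identityˡ a i) , (λ a i _ → ≡.trans (⊛-comm a one i) (⊛-identityˡ a i))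
      ; distrib = (λ a b c i _ → ≡.trans (⊛-comm a (b ⊞ c) i) (≡.trans (⊛-distribʳ a b c i)
                      (≡.cong₂ ℤ._+_ (⊛-comm b a i) (⊛-comm c a i))))
                , (λ a b c i _ → ⊛-distribʳ a b c i) }
    ; *-comm = λ a b i _ → ⊛-comm a b i } }

q : Series
q zero          = + 0
q (suc zero)    = + 1
q (suc (suc _)) = + 0

q⊛-zero : ∀ a → (q ⊛ a) 0 ≡ + 0
q⊛-zero a = ℤₚ.*-zeroˡ (a 0)

q⊛-suc : ∀ a n → (q ⊛ a) (suc n) ≡ a n
q⊛-suc a n = ≡.trans (⊛-head q a n) (≡.trans
  (≡.cong₂ ℤ._+_ (ℤₚ.*-zeroˡ (a (suc n)))
    (≡.trans (⊛-cong {n} {tail q} {one} {a} (λ { zero _ → ≡.refl ; (suc _) _ → ≡.refl }) (λ _ _ → ≡.refl) n ℕₚ.≤-refl) (⊛-identityˡ a n)))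
  (ℤₚ.+-identityˡ (a n)))

-- Independent of the truncation, unlike the power of the ring, with which it agrees by `^≡q^`.
q^ : ℕ → Series
q^ zero    = one
q^ (suc k) = q ⊛ q^ k

q^⊛-shift : ∀ k a n → (q^ k ⊛ a) (k ℕ.+ n) ≡ a n
q^⊛-shift zero    a n = ⊛-identityˡ a n
q^⊛-shift (suc k) a n = ≡.trans (⊛-assoc q (q^ k) a (suc k ℕ.+ n)) (≡.trans (q⊛-suc (q^ k ⊛ a) (k ℕ.+ n)) (q^⊛-shift k a n))

q^⊛-low : ∀ k a {n} → n ℕ.< k → (q^ k ⊛ a) n ≡ + 0
q^⊛-low (suc k) a {zero}  _         = ≡.trans (⊛-assoc q (q^ k) a 0) (q⊛-zero (q^ k ⊛ a))
q^⊛-low (suc k) a {suc n} (s≤s n<k) = ≡.trans (⊛-assoc q (q^ k) a (suc n)) (≡.trans (q⊛-suc (q^ k ⊛ a) n) (q^⊛-low k a n<k))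

⊛-identityʳ : ∀ a n → (a ⊛ one) n ≡ a n
⊛-identityʳ a n = ≡.trans (⊛-comm a one n) (⊛-identityˡ a n)

q^-low : ∀ k {n} → n ℕ.< k → q^ k n ≡ + 0
q^-low k {n} n<k = ≡.trans (≡.sym (⊛-identityʳ (q^ k) n)) (q^⊛-low k one n<k)

q^-shift : ∀ k n → q^ k (k ℕ.+ n) ≡ one n
q^-shift k n = ≡.trans (≡.sym (⊛-identityʳ (q^ k) (k ℕ.+ n))) (q^⊛-shift k one n)

oneMinusQ^≡ : ∀ k n → oneMinusQ^ (suc k) n ≡ (one ⊞ (⊟ (q^ (suc k)))) n
oneMinusQ^≡ k n with n ℕ.≟ 0 | n ℕ.≟ suc k
oneMinusQ^≡ k .0       | yes ≡.refl | _          = ≡.cong (λ x → + 1 ℤ.- x) (≡.sym (q^-low (suc k) (s≤s z≤n)))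
oneMinusQ^≡ k .(suc k) | no _       | yes ≡.refl = ≡.cong (λ x → + 0 ℤ.- x)
  (≡.sym (≡.trans (≡.cong (q^ (suc k)) (≡.sym (ℕₚ.+-identityʳ (suc k)))) (q^-shift (suc k) 0)))
oneMinusQ^≡ k zero     | no 0≢0     | no _       = contradiction ≡.refl 0≢0
oneMinusQ^≡ k (suc n)  | no _       | no n≢k with ℕₚ.<-cmp (suc n) (suc k)
... | tri< n<k _ _ = ≡.cong (λ x → + 0 ℤ.- x) (≡.sym (q^-low (suc k) n<k))
... | tri≈ _ n≡k _ = contradiction n≡k n≢k
... | tri> _ _ k<n = ≡.cong (λ x → + 0 ℤ.- x) (≡.sym (≡.trans
  (≡.cong (q^ (suc k)) (≡.trans (≡.sym (ℕₚ.m+[n∸m]≡n k<n)) (≡.sym (ℕₚ.+-suc (suc k) _))))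
  (q^-shift (suc k) (suc (suc n ℕ.∸ suc (suc k))))))

oneMinusQ^-low : ∀ m {N} → N ℕ.< m → oneMinusQ^ m ≈[ N ] one
oneMinusQ^-low (suc k) N<m i i≤N = ≡.trans (oneMinusQ^≡ k i)
  (≡.trans (≡.cong (λ x → one i ℤ.- x) (q^-low (suc k) (ℕₚ.≤-<-trans i≤N N<m))) (ℤₚ.+-identityʳ (one i)))

prodTo≈f : ∀ k {N n} → N ℕ.≤ n → prodTo (suc k) n ≈[ N ] f (suc k)
prodTo≈f k {N} {n} N≤n i i≤N = ≡.trans
  (≡.cong (λ m → prodTo (suc k) m i) (≡.sym (ℕₚ.m∸n+n≡m (ℕₚ.≤-trans i≤N N≤n)))) (go (n ℕ.∸ i))
  where
  go : ∀ d → prodTo (suc k) (d ℕ.+ i) i ≡ prodTo (suc k) i i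
  go zero    = ≡.refl
  go (suc d) = ≡.trans
    (⊛-cong {i} {prodTo (suc k) (d ℕ.+ i)} (λ _ _ → ≡.refl)
      (oneMinusQ^-low (suc (d ℕ.+ i) ℕ.* suc k) (ℕₚ.≤-trans (s≤s (ℕₚ.m≤n+m i d)) (ℕₚ.m≤m*n (suc (d ℕ.+ i)) (suc k)))) i ℕₚ.≤-refl)
    (≡.trans (⊛-identityʳ (prodTo (suc k) (d ℕ.+ i)) i) (go d))

-- Parity of exponents and the substitution of q² for q.

data Parity : ℕ → Set where
  even : ∀ m → Parity (m ℕ.+ m)
  odd  : ∀ m → Parity (suc (m ℕ.+ m))

parity : ∀ n → Parity n
parity zero    = even 0
parity (suc n) with parity n
... | even m = odd m
... | odd m  = ≡.subst Parity (≡.cong suc (ℕₚ.+-suc m m)) (even (suc m))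

OddFree : ℕ → Series → Set
OddFree N x = ∀ n → suc (n ℕ.+ n) ℕ.≤ N → x (suc (n ℕ.+ n)) ≡ + 0

-- Of two indices with an odd sum, one is odd.
OddFree-⊛ : ∀ {N x y} → OddFree N x → OddFree N y → OddFree N (x ⊛ y)
OddFree-⊛ {N} {x} {y} x-odd y-odd n n≤N = sumℤ-zero (suc (n ℕ.+ n)) term
  where
  term : ∀ i → i ℕ.≤ suc (n ℕ.+ n) → x i ℤ.* y (suc (n ℕ.+ n) ℕ.∸ i) ≡ + 0
  term i i≤ with parity i
  ... | odd m  = ≡.trans (≡.cong (ℤ._* y (suc (n ℕ.+ n) ℕ.∸ suc (m ℕ.+ m))) (x-odd m (ℕₚ.≤-trans i≤ n≤N))) (ℤₚ.*-zeroˡ (y (suc (n ℕ.+ n) ℕ.∸ suc (m ℕ.+ m))))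
  ... | even m = ≡.trans (≡.cong (x (m ℕ.+ m) ℤ.*_) (≡.trans (≡.cong y complement)
                   (y-odd (n ℕ.∸ m) (ℕₚ.≤-trans (ℕₚ.≤-reflexive (≡.sym complement)) (ℕₚ.≤-trans (ℕₚ.m∸n≤m (suc (n ℕ.+ n)) (m ℕ.+ m)) n≤N)))))
                   (ℤₚ.*-zeroʳ (x (m ℕ.+ m)))
    where
    m≤n : m ℕ.≤ n
    m≤n with m ℕ.≤? n
    ... | yes m≤n = m≤n
    ... | no  m≰n = contradiction
      (ℕₚ.≤-trans (≡.subst (ℕ._≤ m ℕ.+ m) (≡.cong suc (ℕₚ.+-suc n n)) (ℕₚ.+-mono-≤ (ℕₚ.≰⇒> m≰n) (ℕₚ.≰⇒> m≰n))) i≤) ℕₚ.1+n≰n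
    complement : suc (n ℕ.+ n) ℕ.∸ (m ℕ.+ m) ≡ suc ((n ℕ.∸ m) ℕ.+ (n ℕ.∸ m))
    complement = ≡.trans (≡.cong (ℕ._∸ (m ℕ.+ m)) (≡.cong₂ (λ a b → suc (a ℕ.+ b)) (≡.sym (ℕₚ.m∸n+n≡m m≤n)) (≡.sym (ℕₚ.m∸n+n≡m m≤n))))
      (≡.trans (≡.cong (ℕ._∸ (m ℕ.+ m))
        (ℕ-solve 2 (λ d m → conⁿ 1 :+ⁿ ((d :+ⁿ m) :+ⁿ (d :+ⁿ m)) :=ⁿ (conⁿ 1 :+ⁿ (d :+ⁿ d)) :+ⁿ (m :+ⁿ m)) ≡.refl (n ℕ.∸ m) m))
        (ℕₚ.m+n∸n≡m _ (m ℕ.+ m)))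

fromℤ-⊛ : ∀ N n x i → (fromℤ (truncatedSeries N) (+ n) ⊛ x) i ≡ + n ℤ.* x i
fromℤ-⊛ N zero          x i = ≡.trans (⊛-zeroˡ x i) (≡.sym (ℤₚ.*-zeroˡ (x i)))
fromℤ-⊛ N (suc zero)    x i = ≡.trans (⊛-identityˡ x i) (≡.sym (ℤₚ.*-identityˡ (x i)))
fromℤ-⊛ N (suc (suc n)) x i = ≡.trans (⊛-distribʳ x (fromℤ (truncatedSeries N) (+ suc n)) one i)
  (≡.trans (≡.cong₂ ℤ._+_ (fromℤ-⊛ N (suc n) x i) (⊛-identityˡ x i))
    (ℤ-solve 2 (λ n x → (conᶻ (+ 1) :+ᶻ n) :*ᶻ x :+ᶻ x :=ᶻ (conᶻ (+ 2) :+ᶻ n) :*ᶻ x) ≡.refl (+ n) (x i)))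

-- The relation a′(q) = a(q²). As a relation it applies directly to a pair such as `f 3` and `f 6`,
-- without a substituted series in between.
record _↦_ (a a′ : Series) : Set where
  field
    at-even : ∀ n → a′ (n ℕ.+ n) ≡ a n
    at-odd  : ∀ n → a′ (suc (n ℕ.+ n)) ≡ + 0

open _↦_

oddPart evenPart : Series → Series
oddPart  x n = x (suc (n ℕ.+ n))
evenPart x n = x (n ℕ.+ n)

2+n+n : ∀ n → suc n ℕ.+ suc n ≡ suc (suc (n ℕ.+ n))
2+n+n n = ≡.cong suc (ℕₚ.+-suc n n)

↦-tail : ∀ {a a′} → a ↦ a′ → tail a ↦ tail (tail a′)
↦-tail {a} {a′} d = record
  { at-even = λ n → ≡.trans (≡.cong a′ (≡.sym (2+n+n n))) (at-even d (suc n))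
  ; at-odd  = λ n → ≡.trans (≡.cong (λ k → a′ (suc k)) (≡.sym (2+n+n n))) (at-odd d (suc n)) }

↦-⊛-step : ∀ {a a′} → a ↦ a′ → ∀ x n → (a′ ⊛ x) (suc (suc n)) ≡ a 0 ℤ.* x (suc (suc n)) ℤ.+ (tail (tail a′) ⊛ x) n
↦-⊛-step {a} {a′} d x n = ≡.trans (⊛-head a′ x (suc n)) (≡.cong₂ ℤ._+_
  (≡.cong (ℤ._* x (suc (suc n))) (at-even d 0))
  (≡.trans (⊛-head (tail a′) x n) (≡.trans
    (≡.cong (λ z → z ℤ.* x (suc n) ℤ.+ (tail (tail a′) ⊛ x) n) (at-odd d 0))
    (≡.trans (≡.cong (ℤ._+ (tail (tail a′) ⊛ x) n) (ℤₚ.*-zeroˡ (x (suc n)))) (ℤₚ.+-identityˡ _)))))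

⊛-evenPart : ∀ {a a′} → a ↦ a′ → ∀ x n → evenPart (a′ ⊛ x) n ≡ (a ⊛ evenPart x) n
⊛-evenPart d x zero    = ≡.cong (ℤ._* x 0) (at-even d 0)
⊛-evenPart {a} {a′} d x (suc n) = ≡.trans (≡.cong (a′ ⊛ x) (2+n+n n)) (≡.trans (↦-⊛-step d x (n ℕ.+ n))
  (≡.trans (≡.cong₂ (λ k z → a 0 ℤ.* x k ℤ.+ z) (≡.sym (2+n+n n)) (⊛-evenPart (↦-tail d) x n)) (≡.sym (⊛-head a (evenPart x) n))))

-- Multiplication by a(q²) commutes with the extraction of odd coefficients, up to replacing q² by
-- q. This turns a dissection into an identity for the progression.
⊛-oddPart : ∀ {a a′} → a ↦ a′ → ∀ x n → oddPart (a′ ⊛ x) n ≡ (a ⊛ oddPart x) n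
⊛-oddPart {a} {a′} d x zero = ≡.trans
  (≡.cong₂ ℤ._+_ (≡.cong (ℤ._* x 1) (at-even d 0)) (≡.trans (≡.cong (ℤ._* x 0) (at-odd d 0)) (ℤₚ.*-zeroˡ (x 0))))
  (ℤₚ.+-identityʳ (a 0 ℤ.* x 1))
⊛-oddPart {a} {a′} d x (suc n) = ≡.trans (≡.cong (λ k → (a′ ⊛ x) (suc k)) (2+n+n n)) (≡.trans (↦-⊛-step d x (suc (n ℕ.+ n)))
  (≡.trans (≡.cong₂ (λ k z → a 0 ℤ.* x (suc k) ℤ.+ z) (≡.sym (2+n+n n)) (⊛-oddPart (↦-tail d) x n)) (≡.sym (⊛-head a (oddPart x) n))))

_↦⊛_ : ∀ {a a′ b b′} → a ↦ a′ → b ↦ b′ → (a ⊛ b) ↦ (a′ ⊛ b′)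
_↦⊛_ {a} {a′} {b} {b′} d d′ = record
  { at-even = λ n → ≡.trans (⊛-evenPart d b′ n) (⊛-cong {n} {a} (λ _ _ → ≡.refl) (λ i _ → at-even d′ i) n ℕₚ.≤-refl)
  ; at-odd  = λ n → ≡.trans (⊛-oddPart d b′ n)
      (sumℤ-zero n (λ i _ → ≡.trans (≡.cong (a i ℤ.*_) (at-odd d′ (n ℕ.∸ i))) (ℤₚ.*-zeroʳ (a i)))) }

one-↦ : one ↦ one
one-↦ = record { at-even = λ { zero → ≡.refl ; (suc n) → ≡.refl } ; at-odd = λ _ → ≡.refl }

q^-↦ : ∀ k → q^ k ↦ q^ (k ℕ.+ k)
q^-↦ zero    = one-↦
q^-↦ (suc k) = ≡.subst (q^ (suc k) ↦_) (≡.cong q^ (≡.sym (2+n+n k))) (record { at-even = ev ; at-odd = od })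
  where
  open _↦_ (q^-↦ k) renaming (at-even to IH-even; at-odd to IH-odd)
  ev : ∀ n → (q ⊛ (q ⊛ q^ (k ℕ.+ k))) (n ℕ.+ n) ≡ (q ⊛ q^ k) n
  ev zero    = ≡.trans (q⊛-zero (q ⊛ q^ (k ℕ.+ k))) (≡.sym (q⊛-zero (q^ k)))
  ev (suc n) = ≡.trans (≡.cong (q ⊛ (q ⊛ q^ (k ℕ.+ k))) (2+n+n n))
    (≡.trans (q⊛-suc (q ⊛ q^ (k ℕ.+ k)) (suc (n ℕ.+ n))) (≡.trans (q⊛-suc (q^ (k ℕ.+ k)) (n ℕ.+ n)) (≡.trans (IH-even n) (≡.sym (q⊛-suc (q^ k) n)))))
  od : ∀ n → (q ⊛ (q ⊛ q^ (k ℕ.+ k))) (suc (n ℕ.+ n)) ≡ + 0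
  od zero    = ≡.trans (q⊛-suc (q ⊛ q^ (k ℕ.+ k)) 0) (q⊛-zero (q^ (k ℕ.+ k)))
  od (suc n) = ≡.trans (≡.cong (λ m → (q ⊛ (q ⊛ q^ (k ℕ.+ k))) (suc m)) (2+n+n n))
    (≡.trans (q⊛-suc (q ⊛ q^ (k ℕ.+ k)) (suc (suc (n ℕ.+ n)))) (≡.trans (q⊛-suc (q^ (k ℕ.+ k)) (suc (n ℕ.+ n))) (IH-odd n)))

oneMinusQ^-↦ : ∀ k → oneMinusQ^ (suc k) ↦ oneMinusQ^ (suc k ℕ.+ suc k)
oneMinusQ^-↦ k = record
  { at-even = λ n → ≡.trans (oneMinusQ^≡ (k ℕ.+ suc k) (n ℕ.+ n))
      (≡.trans (≡.cong₂ ℤ._-_ (at-even one-↦ n) (at-even (q^-↦ (suc k)) n)) (≡.sym (oneMinusQ^≡ k n)))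
  ; at-odd = λ n → ≡.trans (oneMinusQ^≡ (k ℕ.+ suc k) (suc (n ℕ.+ n)))
      (≡.cong₂ ℤ._-_ (at-odd one-↦ n) (at-odd (q^-↦ (suc k)) n)) }

prodTo-↦ : ∀ k n → prodTo (suc k) n ↦ prodTo (suc k ℕ.+ suc k) n
prodTo-↦ k zero    = one-↦
prodTo-↦ k (suc n) = prodTo-↦ k n ↦⊛
  ≡.subst (λ m → oneMinusQ^ (suc n ℕ.* suc k) ↦ oneMinusQ^ m) (≡.sym (ℕₚ.*-distribˡ-+ (suc n) (suc k) (suc k)))
    (oneMinusQ^-↦ (k ℕ.+ n ℕ.* suc k))

f-↦ : ∀ k → f (suc k) ↦ f (suc k ℕ.+ suc k)
f-↦ k = record
  { at-even = λ n → ≡.trans (at-even (prodTo-↦ k (n ℕ.+ n)) n) (prodTo≈f k (ℕₚ.m≤m+n n n) n ℕₚ.≤-refl)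
  ; at-odd  = λ n → at-odd (prodTo-↦ k (suc (n ℕ.+ n))) n }

-- The abstract dissections applied to truncated series.

module Truncated (N : ℕ) where

  R : CommutativeRing _ _
  R = truncatedSeries N

  open CommutativeRing R using (refl; sym; trans; reflexive; *-cong; +-congˡ; -‿cong)
  open Exp (CommutativeRing.commutativeSemiring R) using (_^_; ^-assocʳ)

  ^≡q^ : ∀ k → q ^ k ≡ q^ k
  ^≡q^ zero    = ≡.refl
  ^≡q^ (suc k) = ≡.cong (q ⊛_) (^≡q^ k)

  nil : Nilpotent R q (suc N)
  nil k N<k i i≤N = ≡.trans (≡.cong (λ x → x i) (^≡q^ k)) (q^-low k (ℕₚ.≤-trans (s≤s i≤N) N<k))

  open Dissections R {M = suc N} nil public

  E≈f : ∀ k → E (suc k) ≈[ N ] f (suc k)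
  E≈f k = trans (go (suc N)) (prodTo≈f k (ℕₚ.n≤1+n N))
    where
    factor : ∀ i → (one ⊞ (⊟ ((q ^ suc k) ^ suc i))) ≈[ N ] oneMinusQ^ (suc i ℕ.* suc k)
    factor i = trans
      (+-congˡ {one} (-‿cong {(q ^ suc k) ^ suc i} (trans (^-assocʳ q (suc k) (suc i))
        (reflexive (≡.trans (^≡q^ (suc k ℕ.* suc i)) (≡.cong q^ (ℕₚ.*-comm (suc k) (suc i))))))))
      (λ j _ → ≡.sym (oneMinusQ^≡ (k ℕ.+ i ℕ.* suc k) j))
    go : ∀ n → Πⁿ R n (λ i → one ⊞ (⊟ ((q ^ suc k) ^ suc i))) ≈[ N ] prodTo (suc k) n
    go zero    = refl
    go (suc n) = *-cong {Πⁿ R n (λ i → one ⊞ (⊟ ((q ^ suc k) ^ suc i)))} (go n) (factor n)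

  Even⇒OddFree : ∀ {x} → Even x → OddFree N x
  Even⇒OddFree 1ᵉ       n _ = ≡.refl
  Even⇒OddFree q²ᵉ      n _ = at-odd (q^-↦ 1) n
  Even⇒OddFree (a +ᵉ b) n n≤N = ≡.cong₂ ℤ._+_ (Even⇒OddFree a n n≤N) (Even⇒OddFree b n n≤N)
  Even⇒OddFree (_*ᵉ_ {x} {y} a b) = OddFree-⊛ {N} {x} {y} (Even⇒OddFree a) (Even⇒OddFree b)
  Even⇒OddFree (-ᵉ a)   n n≤N = ≡.cong ℤ.-_ (Even⇒OddFree a n n≤N)
  Even⇒OddFree (resp x≈y a) n n≤N = ≡.trans (≡.sym (x≈y _ n≤N)) (Even⇒OddFree a n n≤N)

-- Partitions without parts divisible by 9

sumℕ-head : ∀ n g → sumℕ (suc n) g ≡ g 0 ℕ.+ sumℕ n (λ i → g (suc i))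
sumℕ-head zero    g = ≡.refl
sumℕ-head (suc n) g = ≡.trans (≡.cong (ℕ._+ g (suc (suc n))) (sumℕ-head n g)) (ℕₚ.+-assoc (g 0) _ _)

sumℕ-cong : ∀ n {g h} → (∀ i → g i ≡ h i) → sumℕ n g ≡ sumℕ n h
sumℕ-cong zero    g≡h = g≡h 0
sumℕ-cong (suc n) g≡h = ≡.cong₂ ℕ._+_ (sumℕ-cong n g≡h) (g≡h (suc n))

count-∣ : ∀ n m → 9 ∣ suc m → count n (suc m) ≡ count n m
count-∣ zero m 9∣ with 9 ∣? suc m
... | yes _ = ≡.refl
... | no 9∤ = contradiction 9∣ 9∤
count-∣ (suc n) m 9∣ with 9 ∣? suc m
... | yes _ = ≡.refl
... | no 9∤ = contradiction 9∣ 9∤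

count-∤ : ∀ n m → ¬ 9 ∣ suc m → count n (suc m) ≡ sumℕ (n ℕ./ suc m) (λ t → count (n ℕ.∸ t ℕ.* suc m) m)
count-∤ zero m 9∤ with 9 ∣? suc m
... | yes 9∣ = contradiction 9∣ 9∤
... | no _ = ≡.refl
count-∤ (suc n) m 9∤ with 9 ∣? suc m
... | yes 9∣ = contradiction 9∣ 9∤
... | no _ = ≡.refl

count-small : ∀ n m → n ℕ.< suc m → count n (suc m) ≡ count n m
count-small n m n<m with 9 ∣? suc m
... | yes 9∣ = count-∣ n m 9∣
... | no 9∤ = ≡.trans (count-∤ n m 9∤) (≡.cong (λ k → sumℕ k (λ t → count (n ℕ.∸ t ℕ.* suc m) m)) (m<n⇒m/n≡0 n<m))

-- Either no part equals m + 1, or one such part can be removed. In the defining sum the term of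
-- multiplicity 0 splits off and the remaining multiplicities drop by one.
count-large : ∀ n m → ¬ 9 ∣ suc m → count (suc m ℕ.+ n) (suc m) ≡ count (suc m ℕ.+ n) m ℕ.+ count n (suc m)
count-large n m 9∤ = ≡.trans (count-∤ (suc m ℕ.+ n) m 9∤)
  (≡.trans (≡.cong (λ k → sumℕ k (λ t → count (suc m ℕ.+ n ℕ.∸ t ℕ.* suc m) m)) quotient)
  (≡.trans (sumℕ-head (n ℕ./ suc m) (λ t → count (suc m ℕ.+ n ℕ.∸ t ℕ.* suc m) m))
  (≡.cong (count (suc m ℕ.+ n) m ℕ.+_) (≡.trans
    (sumℕ-cong (n ℕ./ suc m) (λ t → ≡.cong (λ k → count k m) (ℕₚ.[m+n]∸[m+o]≡n∸o (suc m) n (t ℕ.* suc m))))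
    (≡.sym (count-∤ n m 9∤))))))
  where
  quotient : (suc m ℕ.+ n) ℕ./ suc m ≡ suc (n ℕ./ suc m)
  quotient = ≡.trans (m/n≡1+[m∸n]/n (ℕₚ.m≤m+n (suc m) n)) (≡.cong (λ k → suc (k ℕ./ suc m)) (ℕₚ.m+n∸m≡n (suc m) n))

count-stable : ∀ n d → count n (d ℕ.+ n) ≡ b₉ n
count-stable n zero    = ≡.refl
count-stable n (suc d) = ≡.trans (count-small n (d ℕ.+ n) (s≤s (ℕₚ.m≤n+m n d))) (count-stable n d)

counts : ℕ → Series
counts m n = + count n m

-- The generating function form of `count-small` and `count-large`: multiplication by 1 - q^(m+1)
-- removes the part m + 1.
counts-⊛ : ∀ m → ¬ 9 ∣ suc m → ∀ n → (counts (suc m) ⊛ oneMinusQ^ (suc m)) n ≡ counts m n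
counts-⊛ m 9∤ n = begin
  (c ⊛ oneMinusQ^ (suc m)) n                   ≡⟨ ⊛-comm c (oneMinusQ^ (suc m)) n ⟩
  (oneMinusQ^ (suc m) ⊛ c) n                   ≡⟨ ⊛-cong {n} {oneMinusQ^ (suc m)} {b = c} (λ i _ → oneMinusQ^≡ m i) (λ _ _ → ≡.refl) n ℕₚ.≤-refl ⟩
  ((one ⊞ (⊟ (q^ (suc m)))) ⊛ c) n             ≡⟨ ⊛-distribʳ c one (⊟ (q^ (suc m))) n ⟩
  (one ⊛ c) n ℤ.+ ((⊟ (q^ (suc m))) ⊛ c) n
    ≡⟨ ≡.cong₂ ℤ._+_ (⊛-identityˡ c n) (≡.trans
         (⊛-cong {n} {⊟ (q^ (suc m))} {(ℤ.- + 1) ·ˢ q^ (suc m)} {c} (λ i _ → ≡.sym (ℤₚ.-1*i≡-i (q^ (suc m) i))) (λ _ _ → ≡.refl) n ℕₚ.≤-refl)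
         (≡.trans (⊛-scale (ℤ.- + 1) (q^ (suc m)) c n) (ℤₚ.-1*i≡-i _))) ⟩
  c n ℤ.- (q^ (suc m) ⊛ c) n                   ≡⟨ remove ⟩
  counts m n                                   ∎
  where
  open ≡.≡-Reasoning
  c : Series
  c = counts (suc m)
  remove : c n ℤ.- (q^ (suc m) ⊛ c) n ≡ counts m n
  remove with n ℕ.<? suc m
  ... | yes n<m = ≡.trans (≡.cong₂ ℤ._-_ (≡.cong +_ (count-small n m n<m)) (q^⊛-low (suc m) c n<m)) (ℤₚ.+-identityʳ _)
  ... | no  n≮m = ≡.subst (λ n → c n ℤ.- (q^ (suc m) ⊛ c) n ≡ counts m n) (ℕₚ.m+[n∸m]≡n (ℕₚ.≮⇒≥ n≮m)) (shifted (n ℕ.∸ suc m))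
    where
    shifted : ∀ k → c (suc m ℕ.+ k) ℤ.- (q^ (suc m) ⊛ c) (suc m ℕ.+ k) ≡ counts m (suc m ℕ.+ k)
    shifted k = ≡.trans (≡.cong₂ ℤ._-_ (≡.cong +_ (count-large k m 9∤)) (q^⊛-shift (suc m) c k))
      (ℤ-solve 2 (λ x y → (x :+ᶻ y) :-ᶻ y :=ᶻ x) ≡.refl (counts m (suc m ℕ.+ k)) (c k))

counts-zero : ∀ n → counts 0 n ≡ one n
counts-zero zero    = ≡.refl
counts-zero (suc n) = ≡.refl

-- Parts are treated in blocks of nine. Eight of them cancel against their factors of the product;
-- the ninth is a multiple of 9 and not allowed as a part, so its factor survives and extends
-- `prodTo 9`.
counts-prodTo : ∀ j n → (counts (j ℕ.* 9) ⊛ prodTo 1 (j ℕ.* 9)) n ≡ prodTo 9 j n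
counts-prodTo zero    n = ≡.trans (⊛-identityʳ (counts 0) n) (counts-zero n)
counts-prodTo (suc j) n = begin
  (counts (9 ℕ.+ m) ⊛ prodTo 1 (9 ℕ.+ m)) n
    ≡⟨ ⊛-assoc (counts (9 ℕ.+ m)) (prodTo 1 (8 ℕ.+ m)) (oneMinusQ^ ((9 ℕ.+ m) ℕ.* 1)) n ⟨
  ((counts (9 ℕ.+ m) ⊛ prodTo 1 (8 ℕ.+ m)) ⊛ oneMinusQ^ ((9 ℕ.+ m) ℕ.* 1)) n
    ≡⟨ ⊛-cong {n} {counts (9 ℕ.+ m) ⊛ prodTo 1 (8 ℕ.+ m)}
         (λ i _ → ≡.trans (⊛-cong {i} {counts (9 ℕ.+ m)} {b = prodTo 1 (8 ℕ.+ m)} (λ l _ → ≡.cong +_ (count-∣ l (8 ℕ.+ m) 9∣9+m)) (λ _ _ → ≡.refl) i ℕₚ.≤-refl)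
           (≡.trans (descend 8 ℕₚ.≤-refl i) (counts-prodTo j i)))
         (λ i _ → ≡.cong (λ k → oneMinusQ^ k i) (ℕₚ.*-identityʳ (9 ℕ.+ m))) n ℕₚ.≤-refl ⟩
  (prodTo 9 j ⊛ oneMinusQ^ (9 ℕ.+ m)) n ∎
  where
  open ≡.≡-Reasoning
  m : ℕ
  m = j ℕ.* 9
  9∣9+m : 9 ∣ 9 ℕ.+ m
  9∣9+m = n∣m*n (suc j)
  descend : ∀ d → d ℕ.≤ 8 → ∀ i → (counts (d ℕ.+ m) ⊛ prodTo 1 (d ℕ.+ m)) i ≡ (counts m ⊛ prodTo 1 m) i
  descend zero    _   i = ≡.refl
  descend (suc d) d<9 i = begin
    (C ⊛ (P ⊛ O)) i          ≡⟨ ⊛-cong {i} {C} (λ _ _ → ≡.refl) (λ k _ → ⊛-comm P O k) i ℕₚ.≤-refl ⟩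
    (C ⊛ (O ⊛ P)) i          ≡⟨ ⊛-assoc C O P i ⟨
    ((C ⊛ O) ⊛ P) i          ≡⟨ ⊛-cong {i} {C ⊛ O} {b = P} (λ k _ → ≡.trans
      (⊛-cong {k} {C} (λ _ _ → ≡.refl) (λ l _ → ≡.cong (λ e → oneMinusQ^ e l) (ℕₚ.*-identityʳ (suc d ℕ.+ m))) k ℕₚ.≤-refl)
      (counts-⊛ (d ℕ.+ m) 9∤ k)) (λ _ _ → ≡.refl) i ℕₚ.≤-refl ⟩
    (counts (d ℕ.+ m) ⊛ P) i ≡⟨ descend d (ℕₚ.≤-trans (ℕₚ.n≤1+n d) d<9) i ⟩
    (counts m ⊛ prodTo 1 m) i ∎
    where
    C P O : Series
    C = counts (suc d ℕ.+ m)
    P = prodTo 1 (d ℕ.+ m)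
    O = oneMinusQ^ ((suc d ℕ.+ m) ℕ.* 1)
    9∤ : ¬ 9 ∣ suc (d ℕ.+ m)
    9∤ 9∣ = ℕₚ.<⇒≱ (s≤s d<9) (∣⇒≤ (∣m+n∣m⇒∣n (≡.subst (9 ∣_) (ℕₚ.+-comm (suc d) m) 9∣) (n∣m*n j)))

b : Series
b n = + b₉ n

b⊛f₁ : ∀ n → (b ⊛ f 1) n ≡ f 9 n
b⊛f₁ n = begin
  (b ⊛ f 1) n                                ≡⟨ ⊛-cong {n} {counts m} (λ i i≤n → ≡.cong +_ (stable i i≤n)) (prodTo≈f 0 n≤m) n ℕₚ.≤-refl ⟨
  (counts m ⊛ prodTo 1 m) n                  ≡⟨ counts-prodTo n n ⟩
  f 9 n                                      ∎
  where
  open ≡.≡-Reasoning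
  m : ℕ
  -- A complete number of blocks that is at least n: up to degree n both the counts and the product
  -- have stabilised, and n blocks leave exactly the n factors of `f 9 n`.
  m = n ℕ.* 9
  n≤m : n ℕ.≤ m
  n≤m = ℕₚ.m≤m*n n 9
  stable : ∀ i → i ℕ.≤ n → count i m ≡ b₉ i
  stable i i≤n = ≡.trans (≡.cong (count i) (≡.sym (ℕₚ.m∸n+n≡m (ℕₚ.≤-trans i≤n n≤m)))) (count-stable i (m ℕ.∸ i))

-- conv is private to Defs; its name is recovered by unification.
mutual
  conv′ : Series → ℕ → List ℤ → ℤ
  conv′ = _

  invL-suc : ∀ a n → invL a (suc n) ≡ (ℤ.- conv′ a 0 (invL a n)) ∷ invL a n
  invL-suc a n with invL a n | zero
  ... | xs | j = ≡.refl

-- The list runs from the coefficient of index n of the inverse down to index 0, so pairing it with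
-- x(j + 1), x(j + 2), ... is a convolution. The offset j moves as the list shortens, and separating
-- x from the inverted series keeps the induction free.
conv′-invL : ∀ a x j n → conv′ x j (invL a n) ≡ ((λ i → x (suc j ℕ.+ i)) ⊛ inv a) n
conv′-invL a x j zero    = ≡.trans (ℤₚ.+-identityʳ _) (≡.cong (λ k → x k ℤ.* + 1) (≡.sym (ℕₚ.+-identityʳ (suc j))))
conv′-invL a x j (suc n) = ≡.trans
  (≡.cong₂ (λ k z → x k ℤ.* inv a (suc n) ℤ.+ z) (≡.sym (ℕₚ.+-identityʳ (suc j)))
    (≡.trans (conv′-invL a x (suc j) n)
      (⊛-cong {n} {λ i → x (suc (suc j) ℕ.+ i)} {b = inv a} (λ i _ → ≡.cong x (≡.sym (ℕₚ.+-suc (suc j) i))) (λ _ _ → ≡.refl) n ℕₚ.≤-refl)))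
  (≡.sym (⊛-head (λ i → x (suc j ℕ.+ i)) (inv a) n))

⊛-inv : ∀ a → a 0 ≡ + 1 → ∀ n → (a ⊛ inv a) n ≡ one n
⊛-inv a a₀≡1 zero    = ≡.cong (ℤ._* + 1) a₀≡1
⊛-inv a a₀≡1 (suc n) = ≡.trans (⊛-head a (inv a) n) (≡.trans
  (≡.cong₂ (λ x y → x ℤ.* inv a (suc n) ℤ.+ y) a₀≡1 (≡.sym (conv′-invL a a 0 n)))
  (ℤ-solve 1 (λ x → conᶻ (+ 1) :*ᶻ (:-ᶻ x) :+ᶻ x :=ᶻ conᶻ (+ 0)) ≡.refl (conv′ a 0 (invL a n))))

-- Extracting the progressions 2n + 1 and 4n + 3

c d : Series
c = oddPart b
d = oddPart c

-- This is coefficient 2n + 1 of the first dissection, in the ring truncated exactly there. The even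
-- part contributes zero, and the factor 4 is retained until both sides are integers.
b-dissected : ∀ n → + 4 ℤ.* ((f 1 ⊛ f 1 ⊛ f 1 ⊛ f 3 ⊛ f 6) ⊛ c) n ≡ + 4 ℤ.* (f 2 ⊛ f 2 ⊛ f 3 ⊛ f 3 ⊛ f 18) n
b-dissected n = begin
  + 4 ℤ.* ((f 1 ⊛ f 1 ⊛ f 1 ⊛ f 3 ⊛ f 6) ⊛ c) n
    ≡⟨ ≡.cong (+ 4 ℤ.*_) (⊛-oddPart ((((f-↦ 0 ↦⊛ f-↦ 0) ↦⊛ f-↦ 0) ↦⊛ f-↦ 2) ↦⊛ f-↦ 5) b n) ⟨
  + 4 ℤ.* (f 2 ⊛ f 2 ⊛ f 2 ⊛ f 6 ⊛ f 12 ⊛ b) (suc (n ℕ.+ n))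
    ≡⟨ fromℤ-⊛ N 4 (f 2 ⊛ f 2 ⊛ f 2 ⊛ f 6 ⊛ f 12 ⊛ b) N ⟨
  (4# ⊛ (f 2 ⊛ f 2 ⊛ f 2 ⊛ f 6 ⊛ f 12 ⊛ b)) N
    ≡⟨ first-dissection-F b (λ i _ → b⊛f₁ i) N ℕₚ.≤-refl ⟩
  proj₁ first-dissection N ℤ.+ (4# ⊛ (q ⊛ (f 4 ⊛ f 4 ⊛ f 6 ⊛ f 6 ⊛ f 36))) N
    ≡⟨ ≡.cong₂ ℤ._+_ (Even⇒OddFree (proj₁ (proj₂ first-dissection)) n ℕₚ.≤-refl) (fromℤ-⊛ N 4 (q ⊛ (f 4 ⊛ f 4 ⊛ f 6 ⊛ f 6 ⊛ f 36)) N) ⟩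
  + 0 ℤ.+ + 4 ℤ.* (q ⊛ (f 4 ⊛ f 4 ⊛ f 6 ⊛ f 6 ⊛ f 36)) N
    ≡⟨ ℤₚ.+-identityˡ _ ⟩
  + 4 ℤ.* (q ⊛ (f 4 ⊛ f 4 ⊛ f 6 ⊛ f 6 ⊛ f 36)) N
    ≡⟨ ≡.cong (+ 4 ℤ.*_) (≡.trans (q⊛-suc (f 4 ⊛ f 4 ⊛ f 6 ⊛ f 6 ⊛ f 36) (n ℕ.+ n))
         (at-even ((((f-↦ 1 ↦⊛ f-↦ 1) ↦⊛ f-↦ 2) ↦⊛ f-↦ 2) ↦⊛ f-↦ 17) n)) ⟩
  + 4 ℤ.* (f 2 ⊛ f 2 ⊛ f 3 ⊛ f 3 ⊛ f 18) n ∎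
  where
  open ≡.≡-Reasoning
  N : ℕ
  N = suc (n ℕ.+ n)
  open Truncated N
  open WithF f E≈f

c-eta : ∀ n → (c ⊛ (f 1 ⊛ f 1 ⊛ f 1 ⊛ f 6)) n ≡ (f 2 ⊛ f 2 ⊛ f 3 ⊛ f 18) n
c-eta n = cancel-F₃ c (λ i _ → ℤₚ.*-cancelˡ-≡ (+ 4) _ _ (b-dissected i)) n ℕₚ.≤-refl
  where
  open Truncated n
  open WithF f E≈f

c-dissected : ∀ n → + 4 ℤ.* ((f 1 ⊛ f 1 ⊛ f 1 ⊛ f 1 ⊛ f 1) ⊛ d) n ≡ + 12 ℤ.* (f 6 ⊛ f 6 ⊛ f 2 ⊛ f 2 ⊛ f 9) n
c-dissected n = begin
  + 4 ℤ.* ((f 1 ⊛ f 1 ⊛ f 1 ⊛ f 1 ⊛ f 1) ⊛ d) n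
    ≡⟨ ≡.cong (+ 4 ℤ.*_) (⊛-oddPart ((((f-↦ 0 ↦⊛ f-↦ 0) ↦⊛ f-↦ 0) ↦⊛ f-↦ 0) ↦⊛ f-↦ 0) c n) ⟨
  + 4 ℤ.* (f 2 ⊛ f 2 ⊛ f 2 ⊛ f 2 ⊛ f 2 ⊛ c) (suc (n ℕ.+ n))
    ≡⟨ fromℤ-⊛ N 4 (f 2 ⊛ f 2 ⊛ f 2 ⊛ f 2 ⊛ f 2 ⊛ c) N ⟨
  (4# ⊛ (f 2 ⊛ f 2 ⊛ f 2 ⊛ f 2 ⊛ f 2 ⊛ c)) N
    ≡⟨ second-dissection-F c (λ i _ → c-eta i) N ℕₚ.≤-refl ⟩
  proj₁ second-dissection N ℤ.+ (12# ⊛ (q ⊛ (f 12 ⊛ f 12 ⊛ f 4 ⊛ f 4 ⊛ f 18))) N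
    ≡⟨ ≡.cong₂ ℤ._+_ (Even⇒OddFree (proj₁ (proj₂ second-dissection)) n ℕₚ.≤-refl) (fromℤ-⊛ N 12 (q ⊛ (f 12 ⊛ f 12 ⊛ f 4 ⊛ f 4 ⊛ f 18)) N) ⟩
  + 0 ℤ.+ + 12 ℤ.* (q ⊛ (f 12 ⊛ f 12 ⊛ f 4 ⊛ f 4 ⊛ f 18)) N
    ≡⟨ ℤₚ.+-identityˡ _ ⟩
  + 12 ℤ.* (q ⊛ (f 12 ⊛ f 12 ⊛ f 4 ⊛ f 4 ⊛ f 18)) N
    ≡⟨ ≡.cong (+ 12 ℤ.*_) (≡.trans (q⊛-suc (f 12 ⊛ f 12 ⊛ f 4 ⊛ f 4 ⊛ f 18) (n ℕ.+ n))
         (at-even ((((f-↦ 5 ↦⊛ f-↦ 5) ↦⊛ f-↦ 1) ↦⊛ f-↦ 1) ↦⊛ f-↦ 8) n)) ⟩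
  + 12 ℤ.* (f 6 ⊛ f 6 ⊛ f 2 ⊛ f 2 ⊛ f 9) n ∎
  where
  open ≡.≡-Reasoning
  N : ℕ
  N = suc (n ℕ.+ n)
  open Truncated N
  open WithF f E≈f

d-eta : ∀ n → ((f 1 ⊛ f 1 ⊛ f 1 ⊛ f 1 ⊛ f 1) ⊛ d) n ≡ + 3 ℤ.* (f 6 ⊛ f 6 ⊛ f 2 ⊛ f 2 ⊛ f 9) n
d-eta n = ℤₚ.*-cancelˡ-≡ (+ 4) _ _ (≡.trans (c-dissected n) (ℤₚ.*-assoc (+ 4) (+ 3) _))

d≡ : ∀ n → d n ≡ ((+ 3) ·ˢ ((f 2 ^ˢ 2) ⊛ (f 6 ^ˢ 2) ⊛ f 9 ⊛ inv (f 1 ^ˢ 5))) n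
d≡ n = ≡.trans
  (quotient (f 1) (f 2) (f 6) (f 9) d (inv (f 1 ^ˢ 5))
    (λ i _ → ≡.trans (d-eta i) (≡.sym (fromℤ-⊛ n 3 (f 6 ⊛ f 6 ⊛ f 2 ⊛ f 2 ⊛ f 9) i)))
    -- The constant term of `f 1 ^ˢ 5` evaluates to 1.
    (λ i _ → ⊛-inv (f 1 ^ˢ 5) ≡.refl i) n ℕₚ.≤-refl)
  (fromℤ-⊛ n 3 ((f 2 ^ˢ 2) ⊛ (f 6 ^ˢ 2) ⊛ f 9 ⊛ inv (f 1 ^ˢ 5)) n)
  where open Truncated n

open import Data.Nat using (_+_; _*_)

theorem1p7 : ((n : ℕ) → + b₉ (4 * n + 3)
    ≡ ((+ 3) ·ˢ ((f 2 ^ˢ 2) ⊛ (f 6 ^ˢ 2) ⊛ f 9 ⊛ inv (f 1 ^ˢ 5))) n)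
    × ((n : ℕ) → 3 ∣ b₉ (4 * n + 3))
theorem1p7 = identity , λ n → divides ∣ g n ∣ (≡.trans (≡.cong ∣_∣ (identity n))
    (≡.trans (ℤₚ.abs-* (+ 3) (g n)) (ℕₚ.*-comm 3 ∣ g n ∣)))
  where
  g : Series
  g = (f 2 ^ˢ 2) ⊛ (f 6 ^ˢ 2) ⊛ f 9 ⊛ inv (f 1 ^ˢ 5)
  identity : ∀ n → + b₉ (4 * n + 3) ≡ ((+ 3) ·ˢ g) n
  identity n = ≡.trans
    -- `oddPart` applied twice reads index 2(2n + 1) + 1 = 4n + 3.
    (≡.cong (λ k → + b₉ k) (ℕ-solve 1 (λ n → conⁿ 4 :*ⁿ n :+ⁿ conⁿ 3
      :=ⁿ conⁿ 1 :+ⁿ ((conⁿ 1 :+ⁿ (n :+ⁿ n)) :+ⁿ (conⁿ 1 :+ⁿ (n :+ⁿ n)))) ≡.refl n)) (d≡ n)
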